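{- Let $\lambda=(\lambda_1\ge\cdots\ge\lambda_r>0)$ and $\mu=(\mu_1\ge\cdots\ge\mu_r\ge0)$ be partitions with $\mu_i\le\lambda_i$ for all $i$, and let $f=(f_1,\dots,f_r)$, $g=(g_1,\dots,g_r)$ be sequences of positive integers such that $f/g$ is a flagging of the skew shape $\lambda/\mu$. Then $$\widetilde{G}_{\lambda/\mu,f/g}(x)=G_{\lambda/\mu,f/g}(x).$$
   Context: Let $\lambda=(\lambda_1\ge\cdots\ge\lambda_r>0)$, $\mu=(\mu_1\ge\cdots\ge\mu_r\ge0)$ with $\mu_i\le\lambda_i$ for all $i$. The skew shape $\lambda/\mu$ is $\{(i,j):1\le i\le r,\ \mu_i<j\le\lambda_i\}$ (English notation, $i$ is the row). Given sequences of positive integers $f=(f_1,\dots,f_r)$, $g=(g_1,\dots,g_r)$, one says $f/g$ is a flagging of $\lambda/\mu$ if $g_i\le g_{i+1}$ and $f_i\le f_{i+1}$ whenever $\mu_i<\lambda_{i+1}$. $FSVT(\lambda/\mu,f/g)$ is the set of fillings $T$ of the boxes of $\lambda/\mu$ in which each box of row $i$ is filled with a non-empty subset of $\{g_i,g_i+1,\dots,f_i\}$, such that the maximum at $(i,j)$ is at most the minimum at $(i,j+1)$ whenever both boxes lie in $\lambda/\mu$, and strictly less than the minimum at $(i+1,j)$ whenever both boxes lie in $\lambda/\mu$. Define $$G_{\lambda/\mu,f/g}(x)=\sum_{T\in FSVT(\lambda/\mu,f/g)}\beta^{|T|-|\lambda/\mu|}\prod_{k\in T}x_k,$$ where $|T|$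 is the total number of entries of $T$, $|\lambda/\mu|$ the number of boxes, and the product is over all entries of $T$ (with multiplicity). For positive integers $p,q$ and $m\in\mathbb{Z}$, $G_m^{[p/q]}=G_m^{[p/q]}(x)\in\mathbb{Z}[\beta][[x]]$, $x=(x_1,x_2,\dots)$, is defined by $$\sum_{m\in\mathbb{Z}}G_m^{[p/q]}u^m=\frac{1}{1+\beta u^{ -1}}\prod_{q\le i\le p}\frac{1+\beta x_i}{1-x_iu},$$ where $\frac1{1+\beta u^{ -1}}$ is expanded in powers of $u^{ -1}$, $\frac1{1-x_iu}$ in powers of $u$, and the product is $1$ if $q>p$. Define $$\widetilde{G}_{\lambda/\mu,f/g}(x)=\det\left(\sum_{s\ge0}\binom{i-j}{s}\beta^sG^{[f_i/g_j]}_{\lambda_i-\mu_j+j-i+s}\right)_{1\le i,j\le r},$$ with $\binom{n}{s}=n(n-1)\cdots(n-s+1)/s!$ for $n\in\mathbb{Z}$, $s\ge0$. -}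

module Defs where

open import Algebra.Bundles.Raw using (RawRing)
open import Algebra.Definitions.RawSemiring using (sum; _^_)
open import Data.Fin.Base as Fin using (Fin; zero; suc; toℕ; punchIn)
open import Data.Fin.Properties using (all?; ∀-cons; toℕ≤pred[n])
open import Data.Integer.Base as ℤ using (ℤ; +_; -[1+_]; 0ℤ; 1ℤ; _⊖_)
import Data.Integer.Properties as ℤₚ
open import Data.List.Base as List
  using (List; []; _∷_; [_]; _++_; _∷ʳ_; map; foldr; length; filter; concatMap;
         allFin; applyUpTo; cartesianProductWith)
open import Data.List.NonEmpty.Base as List⁺ using (List⁺; foldr₁; toList; _∷⁺_)
open import Data.Nat.Base as ℕ
  using (ℕ; zero; suc; pred; _∸_; _≤_; _<_; _⊔_; _⊓_; _!; z≤n; s≤s)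
import Data.Nat.Properties as ℕₚ
open import Data.Product.Base using (_×_; _,_; proj₁; proj₂; ∃-syntax)
open import Level using (0ℓ)
open import Relation.Binary.PropositionalEquality
  using (_≡_; refl; sym; trans; cong; cong₂; subst)
open import Relation.Nullary.Decidable using (Dec; _×-dec_; _→-dec_)

------------------------------------------------------------------------
-- The coefficient ring ℤ[β].  A list a₀ ∷ a₁ ∷ … is a₀ + a₁β + …; trailing
-- zeros are identified by _≈ᵝ_.

ℤ[β] : Set
ℤ[β] = List ℤ

_at_ : ℤ[β] → ℕ → ℤ
[]      at _     = 0ℤ
(a ∷ p) at zero  = a
(a ∷ p) at suc n = p at n

infix 4 _≈ᵝ_
record _≈ᵝ_ (p q : ℤ[β]) : Set where
  constructor mk≈ᵝ
  field at-≡ : ∀ n → p at n ≡ q at n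
open _≈ᵝ_ public

infixl 6 _+ᵝ_
infixl 7 _*ᵝ_
_+ᵝ_ : ℤ[β] → ℤ[β] → ℤ[β]
[]      +ᵝ q       = q
(a ∷ p) +ᵝ []      = a ∷ p
(a ∷ p) +ᵝ (b ∷ q) = (a ℤ.+ b) ∷ (p +ᵝ q)

_*ᵝ_ : ℤ[β] → ℤ[β] → ℤ[β]
[]      *ᵝ q = []
(a ∷ p) *ᵝ q = map (a ℤ.*_) q +ᵝ (0ℤ ∷ (p *ᵝ q))

infix 8 -ᵝ_
-ᵝ_ : ℤ[β] → ℤ[β]
-ᵝ_ = map (λ a → ℤ.- a)

ℤ[β]-rawRing : RawRing 0ℓ 0ℓ
ℤ[β]-rawRing = record
  { Carrier = ℤ[β]
  ; _≈_     = _≈ᵝ_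
  ; _+_     = _+ᵝ_
  ; _*_     = _*ᵝ_
  ; -_      = -ᵝ_
  ; 0#      = []
  ; 1#      = [ 1ℤ ]
  }

Σᵝ : ∀ {n} → (Fin n → ℤ[β]) → ℤ[β]
Σᵝ = sum (RawRing.rawSemiring ℤ[β]-rawRing)

≈ᵝ-refl : ∀ {p} → p ≈ᵝ p
≈ᵝ-refl = mk≈ᵝ λ _ → refl

≈ᵝ-sym : ∀ {p q} → p ≈ᵝ q → q ≈ᵝ p
≈ᵝ-sym e = mk≈ᵝ λ n → sym (at-≡ e n)

≈ᵝ-trans : ∀ {p q r} → p ≈ᵝ q → q ≈ᵝ r → p ≈ᵝ r
≈ᵝ-trans e e′ = mk≈ᵝ λ n → trans (at-≡ e n) (at-≡ e′ n)

at-+ : ∀ p q n → (p +ᵝ q) at n ≡ p at n ℤ.+ q at n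
at-+ []      q       n       = sym (ℤₚ.+-identityˡ _)
at-+ (a ∷ p) []      n       = sym (ℤₚ.+-identityʳ _)
at-+ (a ∷ p) (b ∷ q) zero    = refl
at-+ (a ∷ p) (b ∷ q) (suc n) = at-+ p q n

at-map : (h : ℤ → ℤ) → h 0ℤ ≡ 0ℤ → ∀ p n → map h p at n ≡ h (p at n)
at-map h h0 []      n       = sym h0
at-map h h0 (a ∷ p) zero    = refl
at-map h h0 (a ∷ p) (suc n) = at-map h h0 p n

cauchy : (ℕ → ℤ) → (ℕ → ℤ) → ℕ → ℤ
cauchy f g zero    = f 0 ℤ.* g 0
cauchy f g (suc n) = f 0 ℤ.* g (suc n) ℤ.+ cauchy (λ k → f (suc k)) g n

cauchy-cong : ∀ {f f′ g g′} → (∀ n → f n ≡ f′ n) → (∀ n → g n ≡ g′ n) →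
              ∀ n → cauchy f g n ≡ cauchy f′ g′ n
cauchy-cong e e′ zero    = cong₂ ℤ._*_ (e 0) (e′ 0)
cauchy-cong e e′ (suc n) =
  cong₂ ℤ._+_ (cong₂ ℤ._*_ (e 0) (e′ (suc n))) (cauchy-cong (λ k → e (suc k)) e′ n)

cauchy-zeroˡ : ∀ g n → cauchy (λ _ → 0ℤ) g n ≡ 0ℤ
cauchy-zeroˡ g zero    = refl
cauchy-zeroˡ g (suc n) = trans (ℤₚ.+-identityˡ _) (cauchy-zeroˡ g n)

cauchy-zeroʳ : ∀ f n → cauchy f (λ _ → 0ℤ) n ≡ 0ℤ
cauchy-zeroʳ f zero    = ℤₚ.*-zeroʳ (f 0)
cauchy-zeroʳ f (suc n) =
  cong₂ ℤ._+_ (ℤₚ.*-zeroʳ (f 0)) (cauchy-zeroʳ (λ k → f (suc k)) n)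

at-* : ∀ p q n → (p *ᵝ q) at n ≡ cauchy (p at_) (q at_) n
at-* []      q n       = sym (cauchy-zeroˡ (q at_) n)
at-* (a ∷ p) q zero    =
  trans (at-+ (map (a ℤ.*_) q) _ 0)
        (trans (ℤₚ.+-identityʳ _) (at-map (a ℤ.*_) (ℤₚ.*-zeroʳ a) q 0))
at-* (a ∷ p) q (suc n) =
  trans (at-+ (map (a ℤ.*_) q) _ (suc n))
        (cong₂ ℤ._+_ (at-map (a ℤ.*_) (ℤₚ.*-zeroʳ a) q (suc n)) (at-* p q n))

+ᵝ-cong : ∀ {p p′ q q′} → p ≈ᵝ p′ → q ≈ᵝ q′ → p +ᵝ q ≈ᵝ p′ +ᵝ q′
+ᵝ-cong {p} {p′} {q} {q′} e e′ = mk≈ᵝ λ n →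
  trans (at-+ p q n) (trans (cong₂ ℤ._+_ (at-≡ e n) (at-≡ e′ n)) (sym (at-+ p′ q′ n)))

*ᵝ-cong : ∀ {p p′ q q′} → p ≈ᵝ p′ → q ≈ᵝ q′ → p *ᵝ q ≈ᵝ p′ *ᵝ q′
*ᵝ-cong {p} {p′} {q} {q′} e e′ = mk≈ᵝ λ n →
  trans (at-* p q n) (trans (cauchy-cong (at-≡ e) (at-≡ e′) n) (sym (at-* p′ q′ n)))

-ᵝ-cong : ∀ {p q} → p ≈ᵝ q → -ᵝ p ≈ᵝ -ᵝ q
-ᵝ-cong {p} {q} e = mk≈ᵝ λ n →
  trans (at-map (λ a → ℤ.- a) refl p n)
        (trans (cong (λ a → ℤ.- a) (at-≡ e n)) (sym (at-map (λ a → ℤ.- a) refl q n)))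

+ᵝ-zero : ∀ {p q} → p ≈ᵝ [] → q ≈ᵝ [] → p +ᵝ q ≈ᵝ []
+ᵝ-zero e e′ = +ᵝ-cong e e′

*ᵝ-zeroˡ : ∀ {p} q → p ≈ᵝ [] → p *ᵝ q ≈ᵝ []
*ᵝ-zeroˡ q e = *ᵝ-cong e (≈ᵝ-refl {q})

*ᵝ-zeroʳ : ∀ p {q} → q ≈ᵝ [] → p *ᵝ q ≈ᵝ []
*ᵝ-zeroʳ p {q} e = mk≈ᵝ λ n →
  trans (at-* p q n) (trans (cauchy-cong {p at_} (λ _ → refl) (at-≡ e) n) (cauchy-zeroʳ (p at_) n))

Σᵝ-cong : ∀ {n} {f g : Fin n → ℤ[β]} → (∀ i → f i ≈ᵝ g i) → Σᵝ f ≈ᵝ Σᵝ g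
Σᵝ-cong {zero}  e = ≈ᵝ-refl
Σᵝ-cong {suc n} e = +ᵝ-cong (e zero) (Σᵝ-cong λ i → e (suc i))

Σᵝ-zero : ∀ {n} {f : Fin n → ℤ[β]} → (∀ i → f i ≈ᵝ []) → Σᵝ f ≈ᵝ []
Σᵝ-zero {zero}  e = ≈ᵝ-refl
Σᵝ-zero {suc n} e = +ᵝ-zero (e zero) (Σᵝ-zero λ i → e (suc i))

-- Two truncations of the same eventually vanishing sum agree.
Σᵝ-truncate : ∀ m n {f g : ℕ → ℤ[β]} → (∀ k → f k ≈ᵝ g k) →
              (∀ k → m ≤ k → f k ≈ᵝ []) → (∀ k → n ≤ k → g k ≈ᵝ []) →
              Σᵝ {m} (λ i → f (toℕ i)) ≈ᵝ Σᵝ {n} (λ i → g (toℕ i))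
Σᵝ-truncate zero    n       e z z′ =
  ≈ᵝ-sym (Σᵝ-zero {n} λ i → ≈ᵝ-trans (≈ᵝ-sym (e (toℕ i))) (z (toℕ i) z≤n))
Σᵝ-truncate (suc m) zero    e z z′ =
  Σᵝ-zero {suc m} λ i → ≈ᵝ-trans (e (toℕ i)) (z′ (toℕ i) z≤n)
Σᵝ-truncate (suc m) (suc n) e z z′ =
  +ᵝ-cong (e 0) (Σᵝ-truncate m n (λ k → e (suc k))
    (λ k le → z (suc k) (s≤s le)) (λ k le → z′ (suc k) (s≤s le)))

------------------------------------------------------------------------
-- The ring ℤ[β][[x₁,x₂,…]].  The list e₁ ∷ … ∷ eₙ is the monomial
-- x₁^e₁⋯xₙ^eₙ.  A monomial is represented by several lists, differing by
-- trailing zeros, and `stable` makes the coefficient depend on the monomial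
-- only.

Monomial : Set
Monomial = List ℕ

degree : Monomial → ℕ
degree = List.sum

record Series : Set where
  constructor mkSeries
  field
    coeff  : Monomial → ℤ[β]
    stable : ∀ e → coeff (e ∷ʳ 0) ≈ᵝ coeff e
open Series public

infix 4 _≈_
record _≈_ (F G : Series) : Set where
  constructor mk≈
  field coeff-≈ : ∀ e → coeff F e ≈ᵝ coeff G e
open _≈_ public

-- Sum of f d *ᵝ g (e - d) over all exponent vectors d ≤ e.
convolve : (Monomial → ℤ[β]) → (Monomial → ℤ[β]) → Monomial → ℤ[β]
convolve f g []      = f [] *ᵝ g []
convolve f g (n ∷ e) = Σᵝ {suc n} λ i →
  convolve (λ d → f (toℕ i ∷ d)) (λ d → g (n ∸ toℕ i ∷ d)) e

convolve-stable : ∀ f g → (∀ e → f (e ∷ʳ 0) ≈ᵝ f e) → (∀ e → g (e ∷ʳ 0) ≈ᵝ g e) →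
                  ∀ e → convolve f g (e ∷ʳ 0) ≈ᵝ convolve f g e
convolve-stable f g sf sg [] = mk≈ᵝ λ n →
  trans (at-+ (f [ 0 ] *ᵝ g [ 0 ]) [] n)
        (trans (ℤₚ.+-identityʳ _) (at-≡ (*ᵝ-cong (sf []) (sg [])) n))
convolve-stable f g sf sg (n ∷ e) = Σᵝ-cong {suc n} λ i →
  convolve-stable _ _ (λ d → sf (toℕ i ∷ d)) (λ d → sg (n ∸ toℕ i ∷ d)) e

constant : ℤ[β] → Series
constant c = mkSeries co st
  where
  co : Monomial → ℤ[β]
  co []          = c
  co (zero  ∷ e) = co e
  co (suc _ ∷ e) = []
  st : ∀ e → co (e ∷ʳ 0) ≈ᵝ co e
  st []          = ≈ᵝ-refl
  st (zero  ∷ e) = st e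
  st (suc _ ∷ e) = ≈ᵝ-refl

-- The variable at list position k, that is x_{k+1}.
variableAt : ℕ → Series
variableAt k = mkSeries (co k) (st k)
  where
  co : ℕ → Monomial → ℤ[β]
  co _       []          = []
  co zero    (suc zero ∷ e) = coeff (constant [ 1ℤ ]) e
  co zero    (_ ∷ e)     = []
  co (suc k) (zero ∷ e)  = co k e
  co (suc k) (suc _ ∷ e) = []
  st : ∀ k e → co k (e ∷ʳ 0) ≈ᵝ co k e
  st zero    []                 = ≈ᵝ-refl
  st zero    (zero ∷ e)         = ≈ᵝ-refl
  st zero    (suc zero ∷ e)     = stable (constant [ 1ℤ ]) e
  st zero    (suc (suc _) ∷ e)  = ≈ᵝ-refl
  st (suc zero)    []           = ≈ᵝ-refl
  st (suc (suc k)) []           = ≈ᵝ-refl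
  st (suc k) (zero ∷ e)         = st k e
  st (suc k) (suc _ ∷ e)        = ≈ᵝ-refl

Series-rawRing : RawRing 0ℓ 0ℓ
Series-rawRing = record
  { Carrier = Series
  ; _≈_     = _≈_
  ; _+_     = λ F G → mkSeries (λ e → coeff F e +ᵝ coeff G e)
                               (λ e → +ᵝ-cong (stable F e) (stable G e))
  ; _*_     = λ F G → mkSeries (convolve (coeff F) (coeff G))
                               (convolve-stable _ _ (stable F) (stable G))
  ; -_      = λ F → mkSeries (λ e → -ᵝ coeff F e) (λ e → -ᵝ-cong (stable F e))
  ; 0#      = constant []
  ; 1#      = constant [ 1ℤ ]
  }

open RawRing Series-rawRing public
  using (_+_; _*_; -_; 0#; 1#)

infixr 8 _^ˢ_
_^ˢ_ : Series → ℕ → Series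
_^ˢ_ = _^_ (RawRing.rawSemiring Series-rawRing)

Σˢ : ∀ {n} → (Fin n → Series) → Series
Σˢ = sum (RawRing.rawSemiring Series-rawRing)

β : Series
β = constant (0ℤ ∷ 1ℤ ∷ [])

fromℤ : ℤ → Series
fromℤ z = constant [ z ]

-- Variables are numbered from 1; x 0 is never used.
x : ℕ → Series
x i = variableAt (pred i)

-- Infinite sums whose terms contribute to each monomial only finitely often.
Summable : (ℕ → Series) → Set
Summable F = ∀ e → ∃[ n ] (∀ k → n ≤ k → coeff (F k) e ≈ᵝ [])

Σ∞ : (F : ℕ → Series) → Summable F → Series
Σ∞ F summable = mkSeries
  (λ e → Σᵝ {proj₁ (summable e)} λ i → coeff (F (toℕ i)) e)
  (λ e → Σᵝ-truncate (proj₁ (summable (e ∷ʳ 0))) (proj₁ (summable e))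
           (λ k → stable (F k) e) (proj₂ (summable (e ∷ʳ 0))) (proj₂ (summable e)))

------------------------------------------------------------------------
-- All monomials of degree < n have coefficient zero.
Order≥ : ℕ → (Monomial → ℤ[β]) → Set
Order≥ n f = ∀ e → degree e < n → f e ≈ᵝ []

interchange : ∀ a b c d → (a ℕ.+ b) ℕ.+ (c ℕ.+ d) ≡ (a ℕ.+ c) ℕ.+ (b ℕ.+ d)
interchange = interchange-+
  where open import Algebra.Properties.CommutativeSemigroup ℕₚ.+-commutativeSemigroup
          renaming (interchange to interchange-+)

convolve-order : ∀ m n f g → Order≥ m f → Order≥ n g → Order≥ (m ℕ.+ n) (convolve f g)
convolve-order zero    (suc n) f g of og [] _ = *ᵝ-zeroʳ (f []) (og [] (s≤s z≤n))
convolve-order (suc m) n       f g of og [] _ = *ᵝ-zeroˡ (g []) (of [] (s≤s z≤n))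
convolve-order m n f g of og (k ∷ e) lt = Σᵝ-zero {suc k} λ i →
  convolve-order (m ∸ toℕ i) (n ∸ (k ∸ toℕ i)) _ _
    (λ d l → of (toℕ i ∷ d) (unshift (toℕ i) m l))
    (λ d l → og (k ∸ toℕ i ∷ d) (unshift (k ∸ toℕ i) n l))
    e (bound (toℕ i) (toℕ≤pred[n] i))
  where
  unshift : ∀ a b {c} → c < b ∸ a → a ℕ.+ c < b
  unshift zero    b       l = l
  unshift (suc a) (suc b) l = s≤s (unshift a b l)

  bound : ∀ i → i ≤ k → degree e < (m ∸ i) ℕ.+ (n ∸ (k ∸ i))
  bound i i≤k = ℕₚ.+-cancelˡ-< k _ _ (begin-strict
    k ℕ.+ degree e                                     <⟨ lt ⟩
    m ℕ.+ n                                            ≤⟨ ℕₚ.+-mono-≤ (ℕₚ.m≤n+m∸n m i) (ℕₚ.m≤n+m∸n n (k ∸ i)) ⟩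
    (i ℕ.+ (m ∸ i)) ℕ.+ ((k ∸ i) ℕ.+ (n ∸ (k ∸ i)))    ≡⟨ interchange i _ (k ∸ i) _ ⟩
    (i ℕ.+ (k ∸ i)) ℕ.+ ((m ∸ i) ℕ.+ (n ∸ (k ∸ i)))    ≡⟨ cong (ℕ._+ ((m ∸ i) ℕ.+ (n ∸ (k ∸ i)))) (ℕₚ.m+[n∸m]≡n i≤k) ⟩
    k ℕ.+ ((m ∸ i) ℕ.+ (n ∸ (k ∸ i)))                  ∎)
    where open ℕₚ.≤-Reasoning

*-order : ∀ m n F G → Order≥ m (coeff F) → Order≥ n (coeff G) →
          Order≥ (m ℕ.+ n) (coeff (F * G))
*-order m n F G = convolve-order m n (coeff F) (coeff G)

*-orderʳ : ∀ n F G → Order≥ n (coeff G) → Order≥ n (coeff (F * G))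
*-orderʳ n F G = *-order 0 n F G (λ _ ())

0#-order : ∀ n → Order≥ n (coeff 0#)
0#-order n []          _ = ≈ᵝ-refl
0#-order n (zero  ∷ e) l = 0#-order n e l
0#-order n (suc _ ∷ e) l = ≈ᵝ-refl

variableAt-order : ∀ k → Order≥ 1 (coeff (variableAt k))
variableAt-order zero    []         l = ≈ᵝ-refl
variableAt-order (suc k) []         l = ≈ᵝ-refl
variableAt-order zero    (zero ∷ e) l = ≈ᵝ-refl
variableAt-order (suc k) (zero ∷ e) l = variableAt-order k e l
variableAt-order k (suc _ ∷ e) (s≤s ())

^-order : ∀ F → Order≥ 1 (coeff F) → ∀ n → Order≥ n (coeff (F ^ˢ n))
^-order F o zero    e ()
^-order F o (suc n) = *-order 1 n F (F ^ˢ n) o (^-order F o n)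

Σˢ-order : ∀ m {n} (F : Fin n → Series) → (∀ i → Order≥ m (coeff (F i))) →
           Order≥ m (coeff (Σˢ F))
Σˢ-order m {zero}  F o = 0#-order m
Σˢ-order m {suc n} F o e l =
  +ᵝ-zero (o zero e l) (Σˢ-order m (λ i → F (suc i)) (λ i → o (suc i)) e l)

Order≥ℤ : ℤ → Series → Set
Order≥ℤ z F = ∀ e → + degree e ℤ.< z → coeff F e ≈ᵝ []

*-orderℤ : ∀ z F G → Order≥ℤ z G → Order≥ℤ z (F * G)
*-orderℤ z F G o e l = *-orderʳ (suc (degree e)) F G
  (λ d l′ → o d (ℤₚ.≤-<-trans (ℤ.+≤+ (ℕ.s≤s⁻¹ l′)) l)) e ℕₚ.≤-refl

summable-shift : ∀ z (F : ℕ → Series) → (∀ k → Order≥ℤ (z ℤ.+ + k) (F k)) → Summable F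
summable-shift z F o e = suc (degree e ℕ.+ ℤ.∣ z ∣) , λ k le → o k e (large z k le)
  where
  large : ∀ z k → suc (degree e ℕ.+ ℤ.∣ z ∣) ≤ k → + degree e ℤ.< z ℤ.+ + k
  large (+ m)    k le = ℤ.+<+ (ℕₚ.≤-trans (ℕₚ.≤-trans (s≤s (ℕₚ.m≤m+n _ m)) le) (ℕₚ.m≤n+m k m))
  large -[1+ m ] k le =
    subst (+ degree e ℤ.<_) (sym (ℤₚ.⊖-≥ {k} {suc m} (ℕₚ.≤-trans (ℕₚ.m≤n+m (suc m) (suc (degree e))) le)))
          (ℤ.+<+ (ℕₚ.m+n≤o⇒m≤o∸n (suc (degree e)) le))

Σ∞-order : ∀ z F s → (∀ k → Order≥ℤ z (F k)) → Order≥ℤ z (Σ∞ F s)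
Σ∞-order z F s o e l = Σᵝ-zero {proj₁ (s e)} λ i → o (toℕ i) e l

------------------------------------------------------------------------
-- Power series in u over ℤ[β][[x]], given by their coefficients.

USeries : Set
USeries = ℕ → Series

1ᵘ : USeries
1ᵘ zero    = 1#
1ᵘ (suc _) = 0#

infixl 7 _*ᵘ_
_*ᵘ_ : USeries → USeries → USeries
(A *ᵘ B) n = Σˢ {suc n} λ k → A (toℕ k) * B (n ∸ toℕ k)

-- (1 + β xᵢ) / (1 - xᵢ u), with 1 / (1 - xᵢ u) = Σₙ xᵢⁿ uⁿ.
factor : ℕ → USeries
factor i n = (1# + β * x i) * x i ^ˢ n

-- q, q+1, …, p; empty if q > p.
interval : ℕ → ℕ → List ℕ
interval q p = applyUpTo (q ℕ.+_) (suc p ∸ q)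

productᵘ : List ℕ → USeries
productᵘ = foldr (λ i A → factor i *ᵘ A) 1ᵘ

-- Coefficient of uᶻ.
[u^_]_ : ℤ → USeries → Series
[u^ + n      ] A = A n
[u^ -[1+ _ ] ] A = 0#

Homogeneous≥ : USeries → Set
Homogeneous≥ A = ∀ n → Order≥ n (coeff (A n))

productᵘ-order : ∀ is → Homogeneous≥ (productᵘ is)
productᵘ-order []       zero    e ()
productᵘ-order []       (suc n) = 0#-order (suc n)
productᵘ-order (i ∷ is) n = Σˢ-order n {suc n} (λ k → factor i (toℕ k) * productᵘ is (n ∸ toℕ k)) λ k →
  subst (λ m → Order≥ m (coeff (factor i (toℕ k) * productᵘ is (n ∸ toℕ k))))
        (ℕₚ.m+[n∸m]≡n (toℕ≤pred[n] k))
        (*-order (toℕ k) (n ∸ toℕ k) (factor i (toℕ k)) (productᵘ is (n ∸ toℕ k))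
          (*-orderʳ (toℕ k) (1# + β * x i) (x i ^ˢ toℕ k)
            (^-order (x i) (variableAt-order (pred i)) (toℕ k)))
          (productᵘ-order is (n ∸ toℕ k)))

[u^]-order : ∀ A → Homogeneous≥ A → ∀ z → Order≥ℤ z ([u^ z ] A)
[u^]-order A h (+ n) e (ℤ.+<+ l) = h n e l
[u^]-order A h -[1+ n ] e ()

-- G_m^{[p/q]}: the coefficient of u^m in the product of
-- 1 / (1 + β u⁻¹) = Σ_{k≥0} (-β)^k u^{-k} with the power series in u.
G-term : ℕ → ℕ → ℤ → ℕ → Series
G-term p q m k = (- β) ^ˢ k * ([u^ m ℤ.+ + k ] productᵘ (interval q p))

G-term-order : ∀ p q m k → Order≥ℤ (m ℤ.+ + k) (G-term p q m k)
G-term-order p q m k =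
  *-orderℤ (m ℤ.+ + k) ((- β) ^ˢ k) ([u^ m ℤ.+ + k ] productᵘ (interval q p))
    ([u^]-order _ (productᵘ-order (interval q p)) (m ℤ.+ + k))

G[_/_] : ℕ → ℕ → ℤ → Series
G[ p / q ] m = Σ∞ (G-term p q m) (summable-shift m (G-term p q m) (G-term-order p q m))

G[/]-order : ∀ p q m → Order≥ℤ m (G[ p / q ] m)
G[/]-order p q m = Σ∞-order m (G-term p q m)
  (summable-shift m (G-term p q m) (G-term-order p q m)) λ k e l →
  G-term-order p q m k e (ℤₚ.<-≤-trans l (ℤₚ.i≤i+j m (+ k)))

------------------------------------------------------------------------

falling : ℤ → ℕ → ℤ
falling z zero    = 1ℤ
falling z (suc s) = z ℤ.* falling (z ℤ.- 1ℤ) s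

-- z (z - 1) ⋯ (z - s + 1) / s!, an exact division.
binomial : ℤ → ℕ → ℤ
binomial z s = ℤ._/ℕ_ (falling z s) (s !) {{s ℕₚ.!≢0}}

-- Expansion along the first row.
det : ∀ {n} → (Fin n → Fin n → Series) → Series
det {zero}  M = 1#
det {suc n} M = Σˢ λ j →
  (- 1#) ^ˢ toℕ j * (M zero j * det (λ a b → M (suc a) (punchIn j b)))

-- Rows and columns are counted from 0, which leaves i - j unchanged.
module _ {r : ℕ} (lam μ f g : Fin r → ℕ) where

  subscript : Fin r → Fin r → ℤ
  subscript i j = (lam i ⊖ μ j) ℤ.+ (toℕ j ⊖ toℕ i)

  entry-term : Fin r → Fin r → ℕ → Series
  entry-term i j s =
    fromℤ (binomial (toℕ i ⊖ toℕ j) s) * β ^ˢ s * G[ f i / g j ] (subscript i j ℤ.+ + s)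

  entry-term-order : ∀ i j s → Order≥ℤ (subscript i j ℤ.+ + s) (entry-term i j s)
  entry-term-order i j s =
    *-orderℤ (subscript i j ℤ.+ + s) (fromℤ (binomial (toℕ i ⊖ toℕ j) s) * β ^ˢ s)
      (G[ f i / g j ] (subscript i j ℤ.+ + s))
      (G[/]-order (f i) (g j) (subscript i j ℤ.+ + s))

  entry : Fin r → Fin r → Series
  entry i j = Σ∞ (entry-term i j) (summable-shift (subscript i j) (entry-term i j) (entry-term-order i j))

  G̃ : Series
  G̃ = det entry

------------------------------------------------------------------------

WeaklyDecreasing : ∀ {r} → (Fin r → ℕ) → Set
WeaklyDecreasing a = ∀ i j → i Fin.≤ j → a j ≤ a i

Positive : ∀ {r} → (Fin r → ℕ) → Set
Positive a = ∀ i → 0 < a i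

IsFlagging : ∀ {r} (lam μ f g : Fin r → ℕ) → Set
IsFlagging lam μ f g = ∀ i i′ → toℕ i′ ≡ suc (toℕ i) →
  μ i < lam i′ → g i ≤ g i′ × f i ≤ f i′

-- Every non-empty subset of the elements of a strictly increasing list, once
-- each, as a strictly increasing list.
nonEmptySubsets : List ℕ → List (List⁺ ℕ)
nonEmptySubsets []       = []
nonEmptySubsets (a ∷ as) =
  (a List⁺.∷ []) ∷ map (a ∷⁺_) (nonEmptySubsets as) ++ nonEmptySubsets as

-- Every choice function picking an element of each list, once each.
choices : ∀ {n} {A : Fin n → Set} → (∀ i → List (A i)) → List (∀ i → A i)
choices {zero}  c = [ (λ ()) ]
choices {suc n} c = cartesianProductWith ∀-cons (c zero) (choices λ i → c (suc i))

minimum maximum : List⁺ ℕ → ℕ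
minimum = foldr₁ _⊓_
maximum = foldr₁ _⊔_

module _ {r : ℕ} (lam μ : Fin r → ℕ) where

  -- The j-th box of row i, counting from 0, lies in column μ i + j + 1.
  Filling : Set
  Filling = (i : Fin r) → Fin (lam i ∸ μ i) → List⁺ ℕ

  RowCondition : Filling → Set
  RowCondition T = ∀ i j j′ → toℕ j′ ≡ suc (toℕ j) →
    maximum (T i j) ≤ minimum (T i j′)

  ColumnCondition : Filling → Set
  ColumnCondition T = ∀ i i′ → toℕ i′ ≡ suc (toℕ i) →
    ∀ j j′ → μ i ℕ.+ toℕ j ≡ μ i′ ℕ.+ toℕ j′ →
    maximum (T i j) < minimum (T i′ j′)

  tableau? : ∀ T → Dec (RowCondition T × ColumnCondition T)
  tableau? T =
    (all? λ i → all? λ j → all? λ j′ →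
      (toℕ j′ ℕₚ.≟ suc (toℕ j)) →-dec (maximum (T i j) ℕₚ.≤? minimum (T i j′)))
    ×-dec
    (all? λ i → all? λ i′ → (toℕ i′ ℕₚ.≟ suc (toℕ i)) →-dec
      (all? λ j → all? λ j′ → (μ i ℕ.+ toℕ j ℕₚ.≟ μ i′ ℕ.+ toℕ j′) →-dec
        (maximum (T i j) ℕₚ.<? minimum (T i′ j′))))

  FSVT : (f g : Fin r → ℕ) → List Filling
  FSVT f g = filter tableau?
    (choices λ i → choices λ j → nonEmptySubsets (interval (g i) (f i)))

  entries : Filling → List ℕ
  entries T = concatMap (λ i → concatMap (λ j → toList (T i j)) (allFin _)) (allFin r)

  size : ℕ
  size = List.sum (map (λ i → lam i ∸ μ i) (allFin r))

  -- Boxes are non-empty, so the truncated subtraction is a true one.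
  weight : Filling → Series
  weight T = β ^ˢ (length (entries T) ∸ size) * foldr (λ k F → x k * F) 1# (entries T)

  G : (f g : Fin r → ℕ) → Series
  G f g = foldr (λ T F → weight T + F) 0# (FSVT f g)

{-# OPTIONS --safe #-}
module Submission where

-- Let E n m be the coefficient of u^m in (1 + β u⁻¹)ⁿ Σₖ G_k^{[p/q]} u^k, so that
-- the (i, j) entry of the matrix is E (i - j) (λᵢ - μⱼ + j - i).  Multiplying by
-- 1 - x_q u peels off the smallest variable,
--   E[p/q] n m = (1 + β x_q) E[p/q+1] n m + x_q E[p/q] n (m - 1),
-- and E (n + 1) m = E n m + β E n (m + 1).
--
-- Following Wachs, both sides satisfy the same recursion.  Let i be the last row
-- of the maximal run of overlapping rows, starting from the first row, on which g
-- is constant, and x = x_{gᵢ}.  If i is the first row or μᵢ < μᵢ₋₁, the leftmost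
-- box of row i is {gᵢ}, or contains gᵢ properly, or avoids gᵢ, whence
--   Z(μᵢ, gᵢ) = (1 + β x) Z(μᵢ, gᵢ + 1) + x Z(μᵢ + 1, gᵢ);
-- for the determinant this is linearity in column i.  If μᵢ = μᵢ₋₁, the box above
-- the leftmost one excludes gᵢ, so Z(gᵢ) = Z(gᵢ + 1); for the determinant, column
-- i for gᵢ + 1, times 1 + β x, is 1 + β x times column i minus x times column
-- i - 1, and 1 + β x is cancellable.  The recursion stops when the first row is
-- empty, or has f₁ < g₁: then there are no tableaux, and a block of zeros makes
-- the determinant vanish.

open import Algebra.Bundles using (CommutativeMonoid; CommutativeRing)
open import Algebra.Bundles.Raw using (RawRing)
open import Data.Bool.Base using (if_then_else_)
open import Data.Fin.Base using (Fin; fromℕ<; punchIn; punchOut; toℕ) renaming (zero to fzero; suc to fsuc)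
open import Data.Fin.Properties as Finₚ using (punchInᵢ≢i; punchIn-injective; punchIn-punchOut; toℕ<n; ∀-cons)
open import Data.Integer.Base as ℤ using (ℤ; +_; -[1+_]; 0ℤ; 1ℤ; -1ℤ; _⊖_)
import Data.Integer.DivMod as ℤ-DivMod
import Data.Integer.Properties as ℤₚ
import Data.Integer.Solver
open import Data.List.Base as List
  using (List; []; _∷_; _++_; allFin; applyUpTo; cartesianProductWith; concat; filter; foldr; length; map; tabulate)
open import Data.List.NonEmpty.Base as List⁺ using (List⁺; toList; _∷⁺_)
import Data.List.Properties as Listₚ
open import Data.List.Relation.Unary.All as All using (All; []; _∷_)
import Data.List.Relation.Unary.All.Properties as Allₚ
open import Data.Nat.Base as ℕ using (ℕ; zero; suc; _∸_; _!; _<_; _≤_; z≤n; s≤s)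
import Data.Nat.Properties as ℕₚ
open import Data.Product.Base using (∃-syntax; _×_; _,_; proj₁; proj₂)
open import Data.Sum.Base using (_⊎_; inj₁; inj₂)
open import Data.Unit.Base using (⊤; tt)
open import Function.Base using (_∘_; id)
open import Level using (0ℓ)
open import Relation.Binary.PropositionalEquality as ≡ using (_≡_; _≢_)
open import Relation.Nullary.Decidable using (Dec; yes; no; does; ¬?; _×-dec_; _⊎-dec_)
open import Relation.Nullary.Negation using (¬_; contradiction)
import Algebra.Properties.CommutativeSemigroup
import Algebra.Properties.Group
import Algebra.Properties.Ring
import Algebra.Properties.Semiring.Exp
import Algebra.Properties.Semiring.Sum
import Algebra.Solver.Ring.NaturalCoefficients.Default
import Relation.Binary.Reasoning.Setoid
open import Defs using (nonEmptySubsets; minimum; maximum; interval; choices;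
  Filling; RowCondition; ColumnCondition; tableau?; entries; size)

-- Power series rings

-- Two requirements single out row i. Raising gᵢ must leave a flagging, so row i + 1 must not
-- overlap row i, or gᵢ < gᵢ₊₁; the same condition makes the bound that an entry gᵢ puts on the box
-- below it vacuous. And column i can be peeled only in rows a with gᵢ ≤ f_a. Since gᵢ = g₁ ≤ f₁ and
-- f grows weakly along overlapping rows, this holds in all rows down to the first break, which is
-- not above row i; past a break λ_a ≤ μᵢ, and the entries of column i vanish. Constancy of g along
-- the run is also what relates columns i - 1 and i when μᵢ = μᵢ₋₁.
--
-- On the tableau side a row acts on the rows below only through a lower bound for each column, so a
-- change in one row can be followed by comparing bounds.
--
-- The recursion is proved over an arbitrary commutative ring in which the entries obey the laws
-- `EntryLaws`. These laws are identities between infinite sums, proved term by term and transferred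
-- by uniqueness of limits.

module JointlyInjective
  (A : RawRing 0ℓ 0ℓ) (I : Set) (B : I → CommutativeRing 0ℓ 0ℓ)
  (φ : (i : I) → RawRing.Carrier A → CommutativeRing.Carrier (B i))
  where

  private
    module A = RawRing A
    module B (i : I) = CommutativeRing (B i)

  record IsJointlyInjective : Set where
    field
      φ-cong  : ∀ i {a b} → a A.≈ b → B._≈_ i (φ i a) (φ i b)
      φ-+     : ∀ i a b → B._≈_ i (φ i (a A.+ b)) (B._+_ i (φ i a) (φ i b))
      φ-*     : ∀ i a b → B._≈_ i (φ i (a A.* b)) (B._*_ i (φ i a) (φ i b))
      φ-neg   : ∀ i a → B._≈_ i (φ i (A.- a)) (B.-_ i (φ i a))
      φ-0     : ∀ i → B._≈_ i (φ i A.0#) (B.0# i)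
      φ-1     : ∀ i → B._≈_ i (φ i A.1#) (B.1# i)
      reflect : ∀ {a b} → (∀ i → B._≈_ i (φ i a) (φ i b)) → a A.≈ b

    -- Each axiom holds in every `B i` once `φ i` is pushed through the operations, and `reflect`
    -- brings it back.
    commutativeRing : CommutativeRing 0ℓ 0ℓ
    commutativeRing = record
      { Carrier = A.Carrier ; _≈_ = A._≈_ ; _+_ = A._+_ ; _*_ = A._*_ ; -_ = A.-_ ; 0# = A.0# ; 1# = A.1#
      ; isCommutativeRing = record
        { isRing = record
          { +-isAbelianGroup = record
            { isGroup = record
              { isMonoid = record
                { isSemigroup = record
                  { isMagma = record
                    { isEquivalence = record
                      { refl  = reflect λ i → B.refl i
                      ; sym   = λ e → reflect λ i → B.sym i (φ-cong i e)
                      ; trans = λ e e′ → reflect λ i → B.trans i (φ-cong i e) (φ-cong i e′)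
                      }
                    ; ∙-cong = λ {a} {b} {c} {d} e e′ → reflect λ i → let open B i in
                        trans (φ-+ i a c) (trans (+-cong (φ-cong i e) (φ-cong i e′)) (sym (φ-+ i b d)))
                    }
                  ; assoc = λ a b c → reflect λ i → let open B i in
                      trans (φ-+ i _ c) (trans (+-congʳ (φ-+ i a b)) (trans (+-assoc _ _ _)
                        (sym (trans (φ-+ i a _) (+-congˡ (φ-+ i b c))))))
                  }
                ; identity =
                    (λ a → reflect λ i → let open B i in
                      trans (φ-+ i _ a) (trans (+-congʳ (φ-0 i)) (+-identityˡ _)))
                  , (λ a → reflect λ i → let open B i in
                      trans (φ-+ i a _) (trans (+-congˡ (φ-0 i)) (+-identityʳ _)))
                }
              ; inverse =
                  (λ a → reflect λ i → let open B i in
                    trans (φ-+ i _ a) (trans (+-congʳ (φ-neg i a)) (trans (-‿inverseˡ _) (sym (φ-0 i)))))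
                , (λ a → reflect λ i → let open B i in
                    trans (φ-+ i a _) (trans (+-congˡ (φ-neg i a)) (trans (-‿inverseʳ _) (sym (φ-0 i)))))
              ; ⁻¹-cong = λ {a} {b} e → reflect λ i → let open B i in
                  trans (φ-neg i a) (trans (-‿cong (φ-cong i e)) (sym (φ-neg i b)))
              }
            ; comm = λ a b → reflect λ i → let open B i in
                trans (φ-+ i a b) (trans (+-comm _ _) (sym (φ-+ i b a)))
            }
          ; *-cong = λ {a} {b} {c} {d} e e′ → reflect λ i → let open B i in
              trans (φ-* i a c) (trans (*-cong (φ-cong i e) (φ-cong i e′)) (sym (φ-* i b d)))
          ; *-assoc = λ a b c → reflect λ i → let open B i in
              trans (φ-* i _ c) (trans (*-congʳ (φ-* i a b)) (trans (*-assoc _ _ _)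
                (sym (trans (φ-* i a _) (*-congˡ (φ-* i b c))))))
          ; *-identity =
              (λ a → reflect λ i → let open B i in
                trans (φ-* i _ a) (trans (*-congʳ (φ-1 i)) (*-identityˡ _)))
            , (λ a → reflect λ i → let open B i in
                trans (φ-* i a _) (trans (*-congˡ (φ-1 i)) (*-identityʳ _)))
          ; distrib =
              (λ a b c → reflect λ i → let open B i in
                trans (φ-* i a _) (trans (*-congˡ (φ-+ i b c)) (trans (distribˡ _ _ _)
                  (sym (trans (φ-+ i _ _) (+-cong (φ-* i a b) (φ-* i a c)))))))
            , (λ a b c → reflect λ i → let open B i in
                trans (φ-* i _ a) (trans (*-congʳ (φ-+ i b c)) (trans (distribʳ _ _ _)
                  (sym (trans (φ-+ i _ _) (+-cong (φ-* i b a) (φ-* i c a)))))))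
          }
        ; *-comm = λ a b → reflect λ i → let open B i in
            trans (φ-* i a b) (trans (*-comm _ _) (sym (φ-* i b a)))
        }
      }

module PowerSeries (R : CommutativeRing 0ℓ 0ℓ) where
  open CommutativeRing R
  open import Algebra.Properties.CommutativeSemigroup
    (CommutativeMonoid.commutativeSemigroup +-commutativeMonoid) using (interchange; x∙yz≈y∙xz)
  open import Algebra.Properties.Semiring.Sum semiring using (sum)
  open import Relation.Binary.Reasoning.Setoid setoid

  -- Σ_{i+j=n} T i j
  Σ≐ : ℕ → (ℕ → ℕ → Carrier) → Carrier
  Σ≐ zero    T = T 0 0
  Σ≐ (suc n) T = T 0 (suc n) + Σ≐ n (λ i j → T (suc i) j)

  Σ≐-cong : ∀ n {T U} → (∀ i j → T i j ≈ U i j) → Σ≐ n T ≈ Σ≐ n U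
  Σ≐-cong zero    e = e 0 0
  Σ≐-cong (suc n) e = +-cong (e 0 (suc n)) (Σ≐-cong n λ i → e (suc i))

  Σ≐-+ : ∀ n T U → Σ≐ n (λ i j → T i j + U i j) ≈ Σ≐ n T + Σ≐ n U
  Σ≐-+ zero    T U = refl
  Σ≐-+ (suc n) T U = trans (+-congˡ (Σ≐-+ n _ _)) (interchange _ _ _ _)

  Σ≐-*ˡ : ∀ n c T → c * Σ≐ n T ≈ Σ≐ n (λ i j → c * T i j)
  Σ≐-*ˡ zero    c T = refl
  Σ≐-*ˡ (suc n) c T = trans (distribˡ _ _ _) (+-congˡ (Σ≐-*ˡ n c _))

  Σ≐-*ʳ : ∀ n c T → Σ≐ n T * c ≈ Σ≐ n (λ i j → T i j * c)
  Σ≐-*ʳ zero    c T = refl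
  Σ≐-*ʳ (suc n) c T = trans (distribʳ _ _ _) (+-congˡ (Σ≐-*ʳ n c _))

  Σ≐-zero : ∀ n {T} → (∀ i j → T i j ≈ 0#) → Σ≐ n T ≈ 0#
  Σ≐-zero zero    z = z 0 0
  Σ≐-zero (suc n) z = trans (+-cong (z 0 (suc n)) (Σ≐-zero n λ i → z (suc i))) (+-identityˡ _)

  Σ≐-last : ∀ n T → Σ≐ (suc n) T ≈ T (suc n) 0 + Σ≐ n (λ i j → T i (suc j))
  Σ≐-last zero    T = +-comm _ _
  Σ≐-last (suc n) T = trans (+-congˡ (Σ≐-last n (λ i j → T (suc i) j))) (x∙yz≈y∙xz _ _ _)

  Σ≐-flip : ∀ n T → Σ≐ n T ≈ Σ≐ n (λ i j → T j i)
  Σ≐-flip zero    T = refl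
  Σ≐-flip (suc n) T = trans (Σ≐-last n T) (+-congˡ (Σ≐-flip n (λ i j → T i (suc j))))

  -- Both sides run over a + b + k = n; splitting off the terms with a = 0 leaves the same identity
  -- one degree lower.
  Σ≐-assoc : ∀ n (T : ℕ → ℕ → ℕ → Carrier) →
    Σ≐ n (λ i k → Σ≐ i (λ a b → T a b k)) ≈ Σ≐ n (λ a m → Σ≐ m (λ b k → T a b k))
  Σ≐-assoc zero    T = refl
  Σ≐-assoc (suc n) T = begin
    T 0 0 (suc n) + Σ≐ n (λ i k → T 0 (suc i) k + Σ≐ i (λ a b → T (suc a) b k))
      ≈⟨ +-congˡ (Σ≐-+ n _ _) ⟩
    T 0 0 (suc n) + (Σ≐ n (λ i k → T 0 (suc i) k) + Σ≐ n (λ i k → Σ≐ i (λ a b → T (suc a) b k)))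
      ≈⟨ +-assoc _ _ _ ⟨
    Σ≐ (suc n) (T 0) + Σ≐ n (λ i k → Σ≐ i (λ a b → T (suc a) b k))
      ≈⟨ +-congˡ (Σ≐-assoc n (λ a → T (suc a))) ⟩
    Σ≐ (suc n) (T 0) + Σ≐ n (λ a m → Σ≐ m (λ b k → T (suc a) b k)) ∎

  sum≈Σ≐ : ∀ n T → sum {suc n} (λ i → T (toℕ i) (n ∸ toℕ i)) ≈ Σ≐ n T
  sum≈Σ≐ zero    T = +-identityʳ _
  sum≈Σ≐ (suc n) T = +-congˡ (sum≈Σ≐ n (λ i j → T (suc i) j))

  infixl 7 _⊛_
  _⊛_ : (ℕ → Carrier) → (ℕ → Carrier) → ℕ → Carrier
  (a ⊛ b) n = Σ≐ n λ i j → a i * b j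

  1ₚ : ℕ → Carrier
  1ₚ zero    = 1#
  1ₚ (suc _) = 0#

  ⊛-identityˡ : ∀ a n → (1ₚ ⊛ a) n ≈ a n
  ⊛-identityˡ a zero    = *-identityˡ _
  ⊛-identityˡ a (suc n) =
    trans (+-cong (*-identityˡ _) (Σ≐-zero n λ i j → zeroˡ _)) (+-identityʳ _)

  ⊛-comm : ∀ a b n → (a ⊛ b) n ≈ (b ⊛ a) n
  ⊛-comm a b n = trans (Σ≐-flip n _) (Σ≐-cong n λ i j → *-comm _ _)

  ⊛-distribˡ : ∀ a b c n → (a ⊛ (λ k → b k + c k)) n ≈ (a ⊛ b) n + (a ⊛ c) n
  ⊛-distribˡ a b c n = trans (Σ≐-cong n λ i j → distribˡ _ _ _) (Σ≐-+ n _ _)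

  ⊛-assoc : ∀ a b c n → ((a ⊛ b) ⊛ c) n ≈ (a ⊛ (b ⊛ c)) n
  ⊛-assoc a b c n = begin
    Σ≐ n (λ i k → Σ≐ i (λ p q → a p * b q) * c k)   ≈⟨ Σ≐-cong n (λ i k → Σ≐-*ʳ i (c k) _) ⟩
    Σ≐ n (λ i k → Σ≐ i (λ p q → a p * b q * c k))   ≈⟨ Σ≐-assoc n _ ⟩
    Σ≐ n (λ p m → Σ≐ m (λ q k → a p * b q * c k))
      ≈⟨ Σ≐-cong n (λ p m → trans (Σ≐-cong m λ q k → *-assoc _ _ _) (sym (Σ≐-*ˡ m (a p) _))) ⟩
    Σ≐ n (λ p m → a p * Σ≐ m (λ q k → b q * c k))   ∎

  commutativeRingₚ : CommutativeRing 0ℓ 0ℓ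
  commutativeRingₚ = record
    { Carrier = ℕ → Carrier ; _≈_ = λ a b → ∀ n → a n ≈ b n
    ; _+_ = λ a b n → a n + b n ; _*_ = _⊛_ ; -_ = λ a n → - a n ; 0# = λ _ → 0# ; 1# = 1ₚ
    ; isCommutativeRing = record
      { isRing = record
        { +-isAbelianGroup = record
          { isGroup = record
            { isMonoid = record
              { isSemigroup = record
                { isMagma = record
                  { isEquivalence = record
                    { refl = λ _ → refl ; sym = λ e n → sym (e n) ; trans = λ e e′ n → trans (e n) (e′ n) }
                  ; ∙-cong = λ e e′ n → +-cong (e n) (e′ n)
                  }
                ; assoc = λ a b c n → +-assoc _ _ _
                }
              ; identity = (λ a n → +-identityˡ _) , (λ a n → +-identityʳ _)
              }
            ; inverse = (λ a n → -‿inverseˡ _) , (λ a n → -‿inverseʳ _)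
            ; ⁻¹-cong = λ e n → -‿cong (e n)
            }
          ; comm = λ a b n → +-comm _ _
          }
        ; *-cong = λ e e′ n → Σ≐-cong n λ i j → *-cong (e i) (e′ j)
        ; *-assoc = ⊛-assoc
        ; *-identity = ⊛-identityˡ , λ a n → trans (⊛-comm a 1ₚ n) (⊛-identityˡ a n)
        ; distrib = ⊛-distribˡ , λ a b c n →
            trans (⊛-comm _ a n) (trans (⊛-distribˡ a b c n) (+-cong (⊛-comm a b n) (⊛-comm a c n)))
        }
      ; *-comm = ⊛-comm
      }
    }

module RingIdentities (R : CommutativeRing 0ℓ 0ℓ) where
  open CommutativeRing R
  open Algebra.Solver.Ring.NaturalCoefficients.Default commutativeSemiring using (solve; _:+_; _:*_; _:=_)

  b+[a-b]≈a : ∀ a b → b + (a + - b) ≈ a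
  b+[a-b]≈a a b = trans (+-comm b _) (trans (+-assoc a _ b) (trans (+-congˡ (-‿inverseˡ b)) (+-identityʳ a)))

  a+b-a≈b : ∀ a b → a + b + - a ≈ b
  a+b-a≈b a b = trans (+-assoc a b _) (trans (+-congˡ (+-comm b _)) (trans (sym (+-assoc a _ b))
    (trans (+-congʳ (-‿inverseʳ a)) (+-identityˡ b))))

  c*a≈c*b+c*[a-b] : ∀ c a b → c * a ≈ c * b + c * (a + - b)
  c*a≈c*b+c*[a-b] c a b = trans (*-congˡ (sym (b+[a-b]≈a a b))) (distribˡ c b _)

  b+[a-b+c]≈a+c : ∀ a b c → b + (a + - b + c) ≈ a + c
  b+[a-b+c]≈a+c a b c = trans (sym (+-assoc b _ c)) (+-congʳ (b+[a-b]≈a a b))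

  scale-linear : ∀ c u a x b → c * (u * a + x * b) ≈ u * (c * a) + x * (c * b)
  scale-linear = solve 5 (λ c u a x b → c :* (u :* a :+ x :* b) := u :* (c :* a) :+ x :* (c :* b)) refl

  pascal-term : ∀ a b t p y → (a + b) * (t * p) * y ≈ a * (t * p) * y + t * (b * p * y)
  pascal-term = solve 5 (λ a b t p y → (a :+ b) :* (t :* p) :* y := a :* (t :* p) :* y :+ t :* (b :* p :* y)) refl

  geometric-head : ∀ u b → u * 1# * b ≈ u * b
  geometric-head u b = *-congʳ (*-identityʳ u)

  geometric-tail : ∀ u y p b → u * (y * p) * b ≈ y * (u * p * b)
  geometric-tail = solve 4 (λ u y p b → u :* (y :* p) :* b := y :* (u :* p :* b)) refl

  regroup : ∀ t y u a b c → u * a + y * b + t * y * c ≈ u * a + y * (b + t * c)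
  regroup = solve 6 (λ t y u a b c → u :* a :+ y :* b :+ t :* y :* c := u :* a :+ y :* (b :+ t :* c)) refl

-- Convergence reduced to the rules that termwise proofs use: two sums are equal as soon as both are
-- limits of the same terms.
record Summation (R : CommutativeRing 0ℓ 0ℓ) : Set₁ where
  open CommutativeRing R
  infix 4 _⇒_
  field
    _⇒_      : (ℕ → Carrier) → Carrier → Set
    ⇒-unique : ∀ {F s t} → F ⇒ s → F ⇒ t → s ≈ t
    ⇒-cong   : ∀ {F G s} → (∀ k → F k ≈ G k) → F ⇒ s → G ⇒ s
    ⇒-+      : ∀ {F G s t} → F ⇒ s → G ⇒ t → (λ k → F k + G k) ⇒ s + t
    ⇒-*      : ∀ {F s} c → F ⇒ s → (λ k → c * F k) ⇒ c * s
    ⇒-suc    : ∀ {F s} → (λ k → F (suc k)) ⇒ s → F ⇒ F 0 + s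
    ⇒-tail   : ∀ {F s} → F ⇒ s → (λ k → F (suc k)) ⇒ s + - F 0
    ⇒-zero   : ∀ {F} → (∀ k → F k ≈ 0#) → F ⇒ 0#

-- Generating functions

-- E p q n m stands for the coefficient of u^m in (1 + β u⁻¹)ⁿ Σₖ G[ p / q ] k uᵏ.
record EntryLaws (R : CommutativeRing 0ℓ 0ℓ) (β : CommutativeRing.Carrier R) (x : ℕ → CommutativeRing.Carrier R)
                 (E : ℕ → ℕ → ℤ → ℤ → CommutativeRing.Carrier R) : Set where
  open CommutativeRing R
  field
    1+βx-cancelˡ : ∀ k {a b} → (1# + β * x k) * a ≈ (1# + β * x k) * b → a ≈ b
    E-peel   : ∀ {p q} → q ≤ p → ∀ n m → E p q n m ≈ (1# + β * x q) * E p (suc q) n m + x q * E p q n (ℤ.pred m)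
    E-pascal : ∀ p q n m → E p q (ℤ.suc n) m ≈ E p q n m + β * E p q n (ℤ.suc m)
    E-vanish : ∀ p q k m → m ℤ.≤ -[1+ k ] → E p q (+ suc k) m ≈ 0#
    E-empty  : ∀ {p q} → p < q → ∀ n k → E p q n (+ suc k) ≈ 0#
    E-0-0    : ∀ p q → E p q 0ℤ 0ℤ ≈ 1#

module GeometricFactor (R : CommutativeRing 0ℓ 0ℓ) (u y : CommutativeRing.Carrier R) where
  open CommutativeRing R
  open RingIdentities R
  open import Algebra.Properties.Semiring.Exp semiring using (_^_)
  open import Algebra.Properties.Semiring.Sum semiring using (sum; sum-cong-≋; *-distribˡ-sum)

  -- Coefficients of u / (1 - y t) times a power series in t.
  times : (ℕ → Carrier) → ℕ → Carrier
  times B n = sum {suc n} λ k → u * y ^ toℕ k * B (n ∸ toℕ k)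

  times-zero : ∀ B → times B 0 ≈ u * B 0 + y * 0#
  times-zero B = +-cong (geometric-head u (B 0)) (sym (zeroʳ y))

  -- The terms with k ≥ 1 share a factor y, and without it they form the coefficient one degree
  -- lower.
  times-suc : ∀ B n → times B (suc n) ≈ u * B (suc n) + y * times B n
  times-suc B n = +-cong (geometric-head u (B (suc n))) (trans
    (sum-cong-≋ {suc n} λ k → geometric-tail u y (y ^ toℕ k) (B (n ∸ toℕ k)))
    (sym (*-distribˡ-sum {suc n} y (λ k → u * y ^ toℕ k * B (n ∸ toℕ k)))))

  times-neg : 0# ≈ u * 0# + y * 0#
  times-neg = sym (trans (+-cong (zeroʳ u) (zeroʳ y)) (+-identityʳ 0#))

module GeneratingFunctions (R : CommutativeRing 0ℓ 0ℓ) (S : Summation R) where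
  open CommutativeRing R
  open Summation S
  open RingIdentities R
  open import Algebra.Properties.Semiring.Exp semiring using (_^_)
  open import Relation.Binary.Reasoning.Setoid setoid

  -- `A p q m` stands for the coefficient of u^m in the product of (1 + β xᵢ) / (1 - xᵢ u) over q ≤
  -- i ≤ p. Only its recursion and boundary values enter.
  module Entries
    (β : Carrier) (x : ℕ → Carrier)
    (1+βx-cancelˡ : ∀ k {a b} → (1# + β * x k) * a ≈ (1# + β * x k) * b → a ≈ b)
    (binomial : ℤ → ℕ → ℤ)
    (binomial-zeroʳ : ∀ n → binomial n 0 ≡ 1ℤ) (binomial-zeroˡ : ∀ s → binomial 0ℤ (suc s) ≡ 0ℤ)
    (binomial-pascal : ∀ n s → binomial (ℤ.suc n) (suc s) ≡ binomial n (suc s) ℤ.+ binomial n s)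
    (fromℤ : ℤ → Carrier) (fromℤ-0 : fromℤ 0ℤ ≈ 0#) (fromℤ-1 : fromℤ 1ℤ ≈ 1#)
    (fromℤ-+ : ∀ a b → fromℤ (a ℤ.+ b) ≈ fromℤ a + fromℤ b)
    (A : ℕ → ℕ → ℤ → Carrier)
    (A-peel : ∀ {p q} → q ≤ p → ∀ m → A p q m ≈ (1# + β * x q) * A p (suc q) m + x q * A p q (ℤ.pred m))
    (A-empty : ∀ {p q} → p < q → ∀ n → A p q (+ suc n) ≈ 0#)
    (A-empty-zero : ∀ {p q} → p < q → A p q 0ℤ ≈ 1#)
    (A-neg : ∀ p q n → A p q -[1+ n ] ≈ 0#)
    (G : ℕ → ℕ → ℤ → Carrier) (E : ℕ → ℕ → ℤ → ℤ → Carrier)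
    (G-⇒ : ∀ p q m → (λ k → (- β) ^ k * A p q (m ℤ.+ + k)) ⇒ G p q m)
    (E-⇒ : ∀ p q n m → (λ s → fromℤ (binomial n s) * β ^ s * G p q (m ℤ.+ + s)) ⇒ E p q n m)
    where

    G-term : ℕ → ℕ → ℤ → ℕ → Carrier
    G-term p q m k = (- β) ^ k * A p q (m ℤ.+ + k)

    E-term : ℕ → ℕ → ℤ → ℤ → ℕ → Carrier
    E-term p q n m s = fromℤ (binomial n s) * β ^ s * G p q (m ℤ.+ + s)

    [1+βx_] : ℕ → Carrier
    [1+βx i ] = 1# + β * x i

    -- The recursion of `A` holds in every term of the series, and limits are unique.
    G-peel : ∀ {p q} → q ≤ p → ∀ m → G p q m ≈ [1+βx q ] * G p (suc q) m + x q * G p q (ℤ.pred m)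
    G-peel {p} {q} q≤p m = ⇒-unique (G-⇒ p q m)
      (⇒-cong term (⇒-+ (⇒-* [1+βx q ] (G-⇒ p (suc q) m)) (⇒-* (x q) (G-⇒ p q (ℤ.pred m)))))
      where
      term : ∀ k → [1+βx q ] * G-term p (suc q) m k + x q * G-term p q (ℤ.pred m) k ≈ G-term p q m k
      term k rewrite ℤₚ.+-assoc -1ℤ m (+ k) = trans
        (sym (scale-linear ((- β) ^ k) [1+βx q ] (A p (suc q) (m ℤ.+ + k)) (x q) (A p q (ℤ.pred (m ℤ.+ + k)))))
        (*-congˡ (sym (A-peel q≤p (m ℤ.+ + k))))

    m+suc : ∀ m k → m ℤ.+ + suc k ≡ ℤ.suc m ℤ.+ + k
    m+suc m k = ≡.trans (≡.sym (ℤₚ.+-assoc m 1ℤ (+ k))) (≡.cong (ℤ._+ + k) (ℤₚ.+-comm m 1ℤ))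

    -- Multiplication by 1 + β u⁻¹.
    G+βG : ∀ p q m → G p q m + β * G p q (ℤ.suc m) ≈ A p q m
    G+βG p q m = begin
      G p q m + β * G p q (ℤ.suc m)
        ≈⟨ +-congʳ (⇒-unique (G-⇒ p q m) (⇒-suc (⇒-cong term (⇒-* (- β) (G-⇒ p q (ℤ.suc m)))))) ⟩
      1# * A p q (m ℤ.+ 0ℤ) + - β * G p q (ℤ.suc m) + β * G p q (ℤ.suc m)
        ≈⟨ +-assoc (1# * A p q (m ℤ.+ 0ℤ)) (- β * G p q (ℤ.suc m)) (β * G p q (ℤ.suc m)) ⟩
      1# * A p q (m ℤ.+ 0ℤ) + (- β * G p q (ℤ.suc m) + β * G p q (ℤ.suc m))
        ≈⟨ +-cong (*-identityˡ (A p q (m ℤ.+ 0ℤ))) (sym (distribʳ (G p q (ℤ.suc m)) (- β) β)) ⟩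
      A p q (m ℤ.+ 0ℤ) + (- β + β) * G p q (ℤ.suc m)
        ≈⟨ +-congˡ (trans (*-congʳ (-‿inverseˡ β)) (zeroˡ (G p q (ℤ.suc m)))) ⟩
      A p q (m ℤ.+ 0ℤ) + 0#
        ≈⟨ +-identityʳ _ ⟩
      A p q (m ℤ.+ 0ℤ)
        ≡⟨ ≡.cong (A p q) (ℤₚ.+-identityʳ m) ⟩
      A p q m ∎
      where
      -- The terms with k ≥ 1 are - β times the series for m + 1, so they cancel and only `A p q m`
      -- remains.
      term : ∀ k → - β * G-term p q (ℤ.suc m) k ≈ G-term p q m (suc k)
      term k rewrite m+suc m k = sym (*-assoc (- β) ((- β) ^ k) (A p q (ℤ.suc m ℤ.+ + k)))

    G-empty : ∀ {p q} → p < q → ∀ n → G p q (+ suc n) ≈ 0#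
    G-empty {p} {q} p<q n = ⇒-unique (G-⇒ p q (+ suc n)) (⇒-zero λ k →
      trans (*-congˡ (A-empty p<q (n ℕ.+ k))) (zeroʳ ((- β) ^ k)))

    -- The coefficient of u⁰ is Σ (- β)ᵏ Aₖ, the product evaluated at u = - β, where every factor is
    -- (1 + β xᵢ) / (1 + β xᵢ). The induction removes one factor at a time and cancels 1 + β x_q.
    G-zero : ∀ p q → G p q 0ℤ ≈ 1#
    G-zero p q = go (suc p) q (ℕₚ.m≤n+m (suc p) q)
      where
      base : ∀ q → p < q → G p q 0ℤ ≈ 1#
      base q p<q = begin
        G p q 0ℤ                     ≈⟨ +-identityʳ _ ⟨
        G p q 0ℤ + 0#                ≈⟨ +-congˡ (trans (*-congˡ (G-empty p<q 0)) (zeroʳ β)) ⟨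
        G p q 0ℤ + β * G p q 1ℤ ≈⟨ G+βG p q 0ℤ ⟩
        A p q 0ℤ                     ≈⟨ A-empty-zero p<q ⟩
        1#                                ∎

      step : ∀ q → q ≤ p → G p (suc q) 0ℤ ≈ 1# → G p q 0ℤ ≈ 1#
      step q q≤p ih = 1+βx-cancelˡ q (begin
        [1+βx q ] * G₀
          ≈⟨ trans (distribʳ G₀ 1# (β * x q)) (+-congʳ (*-identityˡ G₀)) ⟩
        G₀ + β * x q * G₀
          ≈⟨ +-congʳ (G-peel q≤p 0ℤ) ⟩
        [1+βx q ] * G p (suc q) 0ℤ + x q * G p q -1ℤ + β * x q * G₀
          ≈⟨ regroup β (x q) [1+βx q ] (G p (suc q) 0ℤ) (G p q -1ℤ) G₀ ⟩
        [1+βx q ] * G p (suc q) 0ℤ + x q * (G p q -1ℤ + β * G₀)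
          ≈⟨ +-cong (*-congˡ ih) (trans (*-congˡ (trans (G+βG p q -1ℤ) (A-neg p q 0))) (zeroʳ (x q))) ⟩
        [1+βx q ] * 1# + 0#
          ≈⟨ +-identityʳ _ ⟩
        [1+βx q ] * 1# ∎)
        where G₀ = G p q 0ℤ

      go : ∀ d q → suc p ≤ q ℕ.+ d → G p q 0ℤ ≈ 1#
      go zero    q l = base q (≡.subst (suc p ≤_) (ℕₚ.+-identityʳ q) l)
      go (suc d) q l with q ℕₚ.≤? p
      ... | yes q≤p = step q q≤p (go d (suc q) (≡.subst (suc p ≤_) (ℕₚ.+-suc q d) l))
      ... | no  q≰p = base q (ℕₚ.≰⇒> q≰p)

    E-peel : ∀ {p q} → q ≤ p → ∀ n m → E p q n m ≈ [1+βx q ] * E p (suc q) n m + x q * E p q n (ℤ.pred m)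
    E-peel {p} {q} q≤p n m = ⇒-unique (E-⇒ p q n m)
      (⇒-cong term (⇒-+ (⇒-* [1+βx q ] (E-⇒ p (suc q) n m)) (⇒-* (x q) (E-⇒ p q n (ℤ.pred m)))))
      where
      term : ∀ s → [1+βx q ] * E-term p (suc q) n m s + x q * E-term p q n (ℤ.pred m) s ≈ E-term p q n m s
      term s rewrite ℤₚ.+-assoc -1ℤ m (+ s) = trans
        (sym (scale-linear (fromℤ (binomial n s) * β ^ s) [1+βx q ] (G p (suc q) (m ℤ.+ + s)) (x q) (G p q (ℤ.pred (m ℤ.+ + s)))))
        (*-congˡ (sym (G-peel q≤p (m ℤ.+ + s))))

    E-pascal : ∀ p q n m → E p q (ℤ.suc n) m ≈ E p q n m + β * E p q n (ℤ.suc m)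
    E-pascal p q n m = trans
      (trans (⇒-unique (E-⇒ p q (ℤ.suc n) m)
          -- Pascal's rule covers only s ≥ 1. The terms with s = 0 agree for n and n + 1, so one is
          -- removed and the other put in front.
          (⇒-suc (⇒-cong term (⇒-+ (⇒-tail (E-⇒ p q n m)) (⇒-* β (E-⇒ p q n (ℤ.suc m)))))))
        (+-congʳ (reflexive (≡.cong (λ b → fromℤ b * 1# * G p q (m ℤ.+ 0ℤ))
          (≡.trans (binomial-zeroʳ (ℤ.suc n)) (≡.sym (binomial-zeroʳ n)))))))
      (b+[a-b+c]≈a+c (E p q n m) (E-term p q n m 0) (β * E p q n (ℤ.suc m)))
      where
      term : ∀ s → E-term p q n m (suc s) + β * E-term p q n (ℤ.suc m) s ≈ E-term p q (ℤ.suc n) m (suc s)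
      term s rewrite binomial-pascal n s | m+suc m s = trans
        (sym (pascal-term (fromℤ (binomial n (suc s))) (fromℤ (binomial n s)) β (β ^ s) (G p q (ℤ.suc m ℤ.+ + s))))
        (*-congʳ (*-congʳ (sym (fromℤ-+ (binomial n (suc s)) (binomial n s)))))

    E-0 : ∀ p q m → E p q 0ℤ m ≈ G p q m
    E-0 p q m = begin
      E p q 0ℤ m                        ≈⟨ ⇒-unique (E-⇒ p q 0ℤ m) (⇒-suc (⇒-zero term)) ⟩
      E-term p q 0ℤ m 0 + 0#            ≈⟨ +-identityʳ _ ⟩
      E-term p q 0ℤ m 0                 ≡⟨ ≡.cong (λ b → fromℤ b * 1# * G p q (m ℤ.+ 0ℤ)) (binomial-zeroʳ 0ℤ) ⟩
      fromℤ 1ℤ * 1# * G p q (m ℤ.+ 0ℤ)   ≈⟨ trans (*-congʳ (trans (*-identityʳ (fromℤ 1ℤ)) fromℤ-1)) (*-identityˡ _) ⟩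
      G p q (m ℤ.+ 0ℤ)             ≡⟨ ≡.cong (G p q) (ℤₚ.+-identityʳ m) ⟩
      G p q m                      ∎
      where
      term : ∀ s → E-term p q 0ℤ m (suc s) ≈ 0#
      term s rewrite binomial-zeroˡ s = trans
        (*-congʳ (trans (*-congʳ fromℤ-0) (zeroˡ (β ^ suc s)))) (zeroˡ (G p q (m ℤ.+ + suc s)))

    E-0-0 : ∀ p q → E p q 0ℤ 0ℤ ≈ 1#
    E-0-0 p q = trans (E-0 p q 0ℤ) (G-zero p q)

    -- One factor of (1 + β u⁻¹)^(k+1) cancels 1 / (1 + β u⁻¹). What is left is (1 + β u⁻¹)^k times
    -- a power series in u, which has no power of u below - k.
    E-vanish : ∀ p q k m → m ℤ.≤ -[1+ k ] → E p q (+ suc k) m ≈ 0#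
    E-vanish p q zero m@(-[1+ n ]) l = trans (E-pascal p q 0ℤ m)
      (trans (+-cong (E-0 p q m) (*-congˡ (E-0 p q (ℤ.suc m)))) (trans (G+βG p q m) (A-neg p q n)))
    E-vanish p q (suc k) m l = trans (E-pascal p q (+ suc k) m) (trans
      (+-cong (E-vanish p q k m (ℤₚ.≤-trans l (ℤ.-≤- (ℕₚ.n≤1+n k))))
        (trans (*-congˡ (E-vanish p q k (ℤ.suc m) (ℤₚ.suc-mono l))) (zeroʳ β)))
      (+-identityʳ 0#))

    -- For an empty product the generating function is a power series in u⁻¹ alone, so it has no
    -- positive powers of u.
    E-empty : ∀ {p q} → p < q → ∀ n k → E p q n (+ suc k) ≈ 0#
    E-empty {p} {q} p<q n k = ⇒-unique (E-⇒ p q n (+ suc k)) (⇒-zero λ s →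
      trans (*-congˡ (G-empty p<q (k ℕ.+ s))) (zeroʳ (fromℤ (binomial n s) * β ^ s)))

    entryLaws : EntryLaws R β x E
    entryLaws = record
      { 1+βx-cancelˡ = 1+βx-cancelˡ ; E-peel = E-peel ; E-pascal = E-pascal
      ; E-vanish = E-vanish ; E-empty = E-empty ; E-0-0 = E-0-0 }

-- Determinants

toℕ-punchIn-≤ : ∀ {n} (j : Fin (suc n)) c → toℕ (punchIn j c) ≤ suc (toℕ c)
toℕ-punchIn-≤ fzero    c        = ℕₚ.≤-refl
toℕ-punchIn-≤ (fsuc j) fzero    = z≤n
toℕ-punchIn-≤ (fsuc j) (fsuc c) = s≤s (toℕ-punchIn-≤ j c)

toℕ-punchIn-< : ∀ {n} (j : Fin (suc n)) c → toℕ c < toℕ j → toℕ (punchIn j c) ≡ toℕ c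
toℕ-punchIn-< (fsuc j) fzero    l       = ≡.refl
toℕ-punchIn-< (fsuc j) (fsuc c) (s≤s l) = ≡.cong suc (toℕ-punchIn-< j c l)

data Adjacent : ∀ {n} → Fin n → Fin n → Set where
  here  : ∀ {n} → Adjacent {suc (suc n)} fzero (fsuc fzero)
  there : ∀ {n} {c c′ : Fin n} → Adjacent c c′ → Adjacent (fsuc c) (fsuc c′)

adjacent-≢ : ∀ {n} {c c′ : Fin n} → Adjacent c c′ → c ≢ c′
adjacent-≢ (there a) ≡.refl = adjacent-≢ a ≡.refl

-- Deleting a third column leaves the two adjacent, which carries the alternating property to
-- minors.
adjacent-punchIn : ∀ {n} {c c′ : Fin (suc n)} → Adjacent c c′ → ∀ j →
  j ≡ c ⊎ j ≡ c′ ⊎ ∃[ d ] ∃[ d′ ] (Adjacent d d′ × punchIn j d ≡ c × punchIn j d′ ≡ c′)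
adjacent-punchIn here fzero           = inj₁ ≡.refl
adjacent-punchIn here (fsuc fzero)    = inj₂ (inj₁ ≡.refl)
adjacent-punchIn {suc (suc n)} here (fsuc (fsuc j)) = inj₂ (inj₂ (fzero , fsuc fzero , here , ≡.refl , ≡.refl))
adjacent-punchIn (there a) fzero      = inj₂ (inj₂ (_ , _ , a , ≡.refl , ≡.refl))
adjacent-punchIn {suc n} (there a) (fsuc j) with adjacent-punchIn a j
... | inj₁ e = inj₁ (≡.cong fsuc e)
... | inj₂ (inj₁ e) = inj₂ (inj₁ (≡.cong fsuc e))
... | inj₂ (inj₂ (d , d′ , b , e , e′)) = inj₂ (inj₂ (fsuc d , fsuc d′ , there b , ≡.cong fsuc e , ≡.cong fsuc e′))

-- The two deletions differ only in which of the two columns survives, so equal columns give equal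
-- minors.
punchIn-adjacent : ∀ {n} {c c′ : Fin (suc n)} → Adjacent c c′ → ∀ b →
  punchIn c b ≡ punchIn c′ b ⊎ (punchIn c b ≡ c′ × punchIn c′ b ≡ c)
punchIn-adjacent here      fzero    = inj₂ (≡.refl , ≡.refl)
punchIn-adjacent here      (fsuc b) = inj₁ ≡.refl
punchIn-adjacent (there a) fzero    = inj₁ ≡.refl
punchIn-adjacent (there a) (fsuc b) with punchIn-adjacent a b
... | inj₁ e        = inj₁ (≡.cong fsuc e)
... | inj₂ (e , e′) = inj₂ (≡.cong fsuc e , ≡.cong fsuc e′)

adjacent-toℕ : ∀ {n} {c c′ : Fin n} → Adjacent c c′ → toℕ c′ ≡ suc (toℕ c)
adjacent-toℕ here      = ≡.refl
adjacent-toℕ (there a) = ≡.cong suc (adjacent-toℕ a)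

module Determinant (R : CommutativeRing 0ℓ 0ℓ) where
  open CommutativeRing R hiding (zero)
  open Algebra.Properties.Ring ring using (-‿distribˡ-*; -1*x≈-x)
  open Algebra.Properties.Semiring.Exp semiring using (_^_)
  open Algebra.Properties.Semiring.Sum semiring using (sum; sum-cong-≋; ∑-distrib-+; *-distribˡ-sum; sum-replicate-zero)
  open Algebra.Solver.Ring.NaturalCoefficients.Default commutativeSemiring using (solve; _:+_; _:*_; _:=_)
  open Relation.Binary.Reasoning.Setoid setoid

  Matrix : ℕ → Set
  Matrix n = Fin n → Fin n → Carrier

  minor : ∀ {n} → Matrix (suc n) → Fin (suc n) → Matrix n
  minor M j a b = M (fsuc a) (punchIn j b)

  sign : ∀ {n} → Fin n → Carrier
  sign j = (- 1#) ^ toℕ j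

  det : ∀ {n} → Matrix n → Carrier
  det {zero}  M = 1#
  det {suc n} M = sum λ j → sign j * (M fzero j * det (minor M j))

  sum-zero : ∀ {n} {t : Fin n → Carrier} → (∀ i → t i ≈ 0#) → sum t ≈ 0#
  sum-zero {n} z = trans (sum-cong-≋ z) (sum-replicate-zero n)

  det-cong : ∀ {n} {M N : Matrix n} → (∀ a b → M a b ≈ N a b) → det M ≈ det N
  det-cong {zero}  e = refl
  det-cong {suc n} e = sum-cong-≋ λ j →
    *-congˡ {sign j} (*-cong (e fzero j) (det-cong λ a b → e (fsuc a) (punchIn j b)))

  term-zeroˡ : ∀ s {m} d → m ≈ 0# → s * (m * d) ≈ 0#
  term-zeroˡ s d z = trans (*-congˡ (trans (*-congʳ z) (zeroˡ d))) (zeroʳ s)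

  term-zeroʳ : ∀ s m {d} → d ≈ 0# → s * (m * d) ≈ 0#
  term-zeroʳ s m z = trans (*-congˡ (trans (*-congˡ z) (zeroʳ m))) (zeroʳ s)

  -- The block has n - p rows and q columns, more than n together, so no permutation avoids it. In
  -- the expansion, deleting a row above the block and any column costs at most one zero column;
  -- once p = 0, the first q columns are zero.
  det-zero-block : ∀ {n} p q (M : Matrix n) → p < q → q ≤ n →
    (∀ a c → p ≤ toℕ a → toℕ c < q → M a c ≈ 0#) → det M ≈ 0#
  det-zero-block {zero}  p       q M p<q z≤n z = contradiction p<q λ ()
  det-zero-block {suc n} zero    q M p<q q≤n z = sum-zero term
    where
    term : ∀ j → sign j * (M fzero j * det (minor M j)) ≈ 0#
    term j with toℕ j ℕₚ.<? q
    ... | yes j<q = term-zeroˡ (sign j) (det (minor M j)) (z fzero j z≤n j<q)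
    ... | no  j≮q = term-zeroʳ (sign j) (M fzero j) (det-zero-block zero q (minor M j) p<q
            (ℕₚ.≤-trans q≤j (ℕ.s≤s⁻¹ (toℕ<n j)))
            λ a c _ c<q → z (fsuc a) (punchIn j c) z≤n
              (≡.subst (_< q) (≡.sym (toℕ-punchIn-< j c (ℕₚ.<-≤-trans c<q q≤j))) c<q))
      where q≤j = ℕₚ.≮⇒≥ j≮q
  det-zero-block {suc n} (suc p) (suc q) M (s≤s p<q) (s≤s q≤n) z = sum-zero λ j →
    term-zeroʳ (sign j) (M fzero j) (det-zero-block p q (minor M j) p<q q≤n
      λ a c p≤a c<q → z (fsuc a) (punchIn j c) (s≤s p≤a) (ℕₚ.≤-<-trans (toℕ-punchIn-≤ j c) (s≤s c<q)))

  -- Every minor but the first keeps the zero part of the first column.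
  det-unit-first-column : ∀ {n} (M : Matrix (suc n)) → M fzero fzero ≈ 1# → (∀ a → M (fsuc a) fzero ≈ 0#) →
    det M ≈ det (λ a b → M (fsuc a) (fsuc b))
  det-unit-first-column {n} M one z = begin
    1# * (M fzero fzero * det M′) + sum (λ j → sign (fsuc j) * (M fzero (fsuc j) * det (minor M (fsuc j))))
      ≈⟨ +-cong (trans (*-identityˡ _) (trans (*-congʳ one) (*-identityˡ _)))
           (sum-zero λ j → term-zeroʳ (sign (fsuc j)) (M fzero (fsuc j)) (vanish j)) ⟩
    det M′ + 0# ≈⟨ +-identityʳ _ ⟩
    det M′ ∎
    where
    M′ = minor M fzero
    vanish : ∀ (j : Fin n) → det (minor M (fsuc j)) ≈ 0#
    vanish j = det-zero-block 0 1 (minor M (fsuc j)) (s≤s z≤n) (ℕₚ.≤-trans (s≤s z≤n) (toℕ<n j)) zeros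
      where
      zeros : ∀ a c → 0 ≤ toℕ a → toℕ c < 1 → minor M (fsuc j) a c ≈ 0#
      zeros a fzero _ _ = z a
      zeros a (fsuc c) _ (s≤s ())

  -- Only columns beyond k contribute to the expansion. Deleting one of them keeps all k + 1 zero
  -- columns, while the first row is gone, so the zero block of the minor is too large.
  det-zero-hook : ∀ {n} k (M : Matrix (suc n)) → (∀ j → toℕ j < suc k → M fzero j ≈ 0#) →
    (∀ a c → suc k ≤ toℕ a → toℕ c < suc k → M a c ≈ 0#) → det M ≈ 0#
  det-zero-hook k M z₀ z = sum-zero term
    where
    term : ∀ j → sign j * (M fzero j * det (minor M j)) ≈ 0#
    term j with toℕ j ℕₚ.<? suc k
    ... | yes j<k = term-zeroˡ (sign j) (det (minor M j)) (z₀ j j<k)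
    ... | no  j≮k = term-zeroʳ (sign j) (M fzero j) (det-zero-block k (suc k) (minor M j) ℕₚ.≤-refl
            (ℕₚ.≤-trans k<j (ℕ.s≤s⁻¹ (toℕ<n j)))
            λ a c k≤a c<k → z (fsuc a) (punchIn j c) (s≤s k≤a)
              (≡.subst (_< suc k) (≡.sym (toℕ-punchIn-< j c (ℕₚ.<-≤-trans c<k k<j))) c<k))
      where k<j = ℕₚ.≮⇒≥ j≮k

  det-linear : ∀ {n} (c : Fin n) s t {M P Q : Matrix n} →
    (∀ a → M a c ≈ s * P a c + t * Q a c) →
    (∀ a b → b ≢ c → M a b ≈ P a b) → (∀ a b → b ≢ c → M a b ≈ Q a b) →
    det M ≈ s * det P + t * det Q
  det-linear {suc n} c s t {M} {P} {Q} lin p q = begin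
    sum (λ j → term M j)
      ≈⟨ sum-cong-≋ split ⟩
    sum (λ j → s * term P j + t * term Q j)
      ≈⟨ ∑-distrib-+ (λ j → s * term P j) (λ j → t * term Q j) ⟩
    sum (λ j → s * term P j) + sum (λ j → t * term Q j)
      ≈⟨ +-cong (*-distribˡ-sum s (term P)) (*-distribˡ-sum t (term Q)) ⟨
    s * det P + t * det Q ∎
    where
    term : Matrix (suc n) → Fin (suc n) → Carrier
    term N j = sign j * (N fzero j * det (minor N j))

    split : ∀ j → term M j ≈ s * term P j + t * term Q j
    split j with j Finₚ.≟ c
    ... | yes ≡.refl = begin
      sign j * (M fzero j * det (minor M j))
        ≈⟨ *-congˡ (*-congʳ (lin fzero)) ⟩
      sign j * ((s * P fzero j + t * Q fzero j) * det (minor M j))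
        ≈⟨ solve 6 (λ e s p t q d → e :* ((s :* p :+ t :* q) :* d) := s :* (e :* (p :* d)) :+ t :* (e :* (q :* d)))
             refl (sign j) s (P fzero j) t (Q fzero j) (det (minor M j)) ⟩
      s * (sign j * (P fzero j * det (minor M j))) + t * (sign j * (Q fzero j * det (minor M j)))
        ≈⟨ +-cong (*-congˡ (*-congˡ (*-congˡ (det-cong λ a b → p (fsuc a) (punchIn j b) (punchInᵢ≢i j b)))))
             (*-congˡ (*-congˡ (*-congˡ (det-cong λ a b → q (fsuc a) (punchIn j b) (punchInᵢ≢i j b))))) ⟩
      s * term P j + t * term Q j ∎
    ... | no j≢c = begin
      sign j * (M fzero j * det (minor M j))
        ≈⟨ *-congˡ (*-congˡ (det-linear c′ s t
             (λ a → ≡.subst (λ b → M (fsuc a) b ≈ s * P (fsuc a) b + t * Q (fsuc a) b) (≡.sym c≡) (lin (fsuc a)))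
             (λ a b b≢ → p (fsuc a) (punchIn j b) (other b≢))
             (λ a b b≢ → q (fsuc a) (punchIn j b) (other b≢)))) ⟩
      sign j * (M fzero j * (s * det (minor P j) + t * det (minor Q j)))
        ≈⟨ solve 6 (λ e m s p t q → e :* (m :* (s :* p :+ t :* q)) := s :* (e :* (m :* p)) :+ t :* (e :* (m :* q)))
             refl (sign j) (M fzero j) s (det (minor P j)) t (det (minor Q j)) ⟩
      s * (sign j * (M fzero j * det (minor P j))) + t * (sign j * (M fzero j * det (minor Q j)))
        ≈⟨ +-cong (*-congˡ (*-congˡ (*-congʳ (p fzero j j≢c)))) (*-congˡ (*-congˡ (*-congʳ (q fzero j j≢c)))) ⟩
      s * term P j + t * term Q j ∎
      where
      c′ = punchOut j≢c
      c≡ = punchIn-punchOut j≢c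
      other : ∀ {b} → b ≢ c′ → punchIn j b ≢ c
      other {b} b≢ e = b≢ (punchIn-injective j b c′ (≡.trans e (≡.sym c≡)))

  sum-cancel : ∀ {n} {c c′ : Fin n} → Adjacent c c′ → (t : Fin n → Carrier) → t c + t c′ ≈ 0# →
    (∀ j → j ≢ c → j ≢ c′ → t j ≈ 0#) → sum t ≈ 0#
  sum-cancel here t z zs = trans (sym (+-assoc _ _ _)) (trans (+-cong z
    (sum-zero λ j → zs (fsuc (fsuc j)) (λ ()) λ ())) (+-identityʳ 0#))
  sum-cancel (there a) t z zs = trans (+-cong (zs fzero (λ ()) λ ())
    (sum-cancel a (λ j → t (fsuc j)) z λ j ≢c ≢c′ →
      zs (fsuc j) (λ { ≡.refl → ≢c ≡.refl }) λ { ≡.refl → ≢c′ ≡.refl }))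
    (+-identityʳ 0#)

  -- The terms of the two columns have equal entries, equal minors and opposite signs; in every
  -- other term the minor again has two equal adjacent columns.
  det-alternating : ∀ {n} {c c′ : Fin n} → Adjacent c c′ → (M : Matrix n) →
    (∀ a → M a c ≈ M a c′) → det M ≈ 0#
  det-alternating {suc n} {c} {c′} adj M e = sum-cancel adj term cancel vanish
    where
    term : Fin (suc n) → Carrier
    term j = sign j * (M fzero j * det (minor M j))

    minors : ∀ a b → minor M c a b ≈ minor M c′ a b
    minors a b with punchIn-adjacent adj b
    ... | inj₁ p        = reflexive (≡.cong (M (fsuc a)) p)
    ... | inj₂ (p , p′) = trans (reflexive (≡.cong (M (fsuc a)) p))
      (trans (sym (e (fsuc a))) (reflexive (≡.sym (≡.cong (M (fsuc a)) p′))))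

    cancel : term c + term c′ ≈ 0#
    cancel = begin
      term c + sign c′ * (M fzero c′ * det (minor M c′))
        ≈⟨ +-congˡ (*-cong
             (trans (reflexive (≡.cong ((- 1#) ^_) (adjacent-toℕ adj))) (-1*x≈-x (sign c)))
             (*-cong (sym (e fzero)) (sym (det-cong minors)))) ⟩
      term c + - sign c * (M fzero c * det (minor M c))
        ≈⟨ +-congˡ (-‿distribˡ-* (sign c) (M fzero c * det (minor M c))) ⟨
      term c + - term c ≈⟨ -‿inverseʳ (term c) ⟩
      0# ∎

    vanish : ∀ j → j ≢ c → j ≢ c′ → term j ≈ 0#
    vanish j ≢c ≢c′ with adjacent-punchIn adj j
    ... | inj₁ p = contradiction p ≢c
    ... | inj₂ (inj₁ p) = contradiction p ≢c′
    ... | inj₂ (inj₂ (d , d′ , adj′ , p , p′)) = term-zeroʳ (sign j) (M fzero j)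
      (det-alternating adj′ (minor M j) λ a →
        trans (reflexive (≡.cong (M (fsuc a)) p)) (trans (e (fsuc a)) (reflexive (≡.sym (≡.cong (M (fsuc a)) p′)))))

  replaceColumn : ∀ {n} → Fin n → (Fin n → Carrier) → Matrix n → Matrix n
  replaceColumn c v M a b with b Finₚ.≟ c
  ... | yes _ = v a
  ... | no  _ = M a b

  replaceColumn-same : ∀ {n} c v (M : Matrix n) a → replaceColumn c v M a c ≈ v a
  replaceColumn-same c v M a with c Finₚ.≟ c
  ... | yes _ = refl
  ... | no  n = contradiction ≡.refl n

  replaceColumn-other : ∀ {n} c v (M : Matrix n) a b → b ≢ c → replaceColumn c v M a b ≈ M a b
  replaceColumn-other c v M a b b≢c with b Finₚ.≟ c
  ... | yes e = contradiction e b≢c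
  ... | no  _ = refl

  -- With column c′ of `Q` scaled by u, the determinant is u * det `Q`. Splitting that column by
  -- `op` gives u * det `P` and y times a determinant with equal columns c and c′.
  det-column-operation : ∀ {n} {c c′ : Fin n} → Adjacent c c′ → ∀ u y (P Q : Matrix n) →
    (∀ a → u * Q a c′ ≈ u * P a c′ + y * Q a c) → (∀ a b → b ≢ c′ → Q a b ≈ P a b) →
    u * det Q ≈ u * det P
  det-column-operation {n} {c} {c′} adj u y P Q op same = begin
    u * det Q              ≈⟨ trans (+-congˡ (zeroˡ (det Q))) (+-identityʳ _) ⟨
    u * det Q + 0# * det Q
      ≈⟨ det-linear c′ u 0# (λ a → trans (M-c′ a) (sym (trans (+-congˡ (zeroˡ (Q a c′))) (+-identityʳ _)))) M-other M-other ⟨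
    det M
      ≈⟨ det-linear c′ u y
           (λ a → trans (M-c′ a) (trans (op a) (+-congˡ (*-congˡ (sym (replaceColumn-same c′ (λ a → Q a c) Q a))))))
           (λ a b ≢ → trans (M-other a b ≢) (same a b ≢))
           (λ a b ≢ → trans (M-other a b ≢) (sym (replaceColumn-other c′ (λ a → Q a c) Q a b ≢))) ⟩
    u * det P + y * det N
      ≈⟨ +-congˡ (trans (*-congˡ (det-alternating adj N λ a →
           trans (replaceColumn-other c′ (λ a → Q a c) Q a c (adjacent-≢ adj))
             (sym (replaceColumn-same c′ (λ a → Q a c) Q a)))) (zeroʳ y)) ⟩
    u * det P + 0#         ≈⟨ +-identityʳ _ ⟩
    u * det P              ∎
    where
    M N : Matrix n
    M = replaceColumn c′ (λ a → u * Q a c′) Q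
    N = replaceColumn c′ (λ a → Q a c) Q
    M-c′ : ∀ a → M a c′ ≈ u * Q a c′
    M-c′ = replaceColumn-same c′ (λ a → u * Q a c′) Q
    M-other : ∀ a b → b ≢ c′ → M a b ≈ Q a b
    M-other = replaceColumn-other c′ (λ a → u * Q a c′) Q

-- Tableaux row by row

applyUpTo-cong : ∀ {f g : ℕ → ℕ} → (∀ i → f i ≡ g i) → ∀ n → applyUpTo f n ≡ applyUpTo g n
applyUpTo-cong e zero    = ≡.refl
applyUpTo-cong e (suc n) = ≡.cong₂ _∷_ (e 0) (applyUpTo-cong (λ i → e (suc i)) n)

interval-∷ : ∀ {q p} → q ≤ p → interval q p ≡ q ∷ interval (suc q) p
interval-∷ {q} {p} q≤p = ≡.trans (≡.cong (applyUpTo (q ℕ.+_)) (ℕₚ.+-∸-assoc 1 q≤p))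
  (≡.cong₂ _∷_ (ℕₚ.+-identityʳ q) (applyUpTo-cong (ℕₚ.+-suc q) (p ∸ q)))

interval-[] : ∀ {q p} → p < q → interval q p ≡ []
interval-[] {q} p<q = ≡.cong (applyUpTo (q ℕ.+_)) (ℕₚ.m≤n⇒m∸n≡0 p<q)

update : (ℕ → ℕ) → ℕ → ℕ → ℕ → ℕ
update h zero    v zero    = v
update h zero    v (suc c) = h (suc c)
update h (suc i) v zero    = h 0
update h (suc i) v (suc c) = update (h ∘ suc) i v c

update-same : ∀ h i v → update h i v i ≡ v
update-same h zero    v = ≡.refl
update-same h (suc i) v = update-same (h ∘ suc) i v

update-other : ∀ h i v c → c ≢ i → update h i v c ≡ h c
update-other h zero    v zero    c≢i = contradiction ≡.refl c≢i
update-other h zero    v (suc c) c≢i = ≡.refl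
update-other h (suc i) v zero    c≢i = ≡.refl
update-other h (suc i) v (suc c) c≢i = update-other (h ∘ suc) i v c (c≢i ∘ ≡.cong suc)

subsets-≥ : ∀ {g} {as} → All (g ≤_) as → All (λ s → g ≤ minimum s × g ≤ maximum s) (nonEmptySubsets as)
subsets-≥ []       = []
subsets-≥ {g} (p ∷ ps) = (p , p) ∷ Allₚ.++⁺
  (Allₚ.map⁺ (All.map (λ (q , q′) → ℕₚ.⊓-glb p q , ℕₚ.≤-trans q′ (ℕₚ.m≤n⊔m _ _)) (subsets-≥ ps)))
  (subsets-≥ ps)

interval-subsets-≥ : ∀ g f → All (λ s → g ≤ minimum s × g ≤ maximum s) (nonEmptySubsets (interval g f))
interval-subsets-≥ g f = subsets-≥ (Allₚ.applyUpTo⁺₂ (g ℕ.+_) (suc f ∸ g) (ℕₚ.m≤m+n g))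

module Tableaux (R : CommutativeRing 0ℓ 0ℓ) (β : CommutativeRing.Carrier R) (x : ℕ → CommutativeRing.Carrier R) where
  open CommutativeRing R hiding (zero)
  open Algebra.Properties.Semiring.Exp semiring using (_^_)
  open Algebra.Solver.Ring.NaturalCoefficients.Default commutativeSemiring using (solve; _:+_; _:*_; _:=_; con)
  open Relation.Binary.Reasoning.Setoid setoid

  ΣL : ∀ {A : Set} → List A → (A → Carrier) → Carrier
  ΣL []       φ = 0#
  ΣL (a ∷ as) φ = φ a + ΣL as φ

  ΣL-cong : ∀ {A : Set} {as : List A} {φ ψ : A → Carrier} → All (λ a → φ a ≈ ψ a) as → ΣL as φ ≈ ΣL as ψ
  ΣL-cong []       = refl
  ΣL-cong (e ∷ es) = +-cong e (ΣL-cong es)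

  ΣL-zero : ∀ {A : Set} {as : List A} {φ : A → Carrier} → All (λ a → φ a ≈ 0#) as → ΣL as φ ≈ 0#
  ΣL-zero []       = refl
  ΣL-zero (e ∷ es) = trans (+-cong e (ΣL-zero es)) (+-identityʳ 0#)

  ΣL-++ : ∀ {A : Set} (as bs : List A) φ → ΣL (as ++ bs) φ ≈ ΣL as φ + ΣL bs φ
  ΣL-++ []       bs φ = sym (+-identityˡ _)
  ΣL-++ (a ∷ as) bs φ = trans (+-congˡ (ΣL-++ as bs φ)) (sym (+-assoc _ _ _))

  ΣL-map : ∀ {A B : Set} (h : A → B) as φ → ΣL (map h as) φ ≈ ΣL as (φ ∘ h)
  ΣL-map h []       φ = refl
  ΣL-map h (a ∷ as) φ = +-congˡ (ΣL-map h as φ)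

  ΣL-* : ∀ {A : Set} c (as : List A) φ → c * ΣL as φ ≈ ΣL as (λ a → c * φ a)
  ΣL-* c []       φ = zeroʳ c
  ΣL-* c (a ∷ as) φ = trans (distribˡ c _ _) (+-congˡ (ΣL-* c as φ))

  ΣL-linear : ∀ {A : Set} s t (as : List A) φ ψ → ΣL as (λ a → s * φ a + t * ψ a) ≈ s * ΣL as φ + t * ΣL as ψ
  ΣL-linear s t []       φ ψ = sym (trans (+-cong (zeroʳ s) (zeroʳ t)) (+-identityʳ 0#))
  ΣL-linear s t (a ∷ as) φ ψ = trans (+-congˡ (ΣL-linear s t as φ ψ))
    (solve 6 (λ s t p q r z → s :* p :+ t :* q :+ (s :* r :+ t :* z) := s :* (p :+ r) :+ t :* (q :+ z))
      refl s t (φ a) (ψ a) (ΣL as φ) (ΣL as ψ))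

  𝟙 : ∀ {P : Set} → Dec P → Carrier
  𝟙 P? = if does P? then 1# else 0#

  𝟙-yes : ∀ {P : Set} (P? : Dec P) → P → 𝟙 P? ≈ 1#
  𝟙-yes (yes _) p = refl
  𝟙-yes (no ¬p) p = contradiction p ¬p

  𝟙-no : ∀ {P : Set} (P? : Dec P) → ¬ P → 𝟙 P? ≈ 0#
  𝟙-no (yes p) ¬p = contradiction p ¬p
  𝟙-no (no _)  ¬p = refl

  𝟙-cong : ∀ {P Q : Set} (P? : Dec P) (Q? : Dec Q) → (P → Q) → (Q → P) → 𝟙 P? ≈ 𝟙 Q?
  𝟙-cong (yes p) Q? f g = sym (𝟙-yes Q? (f p))
  𝟙-cong (no ¬p) Q? f g = sym (𝟙-no Q? (¬p ∘ g))

  𝟙-× : ∀ {P Q : Set} (P? : Dec P) (Q? : Dec Q) → 𝟙 (P? ×-dec Q?) ≈ 𝟙 P? * 𝟙 Q?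
  𝟙-× (yes p) (yes q) = sym (*-identityˡ 1#)
  𝟙-× (yes p) (no ¬q) = sym (*-identityˡ 0#)
  𝟙-× (no ¬p) Q?      = sym (zeroˡ _)

  monomial : List ℕ → Carrier
  monomial = foldr (λ k a → x k * a) 1#

  -- The tail counts the entries beyond the first, so over all boxes the exponents of β add up to
  -- |T| - |λ/μ|.
  boxWeight : List⁺ ℕ → Carrier
  boxWeight s = β ^ length (List⁺.tail s) * monomial (toList s)

  boxWeight-singleton : ∀ g → boxWeight (g List⁺.∷ []) ≈ x g
  boxWeight-singleton g = trans (*-identityˡ _) (*-identityʳ _)

  boxWeight-∷⁺ : ∀ g s → boxWeight (g ∷⁺ s) ≈ β * x g * boxWeight s
  boxWeight-∷⁺ g s = solve 4 (λ b p y m → b :* p :* (y :* m) := b :* y :* (p :* m))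
    refl β (β ^ length (List⁺.tail s)) (x g) (monomial (toList s))

  -- The bound l comes from the box to the left, l′ from the box above.
  Allowed : ℕ → ℕ → List⁺ ℕ → Set
  Allowed l l′ s = l ≤ minimum s × l′ ≤ minimum s

  allowed? : ∀ l l′ s → Dec (Allowed l l′ s)
  allowed? l l′ s = l ℕₚ.≤? minimum s ×-dec l′ ℕₚ.≤? minimum s

  -- Sum over the fillings of a row of n boxes, the first in column suc m, by
  -- subsets of [g, f].  Entries are at least l and those of column suc j at
  -- least b j; K receives the bound c on the next row: c j exceeds the
  -- entries of column suc j and is 0 if there is no box.
  rowSum : ∀ (n m l f g : ℕ) (b : ℕ → ℕ) (K : (ℕ → ℕ) → Carrier) → Carrier
  rowSum zero    m l f g b K = K (λ _ → 0)
  rowSum (suc n) m l f g b K = ΣL (nonEmptySubsets (interval g f)) λ s →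
    𝟙 (allowed? l (b m) s) *
    (boxWeight s * rowSum n (suc m) (maximum s) f g b (λ c → K (update c m (suc (maximum s)))))

  subsets-[] : ∀ {g f} → f < g → ∀ φ → ΣL (nonEmptySubsets (interval g f)) φ ≈ 0#
  subsets-[] f<g φ = reflexive (≡.cong (λ is → ΣL (nonEmptySubsets is) φ) (interval-[] f<g))

  split-subsets : ∀ {g f} → g ≤ f → ∀ φ → let N = nonEmptySubsets (interval (suc g) f) in
    ΣL (nonEmptySubsets (interval g f)) φ ≈ φ (g List⁺.∷ []) + (ΣL N (λ s → φ (g ∷⁺ s)) + ΣL N φ)
  split-subsets {g} {f} g≤f φ = begin
    ΣL (nonEmptySubsets (interval g f)) φ
      ≡⟨ ≡.cong (λ is → ΣL (nonEmptySubsets is) φ) (interval-∷ g≤f) ⟩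
    φ (g List⁺.∷ []) + ΣL (map (g ∷⁺_) N ++ N) φ
      ≈⟨ +-congˡ (trans (ΣL-++ (map (g ∷⁺_) N) N φ) (+-congʳ (ΣL-map (g ∷⁺_) N φ))) ⟩
    φ (g List⁺.∷ []) + (ΣL N (λ s → φ (g ∷⁺ s)) + ΣL N φ) ∎
    where N = nonEmptySubsets (interval (suc g) f)

  -- Only bounds that the row can leave matter: 0 to the left of column m, and more than g in column
  -- m if there is a box. The first frees a box of the next row that sticks out to the left, the
  -- second excludes the entry g below column m.
  rowSum-cong : ∀ n m l f g b {K K′} →
    (∀ c → (∀ j → j < m → c j ≡ 0) → (0 < n → g < c m) → K c ≈ K′ c) →
    rowSum n m l f g b K ≈ rowSum n m l f g b K′
  rowSum-cong zero    m l f g b e = e (λ _ → 0) (λ _ _ → ≡.refl) λ ()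
  rowSum-cong (suc n) m l f g b e = ΣL-cong (All.map (λ {s} (_ , g≤max) →
    *-congˡ {𝟙 (allowed? l (b m) s)} (*-congˡ {boxWeight s} (rowSum-cong n (suc m) (maximum s) f g b
      λ c z _ → e (update c m (suc (maximum s)))
        (λ j j<m → ≡.trans (update-other c m _ j (ℕₚ.<⇒≢ j<m)) (z j (ℕₚ.m<n⇒m<1+n j<m)))
        (λ _ → ≡.subst (g <_) (≡.sym (update-same c m _)) (s≤s g≤max)))))
    (interval-subsets-≥ g f))

  rowSum-linear : ∀ n m l f g b s t K K′ →
    rowSum n m l f g b (λ c → s * K c + t * K′ c) ≈ s * rowSum n m l f g b K + t * rowSum n m l f g b K′
  rowSum-linear zero    m l f g b s t K K′ = refl
  rowSum-linear (suc n) m l f g b s t K K′ = trans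
    (ΣL-cong (All.universal (λ S → trans
      (*-congˡ {𝟙 (allowed? l (b m) S)} (*-congˡ {boxWeight S} (rowSum-linear n (suc m) (maximum S) f g b s t _ _)))
      (solve 6 (λ i w s t p q → i :* (w :* (s :* p :+ t :* q)) := s :* (i :* (w :* p)) :+ t :* (i :* (w :* q)))
        refl (𝟙 (allowed? l (b m) S)) (boxWeight S) s t _ _)) (nonEmptySubsets (interval g f))))
    (ΣL-linear s t (nonEmptySubsets (interval g f)) _ _)

  -- Only the comparison of the bounds with values ≥ g matters.
  SameBound : ℕ → ℕ → ℕ → Set
  SameBound g b b′ = ∀ v → g ≤ v → (b ≤ v → b′ ≤ v) × (b′ ≤ v → b ≤ v)

  rowSum-bound : ∀ n m l f g b b′ K → (∀ j → m ≤ j → j < m ℕ.+ n → SameBound g (b j) (b′ j)) →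
    rowSum n m l f g b K ≈ rowSum n m l f g b′ K
  rowSum-bound zero    m l f g b b′ K e = refl
  rowSum-bound (suc n) m l f g b b′ K e = ΣL-cong (All.map (λ {s} (g≤min , _) →
    let to , from = e m ℕₚ.≤-refl (ℕₚ.m<m+n m (s≤s z≤n)) (minimum s) g≤min in
    *-cong (𝟙-cong (allowed? l (b m) s) (allowed? l (b′ m) s)
        (λ (p , q) → p , to q) (λ (p , q) → p , from q))
      (*-congˡ {boxWeight s} (rowSum-bound n (suc m) (maximum s) f g b b′ _
        λ j m<j j< → e j (ℕₚ.<⇒≤ m<j) (≡.subst (j <_) (≡.sym (ℕₚ.+-suc m n)) j<))))
    (interval-subsets-≥ g f))

  rowSum-lower : ∀ n m l l′ f g b K → l ≤ g → l′ ≤ g → rowSum n m l f g b K ≈ rowSum n m l′ f g b K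
  rowSum-lower zero    m l l′ f g b K l≤g l′≤g = refl
  rowSum-lower (suc n) m l l′ f g b K l≤g l′≤g = ΣL-cong (All.map (λ {s} (g≤min , _) →
    *-congʳ (𝟙-cong (allowed? l (b m) s) (allowed? l′ (b m) s)
      (λ (_ , q) → ℕₚ.≤-trans l′≤g g≤min , q) (λ (_ , q) → ℕₚ.≤-trans l≤g g≤min , q)))
    (interval-subsets-≥ g f))

  -- A bound exceeding g excludes the entry g.
  rowSum-raise : ∀ n m l f g b K → g < l ⊎ g < b m → rowSum n m l f g b K ≈ rowSum n m l f (suc g) b K
  rowSum-raise zero    m l f g b K g< = refl
  rowSum-raise (suc n) m l f g b K g< with g ℕₚ.≤? f
  ... | no g≰f = trans (subsets-[] (ℕₚ.≰⇒> g≰f) _) (sym (subsets-[] (ℕₚ.m<n⇒m<1+n (ℕₚ.≰⇒> g≰f)) _))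
  ... | yes g≤f = begin
    ΣL (nonEmptySubsets (interval g f)) φ
      ≈⟨ split-subsets g≤f φ ⟩
    φ (g List⁺.∷ []) + (ΣL N (λ s → φ (g ∷⁺ s)) + ΣL N φ)
      ≈⟨ +-cong (excluded (g List⁺.∷ []) ℕₚ.≤-refl)
           (+-cong (ΣL-zero (All.universal (λ s → excluded (g ∷⁺ s) (ℕₚ.m⊓n≤m g (minimum s))) N))
             (ΣL-cong (All.map (λ {s} (_ , g<max) → *-congˡ {𝟙 (allowed? l (b m) s)} (*-congˡ {boxWeight s}
               (rowSum-raise n (suc m) (maximum s) f g b _ (inj₁ g<max)))) (interval-subsets-≥ (suc g) f)))) ⟩
    0# + (0# + rowSum (suc n) m l f (suc g) b K)
      ≈⟨ trans (+-identityˡ _) (+-identityˡ _) ⟩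
    rowSum (suc n) m l f (suc g) b K ∎
    where
    N = nonEmptySubsets (interval (suc g) f)
    φ : List⁺ ℕ → Carrier
    φ s = 𝟙 (allowed? l (b m) s) *
      (boxWeight s * rowSum n (suc m) (maximum s) f g b (λ c → K (update c m (suc (maximum s)))))
    violated : ∀ {s} → minimum s ≤ g → g < l ⊎ g < b m → ¬ Allowed l (b m) s
    violated min≤g (inj₁ g<l) (p , _) = ℕₚ.<⇒≱ g<l (ℕₚ.≤-trans p min≤g)
    violated min≤g (inj₂ g<b) (_ , q) = ℕₚ.<⇒≱ g<b (ℕₚ.≤-trans q min≤g)
    excluded : ∀ s → minimum s ≤ g → φ s ≈ 0#
    excluded s min≤g = trans (*-congʳ (𝟙-no (allowed? l (b m) s) (violated {s} min≤g g<))) (zeroˡ _)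

  -- The first box is {g}, {g} ∪ s or s with s ⊆ [suc g, f].
  rowSum-peel : ∀ n m f g b K → g ≤ f → b m ≡ 0 →
    (∀ c → c m ≡ 0 → K (update c m (suc g)) ≈ K c) →
    rowSum (suc n) m 0 f g b K ≈
      (1# + β * x g) * rowSum (suc n) m 0 f (suc g) b K + x g * rowSum n (suc m) 0 f g b K
  rowSum-peel n m f g b K g≤f bm≡0 eK = begin
    ΣL (nonEmptySubsets (interval g f)) φ
      ≈⟨ split-subsets g≤f φ ⟩
    φ (g List⁺.∷ []) + (ΣL N (λ s → φ (g ∷⁺ s)) + ΣL N φ)
      ≈⟨ +-cong singleton (+-cong (trans (ΣL-cong with-g) (sym (ΣL-* (β * x g) N ψ))) (ΣL-cong without-g)) ⟩
    x g * Z₀ + (β * x g * Z₁ + Z₁)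
      ≈⟨ solve 4 (λ b y p q → y :* p :+ (b :* y :* q :+ q) := (con 1 :+ b :* y) :* q :+ y :* p) refl β (x g) Z₀ Z₁ ⟩
    (1# + β * x g) * Z₁ + x g * Z₀ ∎
    where
    N  = nonEmptySubsets (interval (suc g) f)
    Z₀ = rowSum n (suc m) 0 f g b K
    Z₁ = rowSum (suc n) m 0 f (suc g) b K
    K′ : ℕ → (ℕ → ℕ) → Carrier
    K′ v c = K (update c m (suc v))
    φ ψ : List⁺ ℕ → Carrier
    φ s = 𝟙 (allowed? 0 (b m) s) * (boxWeight s * rowSum n (suc m) (maximum s) f g b (K′ (maximum s)))
    ψ s = 𝟙 (allowed? 0 (b m) s) * (boxWeight s * rowSum n (suc m) (maximum s) f (suc g) b (K′ (maximum s)))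

    allowed : ∀ s → 𝟙 (allowed? 0 (b m) s) ≈ 1#
    allowed s = 𝟙-yes (allowed? 0 (b m) s) (z≤n , ≡.subst (_≤ minimum s) (≡.sym bm≡0) z≤n)

    -- After {g} the rest of the row has the vacuous lower bound g, and `eK` makes the bound `suc g`
    -- left in column m invisible, so the row may as well start one column later.
    singleton : φ (g List⁺.∷ []) ≈ x g * Z₀
    singleton = trans (*-cong (allowed (g List⁺.∷ [])) (*-cong (boxWeight-singleton g) (trans
        (rowSum-cong n (suc m) g f g b λ c z _ → eK c (z m ℕₚ.≤-refl))
        (rowSum-lower n (suc m) g 0 f g b K ℕₚ.≤-refl z≤n))))
      (*-identityˡ _)

    -- Rows increase weakly, so once a maximum exceeds g, later boxes avoid g.
    raise : ∀ s v → suc g ≤ v → rowSum n (suc m) v f g b s ≈ rowSum n (suc m) v f (suc g) b s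
    raise s v g<v = rowSum-raise n (suc m) v f g b s (inj₁ g<v)

    with-g : All (λ s → φ (g ∷⁺ s) ≈ β * x g * ψ s) N
    with-g = All.map (λ {s} (_ , g<max) → begin
      φ (g ∷⁺ s)
        ≈⟨ *-cong (trans (allowed (g ∷⁺ s)) (sym (allowed s))) (*-cong (boxWeight-∷⁺ g s) (trans
             (reflexive (≡.cong (λ v → rowSum n (suc m) v f g b (K′ v)) (ℕₚ.m≤n⇒m⊔n≡n (ℕₚ.<⇒≤ g<max))))
             (raise (K′ (maximum s)) (maximum s) g<max))) ⟩
      𝟙 (allowed? 0 (b m) s) * (β * x g * boxWeight s * rowSum n (suc m) (maximum s) f (suc g) b (K′ (maximum s)))
        ≈⟨ solve 5 (λ i b y w r → i :* (b :* y :* w :* r) := b :* y :* (i :* (w :* r)))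
             refl (𝟙 (allowed? 0 (b m) s)) β (x g) (boxWeight s) _ ⟩
      β * x g * ψ s ∎) (interval-subsets-≥ (suc g) f)

    without-g : All (λ s → φ s ≈ ψ s) N
    without-g = All.map (λ {s} (_ , g<max) → *-congˡ {𝟙 (allowed? 0 (b m) s)} (*-congˡ {boxWeight s}
      (raise (K′ (maximum s)) (maximum s) g<max))) (interval-subsets-≥ (suc g) f)

  -- The rows below form the continuation of the first row, a function of the bound that it leaves.
  tableauSum : ℕ → (lam μ f g b : ℕ → ℕ) → Carrier
  tableauSum zero    lam μ f g b = 1#
  tableauSum (suc r) lam μ f g b =
    rowSum (lam 0 ∸ μ 0) (μ 0) 0 (f 0) (g 0) b (tableauSum r (lam ∘ suc) (μ ∘ suc) (f ∘ suc) (g ∘ suc))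

  tableauSum-bound : ∀ r lam μ f g b b′ →
    (∀ j → μ 0 ≤ j → j < μ 0 ℕ.+ (lam 0 ∸ μ 0) → SameBound (g 0) (b j) (b′ j)) →
    tableauSum r lam μ f g b ≈ tableauSum r lam μ f g b′
  tableauSum-bound zero    lam μ f g b b′ e = refl
  tableauSum-bound (suc r) lam μ f g b b′ e = rowSum-bound (lam 0 ∸ μ 0) (μ 0) 0 (f 0) (g 0) b b′ _ e

  -- No box lies above the leftmost box of row i, where `b` plays the part of a row above row 0.
  FreeLeft : ℕ → (μ b : ℕ → ℕ) → Set
  FreeLeft zero    μ b = b (μ 0) ≡ 0
  FreeLeft (suc i) μ b = μ (suc i) < μ i

  -- In row i this is `rowSum-peel`: the first box is free from above, and `end` hides an entry gᵢ
  -- in it from the row below. The rows above preserve the identity by linearity of `rowSum` in its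
  -- continuation.
  tableauSum-peel : ∀ r i lam μ f g b → i < r → g i ≤ f i → μ i < lam i → FreeLeft i μ b →
    μ (suc i) ≤ lam (suc i) → lam (suc i) ≤ μ i ⊎ g i < g (suc i) →
    tableauSum r lam μ f g b ≈
      (1# + β * x (g i)) * tableauSum r lam μ f (update g i (suc (g i))) b
      + x (g i) * tableauSum r lam (update μ i (suc (μ i))) f g b
  tableauSum-peel (suc r) zero lam μ f g b _ g≤f μ<lam free μ≤lam end = begin
    rowSum (lam 0 ∸ μ 0) (μ 0) 0 (f 0) (g 0) b K
      ≡⟨ ≡.cong (λ n → rowSum n (μ 0) 0 (f 0) (g 0) b K) n≡ ⟩
    rowSum (suc n) (μ 0) 0 (f 0) (g 0) b K
      ≈⟨ rowSum-peel n (μ 0) (f 0) (g 0) b K g≤f free eK ⟩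
    (1# + β * x (g 0)) * rowSum (suc n) (μ 0) 0 (f 0) (suc (g 0)) b K + x (g 0) * rowSum n (suc (μ 0)) 0 (f 0) (g 0) b K
      ≡⟨ ≡.cong (λ n′ → (1# + β * x (g 0)) * rowSum n′ (μ 0) 0 (f 0) (suc (g 0)) b K
           + x (g 0) * rowSum n (suc (μ 0)) 0 (f 0) (g 0) b K) n≡ ⟨
    (1# + β * x (g 0)) * rowSum (lam 0 ∸ μ 0) (μ 0) 0 (f 0) (suc (g 0)) b K
      + x (g 0) * rowSum n (suc (μ 0)) 0 (f 0) (g 0) b K ∎
    where
    n = lam 0 ∸ suc (μ 0)
    n≡ : lam 0 ∸ μ 0 ≡ suc n
    n≡ = ℕₚ.+-∸-assoc 1 μ<lam
    K = tableauSum r (lam ∘ suc) (μ ∘ suc) (f ∘ suc) (g ∘ suc)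
    eK : ∀ c → c (μ 0) ≡ 0 → K (update c (μ 0) (suc (g 0))) ≈ K c
    eK c c≡0 = tableauSum-bound r (lam ∘ suc) (μ ∘ suc) (f ∘ suc) (g ∘ suc) _ c same
      where
      -- The bounds differ only in column μ 0, where they are `suc (g 0)` and 0. Either row 1 ends
      -- before that column, or all its entries exceed g 0.
      same : ∀ j → μ 1 ≤ j → j < μ 1 ℕ.+ (lam 1 ∸ μ 1) → SameBound (g 1) (update c (μ 0) (suc (g 0)) j) (c j)
      same j _ j< v g≤v with j ℕₚ.≟ μ 0
      ... | no j≢ rewrite update-other c (μ 0) (suc (g 0)) j j≢ = (λ p → p) , (λ p → p)
      ... | yes ≡.refl rewrite update-same c (μ 0) (suc (g 0)) | c≡0 = (λ _ → z≤n) , λ _ → below end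
        where
        below : lam 1 ≤ μ 0 ⊎ g 0 < g 1 → g 0 < v
        below (inj₁ lam≤μ) = contradiction (≡.subst (μ 0 <_) (ℕₚ.m+[n∸m]≡n μ≤lam) j<) (ℕₚ.≤⇒≯ lam≤μ)
        below (inj₂ g<g)   = ℕₚ.<-≤-trans g<g g≤v
  tableauSum-peel (suc r) (suc i) lam μ f g b (s≤s i<r) g≤f μ<lam free μ≤lam end = trans
    (rowSum-cong (lam 0 ∸ μ 0) (μ 0) 0 (f 0) (g 0) b λ c z _ →
      tableauSum-peel r i (lam ∘ suc) (μ ∘ suc) (f ∘ suc) (g ∘ suc) c i<r g≤f μ<lam (shift i free c z) μ≤lam end)
    (rowSum-linear (lam 0 ∸ μ 0) (μ 0) 0 (f 0) (g 0) b (1# + β * x (g (suc i))) (x (g (suc i))) _ _)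
    where
    -- A box of row 1 to the left of row 0 has nothing above it, so its bound is 0.
    shift : ∀ i → μ (suc i) < μ i → ∀ c → (∀ j → j < μ 0 → c j ≡ 0) → FreeLeft i (μ ∘ suc) c
    shift zero    l c z = z (μ 1) l
    shift (suc i) l c z = l

  -- Row k has a box above the leftmost box of row k + 1, with entries at least g k = g (k + 1), so
  -- the bound passed down exceeds this value.
  tableauSum-raise : ∀ r k lam μ f g b → suc k < r → μ k < lam k → μ (suc k) ≡ μ k → g (suc k) ≡ g k →
    tableauSum r lam μ f g b ≈ tableauSum r lam μ f (update g (suc k) (suc (g (suc k)))) b
  tableauSum-raise (suc (suc r)) zero lam μ f g b _ μ<lam μ≡ g≡ =
    rowSum-cong (lam 0 ∸ μ 0) (μ 0) 0 (f 0) (g 0) b λ c _ g<c →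
      rowSum-raise (lam 1 ∸ μ 1) (μ 1) 0 (f 1) (g 1) c _
        (inj₂ (≡.subst₂ (λ a m → a < c m) (≡.sym g≡) (≡.sym μ≡) (g<c (ℕₚ.m<n⇒0<n∸m μ<lam))))
  tableauSum-raise (suc r) (suc k) lam μ f g b (s≤s k<r) μ<lam μ≡ g≡ =
    rowSum-cong (lam 0 ∸ μ 0) (μ 0) 0 (f 0) (g 0) b λ c _ _ →
      tableauSum-raise r k (lam ∘ suc) (μ ∘ suc) (f ∘ suc) (g ∘ suc) c k<r μ<lam μ≡ g≡

  tableauSum-empty-row : ∀ r lam μ f g b → lam 0 ≡ μ 0 →
    tableauSum (suc r) lam μ f g b ≈ tableauSum r (lam ∘ suc) (μ ∘ suc) (f ∘ suc) (g ∘ suc) (λ _ → 0)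
  tableauSum-empty-row r lam μ f g b e =
    reflexive (≡.cong (λ n → rowSum n (μ 0) 0 (f 0) (g 0) b (tableauSum r (lam ∘ suc) (μ ∘ suc) (f ∘ suc) (g ∘ suc)))
      (≡.trans (≡.cong (_∸ μ 0) e) (ℕₚ.n∸n≡0 (μ 0))))

  tableauSum-zero : ∀ r lam μ f g b → f 0 < g 0 → μ 0 < lam 0 → tableauSum (suc r) lam μ f g b ≈ 0#
  tableauSum-zero r lam μ f g b f<g μ<lam = trans
    (reflexive (≡.cong (λ n → rowSum n (μ 0) 0 (f 0) (g 0) b K) (ℕₚ.+-∸-assoc 1 μ<lam)))
    (subsets-[] f<g λ s → 𝟙 (allowed? 0 (b (μ 0)) s) * (boxWeight s *
      rowSum (lam 0 ∸ suc (μ 0)) (suc (μ 0)) (maximum s) (f 0) (g 0) b (λ c → K (update c (μ 0) (suc (maximum s))))))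
    where K = tableauSum r (lam ∘ suc) (μ ∘ suc) (f ∘ suc) (g ∘ suc)

-- The recursion

least : ∀ {P : ℕ → Set} → (∀ n → Dec (P n)) → ∀ N → P N → ∃[ e ] (P e × (∀ c → c < e → ¬ P c))
least P? N p with P? 0
... | yes p₀ = 0 , p₀ , λ _ ()
least P? zero    p | no ¬p₀ = contradiction p ¬p₀
least P? (suc N) p | no ¬p₀ with least (P? ∘ suc) N p
... | e , q , ¬q = suc e , q , λ { zero _ → ¬p₀ ; (suc c) (s≤s l) → ¬q c l }

antitone : ∀ {h : ℕ → ℕ} → (∀ i → h (suc i) ≤ h i) → ∀ {a b} → a ≤ b → h b ≤ h a
antitone {h} d {a} {b} a≤b with ℕₚ.m≤n⇒∃[o]m+o≡n a≤b
... | o , ≡.refl = go o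
  where
  go : ∀ o → h (a ℕ.+ o) ≤ h a
  go zero    = ℕₚ.≤-reflexive (≡.cong h (ℕₚ.+-identityʳ a))
  go (suc o) = ℕₚ.≤-trans (ℕₚ.≤-reflexive (≡.cong h (ℕₚ.+-suc a o))) (ℕₚ.≤-trans (d (a ℕ.+ o)) (go o))

adjacent-at : ∀ {n} k → suc k < n → ∃[ c ] ∃[ c′ ] (Adjacent {n} c c′ × toℕ c ≡ k × toℕ c′ ≡ suc k)
adjacent-at zero    (s≤s (s≤s _)) = fzero , fsuc fzero , here , ≡.refl , ≡.refl
adjacent-at (suc k) (s≤s l) with adjacent-at k l
... | c , c′ , adj , e , e′ = fsuc c , fsuc c′ , there adj , ≡.cong suc e , ≡.cong suc e′

module Indices where
  open Data.Integer.Solver.+-*-Solver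

  ⊖-suc : ∀ l m → l ⊖ suc m ≡ ℤ.pred (l ⊖ m)
  ⊖-suc l m = ≡.trans (≡.sym (ℤₚ.m-n≡m⊖n l (suc m))) (≡.trans
    (solve 2 (λ l m → l :- (con 1ℤ :+ m) := con -1ℤ :+ (l :- m)) ≡.refl (+ l) (+ m))
    (≡.cong ℤ.pred (ℤₚ.m-n≡m⊖n l m)))

  suc-⊖ : ∀ l m → l ⊖ m ≡ ℤ.suc (l ⊖ suc m)
  suc-⊖ l m = ≡.sym (≡.trans (≡.cong ℤ.suc (⊖-suc l m)) (ℤₚ.suc-pred (l ⊖ m)))

  pred-+ˡ : ∀ l m z → (l ⊖ suc m) ℤ.+ z ≡ ℤ.pred ((l ⊖ m) ℤ.+ z)
  pred-+ˡ l m z = ≡.trans (≡.cong (ℤ._+ z) (⊖-suc l m)) (ℤₚ.+-assoc -1ℤ (l ⊖ m) z)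

  pred-+ʳ : ∀ z k a → z ℤ.+ (k ⊖ a) ≡ ℤ.pred (z ℤ.+ (suc k ⊖ a))
  pred-+ʳ z k a = ≡.trans (≡.cong (λ w → z ℤ.+ w) k⊖a)
    (solve 2 (λ z w → z :+ (con -1ℤ :+ w) := con -1ℤ :+ (z :+ w)) ≡.refl z (suc k ⊖ a))
    where
    k⊖a : k ⊖ a ≡ ℤ.pred (suc k ⊖ a)
    k⊖a = ≡.trans (≡.sym (ℤₚ.[1+m]⊖[1+n]≡m⊖n k a)) (⊖-suc (suc k) a)

  ⊖-below : ∀ {c a} → c < a → ∃[ k ] (a ⊖ c ≡ + suc k × c ⊖ a ≡ -[1+ k ])
  ⊖-below {c} {a} c<a with ℕₚ.m≤n⇒∃[o]m+o≡n c<a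
  ... | k , ≡.refl = k , e , ≡.trans (ℤₚ.⊖-swap c (suc c ℕ.+ k)) (≡.cong ℤ.-_ e)
    where
    e : suc c ℕ.+ k ⊖ c ≡ + suc k
    e = ≡.trans (≡.cong₂ _⊖_ (≡.sym (ℕₚ.+-suc c k)) (≡.sym (ℕₚ.+-identityʳ c))) (ℤₚ.+-cancelˡ-⊖ c (suc k) 0)

  ⊖-≤0 : ∀ {l m} → l ≤ m → l ⊖ m ℤ.≤ 0ℤ
  ⊖-≤0 {l} {m} l≤m = ≡.subst (l ⊖ m ℤ.≤_) (ℤₚ.n⊖n≡0 m) (ℤₚ.⊖-monoˡ-≤ m l≤m)

  ⊖-positive : ∀ {m l} j → m < l → ∃[ k ] (l ⊖ m) ℤ.+ (j ⊖ 0) ≡ + suc k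
  ⊖-positive {m} {l} j m<l = l ∸ suc m ℕ.+ j , ≡.cong (ℤ._+ + j)
    (≡.trans (ℤₚ.⊖-≥ (ℕₚ.<⇒≤ m<l)) (≡.cong +_ (ℕₚ.+-∸-assoc 1 m<l)))

open Indices

-- The number of boxes plus the lengths of the intervals [gᵢ, fᵢ]: raising μᵢ in a non-empty row
-- removes a box, and raising gᵢ ≤ fᵢ shortens an interval.
measure : ℕ → (lam μ f g : ℕ → ℕ) → ℕ
measure zero    lam μ f g = 0
measure (suc r) lam μ f g =
  (lam 0 ∸ μ 0) ℕ.+ (suc (f 0) ∸ g 0) ℕ.+ measure r (lam ∘ suc) (μ ∘ suc) (f ∘ suc) (g ∘ suc)

measure-μ : ∀ r i lam μ f g → i < r → μ i < lam i → measure r lam (update μ i (suc (μ i))) f g < measure r lam μ f g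
measure-μ (suc r) zero    lam μ f g _ l = ℕₚ.+-monoˡ-< _ (ℕₚ.+-monoˡ-< (suc (f 0) ∸ g 0) (ℕₚ.∸-monoʳ-< (ℕₚ.n<1+n (μ 0)) l))
measure-μ (suc r) (suc i) lam μ f g (s≤s i<r) l = ℕₚ.+-monoʳ-< _ (measure-μ r i (lam ∘ suc) (μ ∘ suc) (f ∘ suc) (g ∘ suc) i<r l)

measure-g : ∀ r i lam μ f g → i < r → g i ≤ f i → measure r lam μ f (update g i (suc (g i))) < measure r lam μ f g
measure-g (suc r) zero    lam μ f g _ l = ℕₚ.+-monoˡ-< _ (ℕₚ.+-monoʳ-< (lam 0 ∸ μ 0) (ℕₚ.∸-monoʳ-< (ℕₚ.n<1+n (g 0)) (s≤s l)))
measure-g (suc r) (suc i) lam μ f g (s≤s i<r) l = ℕₚ.+-monoʳ-< _ (measure-g r i (lam ∘ suc) (μ ∘ suc) (f ∘ suc) (g ∘ suc) i<r l)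

update-≥ : ∀ h i {v} → h i ≤ v → ∀ c → h c ≤ update h i v c
update-≥ h i {v} l c with c ℕₚ.≟ i
... | yes ≡.refl = ≡.subst (h c ≤_) (≡.sym (update-same h c v)) l
... | no  c≢i    = ℕₚ.≤-reflexive (≡.sym (update-other h i v c c≢i))

-- Rows are indexed by all natural numbers, so that dropping the first row is composition with
-- `suc`. The rows from r on are empty by `support`, so every search for a break succeeds by row r.
record Flagged (r : ℕ) (lam μ f g : ℕ → ℕ) : Set where
  field
    lam-dec : ∀ i → lam (suc i) ≤ lam i
    μ-dec   : ∀ i → μ (suc i) ≤ μ i
    μ≤lam   : ∀ i → μ i ≤ lam i
    flag    : ∀ i → μ i < lam (suc i) → g i ≤ g (suc i) × f i ≤ f (suc i)
    support : ∀ i → r ≤ i → lam i ≡ 0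

  nonEmpty⇒<r : ∀ {i} → μ i < lam i → i < r
  nonEmpty⇒<r {i} l with i ℕₚ.<? r
  ... | yes i<r = i<r
  ... | no  i≮r = contradiction (≡.subst (μ i <_) (support i (ℕₚ.≮⇒≥ i≮r)) l) λ ()

  g-chain : ∀ j → (∀ c → c < j → ¬ lam (suc c) ≤ μ c) → g 0 ≤ g j
  g-chain zero    _ = ℕₚ.≤-refl
  g-chain (suc j) h = ℕₚ.≤-trans (g-chain j λ c l → h c (ℕₚ.m<n⇒m<1+n l)) (proj₁ (flag j (ℕₚ.≰⇒> (h j ℕₚ.≤-refl))))

  -- f grows weakly while consecutive rows overlap; the alternative is a break between rows e and e
  -- + 1.
  f-chain : ∀ a → f 0 ≤ f a ⊎ ∃[ e ] (e < a × lam (suc e) ≤ μ e)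
  f-chain zero = inj₁ ℕₚ.≤-refl
  f-chain (suc a) with f-chain a | lam (suc a) ℕₚ.≤? μ a
  ... | inj₂ (e , e<a , d) | _     = inj₂ (e , ℕₚ.m<n⇒m<1+n e<a , d)
  ... | inj₁ _             | yes d = inj₂ (a , ℕₚ.≤-refl , d)
  ... | inj₁ f≤            | no ¬d = inj₁ (ℕₚ.≤-trans f≤ (proj₂ (flag a (ℕₚ.≰⇒> ¬d))))

flagged-tail : ∀ {r lam μ f g} → Flagged (suc r) lam μ f g → Flagged r (lam ∘ suc) (μ ∘ suc) (f ∘ suc) (g ∘ suc)
flagged-tail h = record
  { lam-dec = lam-dec ∘ suc ; μ-dec = μ-dec ∘ suc ; μ≤lam = μ≤lam ∘ suc ; flag = flag ∘ suc
  ; support = λ i l → support (suc i) (s≤s l) }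
  where open Flagged h

-- A larger μᵢ only removes overlaps, so the remaining flag conditions held before; `free` keeps μ
-- decreasing.
flagged-μ : ∀ {r lam μ f g} i → Flagged r lam μ f g → μ i < lam i → (∀ k → i ≡ suc k → μ i < μ k) →
  Flagged r lam (update μ i (suc (μ i))) f g
flagged-μ {r} {lam} {μ} {f} {g} i h μ<lam free = record
  { lam-dec = lam-dec
  ; μ-dec   = dec
  ; μ≤lam   = bound
  ; flag    = λ c l → flag c (ℕₚ.≤-<-trans (update-≥ μ i (ℕₚ.n≤1+n (μ i)) c) l)
  ; support = support
  }
  where
  open Flagged h
  μ′ = update μ i (suc (μ i))
  dec : ∀ c → μ′ (suc c) ≤ μ′ c
  dec c with suc c ℕₚ.≟ i
  ... | yes ≡.refl = ≡.subst (_≤ μ′ c) (≡.sym (update-same μ (suc c) _))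
          (ℕₚ.≤-trans (free c ≡.refl) (update-≥ μ (suc c) (ℕₚ.n≤1+n _) c))
  ... | no  c≢i    = ≡.subst (_≤ μ′ c) (≡.sym (update-other μ i _ (suc c) c≢i))
          (ℕₚ.≤-trans (μ-dec c) (update-≥ μ i (ℕₚ.n≤1+n _) c))
  bound : ∀ c → μ′ c ≤ lam c
  bound c with c ℕₚ.≟ i
  ... | yes ≡.refl = ≡.subst (_≤ lam c) (≡.sym (update-same μ c _)) μ<lam
  ... | no  c≢i    = ≡.subst (_≤ lam c) (≡.sym (update-other μ i _ c c≢i)) (μ≤lam c)

-- A larger gᵢ can only spoil the condition between rows i and i + 1, which `end` prevents.
flagged-g : ∀ {r lam μ f g} i → Flagged r lam μ f g → lam (suc i) ≤ μ i ⊎ g i < g (suc i) →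
  Flagged r lam μ f (update g i (suc (g i)))
flagged-g {r} {lam} {μ} {f} {g} i h end = record
  { lam-dec = lam-dec ; μ-dec = μ-dec ; μ≤lam = μ≤lam ; support = support
  ; flag    = λ c l → g-inc c l , proj₂ (flag c l)
  }
  where
  open Flagged h
  g′ = update g i (suc (g i))
  g-inc : ∀ c → μ c < lam (suc c) → g′ c ≤ g′ (suc c)
  g-inc c l with c ℕₚ.≟ i
  ... | no c≢i     = ≡.subst (_≤ g′ (suc c)) (≡.sym (update-other g i _ c c≢i))
          (ℕₚ.≤-trans (proj₁ (flag c l)) (update-≥ g i (ℕₚ.n≤1+n _) (suc c)))
  ... | yes ≡.refl = ≡.subst₂ _≤_ (≡.sym (update-same g c _)) (≡.sym (update-other g c _ (suc c) ℕₚ.1+n≢n)) (below end)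
    where
    below : lam (suc c) ≤ μ c ⊎ g c < g (suc c) → g c < g (suc c)
    below (inj₁ d)   = contradiction d (ℕₚ.<⇒≱ l)
    below (inj₂ g<g) = g<g

module DeterminantFormula
  (R : CommutativeRing 0ℓ 0ℓ) (β : CommutativeRing.Carrier R) (x : ℕ → CommutativeRing.Carrier R)
  (E : ℕ → ℕ → ℤ → ℤ → CommutativeRing.Carrier R) (laws : EntryLaws R β x E)
  where

  open CommutativeRing R hiding (zero)
  open RingIdentities R using (regroup)
  open EntryLaws laws
  open Determinant R
  open Tableaux R β x
  open Relation.Binary.Reasoning.Setoid setoid

  entry : (lam μ f g : ℕ → ℕ) → ℕ → ℕ → Carrier
  entry lam μ f g a b = E (f a) (g b) (a ⊖ b) ((lam a ⊖ μ b) ℤ.+ (b ⊖ a))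

  entryMatrix : ∀ r (lam μ f g : ℕ → ℕ) → Matrix r
  entryMatrix r lam μ f g a b = entry lam μ f g (toℕ a) (toℕ b)

  -- Here n = a - c is positive and, as l ≤ m, the exponent is at most - n, which is the range of
  -- `E-vanish`.
  E-below : ∀ p q {l m a c} → c < a → l ≤ m → E p q (a ⊖ c) ((l ⊖ m) ℤ.+ (c ⊖ a)) ≈ 0#
  E-below p q {l} {m} c<a l≤m with ⊖-below c<a
  ... | k , a⊖c , c⊖a rewrite a⊖c | c⊖a =
    E-vanish p q k _ (≡.subst ((l ⊖ m) ℤ.+ -[1+ k ] ℤ.≤_) (ℤₚ.+-identityˡ -[1+ k ]) (ℤₚ.+-monoˡ-≤ -[1+ k ] (⊖-≤0 l≤m)))

  E-peel-⊖ : ∀ {p q} → q ≤ p → ∀ n l m z →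
    E p q n ((l ⊖ m) ℤ.+ z) ≈ (1# + β * x q) * E p (suc q) n ((l ⊖ m) ℤ.+ z) + x q * E p q n ((l ⊖ suc m) ℤ.+ z)
  E-peel-⊖ {p} {q} q≤p n l m z = trans (E-peel q≤p n ((l ⊖ m) ℤ.+ z))
    (+-congˡ (*-congˡ (reflexive (≡.cong (E p q n) (≡.sym (pred-+ˡ l m z))))))

  -- Adding β x E to the peeled identity turns its last term into x (E n (m - 1) + β E n m). By
  -- Pascal's rule this is x times the value at n + 1 and m - 1, the entry one column to the left
  -- for equal μ and g.
  E-column : ∀ {p q} → q ≤ p → ∀ w a k →
    (1# + β * x q) * E p q (a ⊖ suc k) (w ℤ.+ (suc k ⊖ a)) ≈
      (1# + β * x q) * E p (suc q) (a ⊖ suc k) (w ℤ.+ (suc k ⊖ a)) + x q * E p q (a ⊖ k) (w ℤ.+ (k ⊖ a))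
  E-column {p} {q} q≤p w a k = begin
    u * E p q n m                                             ≈⟨ trans (distribʳ _ _ _) (+-congʳ (*-identityˡ _)) ⟩
    E p q n m + β * x q * E p q n m                           ≈⟨ +-congʳ (E-peel q≤p n m) ⟩
    u * E p (suc q) n m + x q * E p q n (ℤ.pred m) + β * x q * E p q n m
      ≈⟨ regroup β (x q) u (E p (suc q) n m) (E p q n (ℤ.pred m)) (E p q n m) ⟩
    u * E p (suc q) n m + x q * (E p q n (ℤ.pred m) + β * E p q n m)
      ≡⟨ ≡.cong (λ m′ → u * E p (suc q) n m + x q * (E p q n (ℤ.pred m) + β * E p q n m′)) (ℤₚ.suc-pred m) ⟨
    u * E p (suc q) n m + x q * (E p q n (ℤ.pred m) + β * E p q n (ℤ.suc (ℤ.pred m)))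
      ≈⟨ +-congˡ (*-congˡ (E-pascal p q n (ℤ.pred m))) ⟨
    u * E p (suc q) n m + x q * E p q (ℤ.suc n) (ℤ.pred m)
      ≡⟨ ≡.cong₂ (λ n′ m′ → u * E p (suc q) n m + x q * E p q n′ m′) (suc-⊖ a k) (pred-+ʳ w k a) ⟨
    u * E p (suc q) n m + x q * E p q (a ⊖ k) (w ℤ.+ (k ⊖ a)) ∎
    where
    u = 1# + β * x q
    n = a ⊖ suc k
    m = w ℤ.+ (suc k ⊖ a)

  -- The last row of the maximal chain of overlapping rows, starting from row
  -- 0, with the same lower flag as row 0.
  record ChainEnd (lam μ g : ℕ → ℕ) (i : ℕ) : Set where
    field
      end     : lam (suc i) ≤ μ i ⊎ g i < g (suc i)
      linked : ∀ c → c < i → μ c < lam (suc c)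
      level   : ∀ c → c ≤ i → g c ≡ g 0

  chainEnd : ∀ {r lam μ f g} → Flagged r lam μ f g → ∃[ i ] ChainEnd lam μ g i
  chainEnd {r} {lam} {μ} {f} {g} h with least stop? r (inj₁ (≡.subst (_≤ μ r) (≡.sym (support (suc r) (ℕₚ.n≤1+n r))) z≤n))
    where
    open Flagged h
    -- Testing for inequality is enough: on overlapping rows the flagging turns it into g c < g (c +
    -- 1).
    stop? : ∀ c → Dec (lam (suc c) ≤ μ c ⊎ g c ≢ g (suc c))
    stop? c = lam (suc c) ℕₚ.≤? μ c ⊎-dec ¬? (g c ℕₚ.≟ g (suc c))
  ... | i , stop , go = i , record { end = end stop ; linked = linked ; level = level }
    where
    open Flagged h
    linked : ∀ c → c < i → μ c < lam (suc c)
    linked c c<i = ℕₚ.≰⇒> (go c c<i ∘ inj₁)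
    level : ∀ c → c ≤ i → g c ≡ g 0
    level zero    _ = ≡.refl
    level (suc c) l with g c ℕₚ.≟ g (suc c)
    ... | yes e = ≡.trans (≡.sym e) (level c (ℕₚ.<⇒≤ l))
    ... | no ¬e = contradiction (inj₂ ¬e) (go c l)
    end : lam (suc i) ≤ μ i ⊎ g i ≢ g (suc i) → lam (suc i) ≤ μ i ⊎ g i < g (suc i)
    end (inj₁ d) = inj₁ d
    end (inj₂ n) with lam (suc i) ℕₚ.≤? μ i
    ... | yes d = inj₁ d
    ... | no ¬d = inj₂ (ℕₚ.≤∧≢⇒< (proj₁ (flag i (ℕₚ.≰⇒> ¬d))) n)

  module _ {r : ℕ} {lam μ f g : ℕ → ℕ} (h : Flagged r lam μ f g) {i : ℕ} (chain : ChainEnd lam μ g i) (g≤f : g 0 ≤ f 0) where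
    open Flagged h
    open ChainEnd chain

    -- In the first case column i can be peeled in row a. In the second a break lies between rows i
    -- and a, and `E-below` makes the entry vanish.
    reach : ∀ a → g i ≤ f a ⊎ (i < a × lam a ≤ μ i)
    reach a with f-chain a
    ... | inj₁ f≤ = inj₁ (ℕₚ.≤-trans (ℕₚ.≤-reflexive (level i ℕₚ.≤-refl)) (ℕₚ.≤-trans g≤f f≤))
    ... | inj₂ (e , e<a , d) = inj₂ (ℕₚ.≤-<-trans i≤e e<a ,
            ℕₚ.≤-trans (antitone {lam} lam-dec e<a) (ℕₚ.≤-trans d (antitone {μ} μ-dec i≤e)))
      where
      i≤e : i ≤ e
      i≤e = ℕₚ.≮⇒≥ λ e<i → contradiction d (ℕₚ.<⇒≱ (linked e e<i))

    g≤f-end : g i ≤ f i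
    g≤f-end with reach i
    ... | inj₁ l = l
    ... | inj₂ (i<i , _) = contradiction i<i (ℕₚ.<-irrefl ≡.refl)

    nonEmpty-end : μ 0 < lam 0 → μ i < lam i
    nonEmpty-end l = go i linked
      where
      go : ∀ i → (∀ c → c < i → μ c < lam (suc c)) → μ i < lam i
      go zero    _ = l
      go (suc k) o = ℕₚ.≤-<-trans (μ-dec k) (o k ℕₚ.≤-refl)

  -- Only column i depends on gᵢ and μᵢ. Its entries peel in the rows before the break and vanish in
  -- all three matrices after it.
  det-peel : ∀ {r lam μ f g} → Flagged r lam μ f g → ∀ i (c : Fin r) → toℕ c ≡ i → ChainEnd lam μ g i → g 0 ≤ f 0 →
    det (entryMatrix r lam μ f g) ≈ (1# + β * x (g i)) * det (entryMatrix r lam μ f (update g i (suc (g i))))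
      + x (g i) * det (entryMatrix r lam (update μ i (suc (μ i))) f g)
  det-peel {r} {lam} {μ} {f} {g} h i c ≡.refl chain g≤f = det-linear c (1# + β * x (g i)) (x (g i))
    (λ a → column (toℕ a))
    (λ a b b≢c → reflexive (≡.cong (λ q → E (f (toℕ a)) q _ _)
      (≡.sym (update-other g i _ (toℕ b) (b≢c ∘ Finₚ.toℕ-injective)))))
    (λ a b b≢c → reflexive (≡.cong (λ m → E _ _ (toℕ a ⊖ toℕ b) ((lam (toℕ a) ⊖ m) ℤ.+ (toℕ b ⊖ toℕ a)))
      (≡.sym (update-other μ i _ (toℕ b) (b≢c ∘ Finₚ.toℕ-injective)))))
    where
    column : ∀ a → entry lam μ f g a i ≈ (1# + β * x (g i)) * entry lam μ f (update g i (suc (g i))) a i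
      + x (g i) * entry lam (update μ i (suc (μ i))) f g a i
    column a rewrite update-same g i (suc (g i)) | update-same μ i (suc (μ i)) with reach h chain g≤f a
    ... | inj₁ g≤fa = E-peel-⊖ g≤fa (a ⊖ i) (lam a) (μ i) (i ⊖ a)
    ... | inj₂ (i<a , l) = trans (E-below (f a) (g i) i<a l) (sym (trans
      (+-cong (trans (*-congˡ (E-below (f a) (suc (g i)) i<a l)) (zeroʳ _))
              (trans (*-congˡ (E-below (f a) (g i) i<a (ℕₚ.m≤n⇒m≤1+n l))) (zeroʳ _)))
      (+-identityʳ 0#)))

  -- Columns k and k + 1 share μ and g, so `E-column` provides the column operation; in rows past a
  -- break all three entries vanish.
  det-raise : ∀ {r lam μ f g} → Flagged r lam μ f g → ∀ k → suc k < r → ChainEnd lam μ g (suc k) → g 0 ≤ f 0 →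
    μ (suc k) ≡ μ k → det (entryMatrix r lam μ f g) ≈ det (entryMatrix r lam μ f (update g (suc k) (suc (g (suc k)))))
  det-raise {r} {lam} {μ} {f} {g} h k k<r chain g≤f μ≡ with adjacent-at k k<r
  ... | c , c′ , adj , c≡ , c′≡ = 1+βx-cancelˡ (g (suc k)) (det-column-operation adj u (x (g (suc k)))
    (entryMatrix r lam μ f g′) (entryMatrix r lam μ f g)
    (λ a → column (toℕ a))
    (λ a b b≢c′ → reflexive (≡.cong (λ q → E (f (toℕ a)) q _ _)
      (≡.sym (update-other g (suc k) _ (toℕ b) (λ e → b≢c′ (Finₚ.toℕ-injective (≡.trans e (≡.sym c′≡)))))))))
    where
    open ChainEnd chain
    u = 1# + β * x (g (suc k))
    g′ = update g (suc k) (suc (g (suc k)))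
    g≡ : g (suc k) ≡ g k
    g≡ = ≡.trans (level (suc k) ℕₚ.≤-refl) (≡.sym (level k (ℕₚ.n≤1+n k)))
    column : ∀ a → u * entry lam μ f g a (toℕ c′) ≈ u * entry lam μ f g′ a (toℕ c′) + x (g (suc k)) * entry lam μ f g a (toℕ c)
    column a rewrite c≡ | c′≡ | update-same g (suc k) (suc (g (suc k))) | ≡.sym g≡ | ≡.sym μ≡ with reach h chain g≤f a
    ... | inj₁ g≤fa = E-column g≤fa (lam a ⊖ μ (suc k)) a k
    ... | inj₂ (k<a , l) = trans (trans (*-congˡ (E-below (f a) (g (suc k)) k<a l)) (zeroʳ u)) (sym (trans
      (+-cong (trans (*-congˡ (E-below (f a) (suc (g (suc k))) k<a l)) (zeroʳ u))
              (trans (*-congˡ (E-below (f a) (g (suc k)) (ℕₚ.<-trans (ℕₚ.n<1+n k) k<a) l)) (zeroʳ (x (g (suc k))))))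
      (+-identityʳ 0#)))

  -- The corner has n = 0 and exponent 0, hence value 1, and lam a ≤ lam 0 = μ 0 kills the rest of
  -- the first column.
  det-empty-row : ∀ {r lam μ f g} → Flagged (suc r) lam μ f g → lam 0 ≡ μ 0 →
    det (entryMatrix (suc r) lam μ f g) ≈ det (entryMatrix r (lam ∘ suc) (μ ∘ suc) (f ∘ suc) (g ∘ suc))
  det-empty-row {r} {lam} {μ} {f} {g} h e = trans
    (det-unit-first-column (entryMatrix (suc r) lam μ f g) diagonal
      λ a → E-below (f (suc (toℕ a))) (g 0) (s≤s z≤n)
        (ℕₚ.≤-trans (antitone {lam} lam-dec {0} z≤n) (ℕₚ.≤-reflexive e)))
    (det-cong {r} λ a b → reflexive (≡.cong₂
      (λ n m → E (f (suc (toℕ a))) (g (suc (toℕ b))) n ((lam (suc (toℕ a)) ⊖ μ (suc (toℕ b))) ℤ.+ m))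
      (ℤₚ.[1+m]⊖[1+n]≡m⊖n (toℕ a) (toℕ b)) (ℤₚ.[1+m]⊖[1+n]≡m⊖n (toℕ b) (toℕ a))))
    where
    open Flagged h
    diagonal : entry lam μ f g 0 0 ≈ 1#
    diagonal = trans (reflexive (≡.cong (λ z → E (f 0) (g 0) 0ℤ (z ℤ.+ 0ℤ))
      (≡.trans (≡.cong (_⊖ μ 0) e) (ℤₚ.n⊖n≡0 (μ 0))))) (E-0-0 (f 0) (g 0))

  -- Let e be the first break. In columns j ≤ e the chain gives g j ≥ g 0 > f 0, so row 0 has empty
  -- products there, at positive exponents since μ j ≤ μ 0 < lam 0. Rows below the break vanish in
  -- these columns by `E-below`.
  det-zero : ∀ {r lam μ f g} → Flagged (suc r) lam μ f g → μ 0 < lam 0 → f 0 < g 0 →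
    det (entryMatrix (suc r) lam μ f g) ≈ 0#
  det-zero {r} {lam} {μ} {f} {g} h μ<lam f<g
    with least (λ c → lam (suc c) ℕₚ.≤? μ c) r (≡.subst (_≤ μ r) (≡.sym (Flagged.support h (suc r) ℕₚ.≤-refl)) z≤n)
  ... | e , d , go = det-zero-hook e (entryMatrix (suc r) lam μ f g)
    (λ j j≤e → row (toℕ j) (ℕ.s≤s⁻¹ j≤e))
    (λ a c e<a c≤e → E-below (f (toℕ a)) (g (toℕ c)) (ℕₚ.<-≤-trans c≤e e<a)
      (ℕₚ.≤-trans (antitone {lam} lam-dec e<a) (ℕₚ.≤-trans d (antitone {μ} μ-dec (ℕ.s≤s⁻¹ c≤e)))))
    where
    open Flagged h
    row : ∀ j → j ≤ e → entry lam μ f g 0 j ≈ 0#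
    row j j≤e with ⊖-positive j (ℕₚ.≤-<-trans (antitone {μ} μ-dec {0} {j} z≤n) μ<lam)
    ... | k , eq = trans (reflexive (≡.cong (E (f 0) (g j) (0 ⊖ j)) eq))
      (E-empty (ℕₚ.<-≤-trans f<g (g-chain j λ c c<j → go c (ℕₚ.<-≤-trans c<j j≤e))) (0 ⊖ j) k)

  Formula : ℕ → (lam μ f g : ℕ → ℕ) → Set
  Formula r lam μ f g = det (entryMatrix r lam μ f g) ≈ tableauSum r lam μ f g (λ _ → 0)

  -- Both induction hypotheses are arguments, one for a dropped row and one for a smaller measure.
  -- The recursion in `det≈tableauSum` is then structural, on r and for fixed r on N.
  formula-step : ∀ {r N lam μ f g} →
    (∀ {lam μ f g} → Flagged r lam μ f g → Formula r lam μ f g) →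
    (∀ {lam μ f g} → Flagged (suc r) lam μ f g → measure (suc r) lam μ f g < N → Formula (suc r) lam μ f g) →
    Flagged (suc r) lam μ f g → measure (suc r) lam μ f g ≤ N → Formula (suc r) lam μ f g
  formula-step {r} {N} {lam} {μ} {f} {g} ih-tail ih h bound with μ 0 ℕₚ.<? lam 0
  ... | no μ≮lam = begin
    det (entryMatrix (suc r) lam μ f g)
      ≈⟨ det-empty-row h lam≡μ ⟩
    det (entryMatrix r (lam ∘ suc) (μ ∘ suc) (f ∘ suc) (g ∘ suc))
      ≈⟨ ih-tail (flagged-tail h) ⟩
    tableauSum r (lam ∘ suc) (μ ∘ suc) (f ∘ suc) (g ∘ suc) (λ _ → 0)
      ≈⟨ tableauSum-empty-row r lam μ f g (λ _ → 0) lam≡μ ⟨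
    tableauSum (suc r) lam μ f g (λ _ → 0) ∎
    where lam≡μ = ℕₚ.≤-antisym (ℕₚ.≮⇒≥ μ≮lam) (Flagged.μ≤lam h 0)
  ... | yes μ<lam with g 0 ℕₚ.≤? f 0
  ...   | no g≰f = trans (det-zero h μ<lam (ℕₚ.≰⇒> g≰f))
            (sym (tableauSum-zero r lam μ f g (λ _ → 0) (ℕₚ.≰⇒> g≰f) μ<lam))
  ...   | yes g≤f with chainEnd h
  ...     | i , chain = step i chain
    where
    open Flagged h

    peel : ∀ i → ChainEnd lam μ g i → FreeLeft i μ (λ _ → 0) → (∀ k → i ≡ suc k → μ i < μ k) →
      det (entryMatrix (suc r) lam μ f g) ≈ tableauSum (suc r) lam μ f g (λ _ → 0)
    peel i chain free free′ = begin
      det (entryMatrix (suc r) lam μ f g)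
        ≈⟨ det-peel h i (fromℕ< i<r) (Finₚ.toℕ-fromℕ< i<r) chain g≤f ⟩
      (1# + β * x (g i)) * det (entryMatrix (suc r) lam μ f (update g i (suc (g i))))
        + x (g i) * det (entryMatrix (suc r) lam (update μ i (suc (μ i))) f g)
        ≈⟨ +-cong
             (*-congˡ (ih (flagged-g i h (ChainEnd.end chain))
               (ℕₚ.<-≤-trans (measure-g (suc r) i lam μ f g i<r gi≤fi) bound)))
             (*-congˡ (ih (flagged-μ i h μi<lami free′)
               (ℕₚ.<-≤-trans (measure-μ (suc r) i lam μ f g i<r μi<lami) bound))) ⟩
      (1# + β * x (g i)) * tableauSum (suc r) lam μ f (update g i (suc (g i))) (λ _ → 0)
        + x (g i) * tableauSum (suc r) lam (update μ i (suc (μ i))) f g (λ _ → 0)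
        ≈⟨ tableauSum-peel (suc r) i lam μ f g (λ _ → 0) i<r gi≤fi μi<lami free (μ≤lam (suc i)) (ChainEnd.end chain) ⟨
      tableauSum (suc r) lam μ f g (λ _ → 0) ∎
      where
      μi<lami = nonEmpty-end h chain g≤f μ<lam
      gi≤fi   = g≤f-end h chain g≤f
      i<r     = nonEmpty⇒<r μi<lami

    step : ∀ i → ChainEnd lam μ g i →
      det (entryMatrix (suc r) lam μ f g) ≈ tableauSum (suc r) lam μ f g (λ _ → 0)
    step zero    chain = peel zero chain ≡.refl λ _ ()
    step (suc k) chain with μ (suc k) ℕₚ.≟ μ k
    ... | no μ≢ = peel (suc k) chain μ< λ { _ ≡.refl → μ< }
      where μ< = ℕₚ.≤∧≢⇒< (μ-dec k) μ≢
    ... | yes μ≡ = begin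
      det (entryMatrix (suc r) lam μ f g)
        ≈⟨ det-raise h k k<r chain g≤f μ≡ ⟩
      det (entryMatrix (suc r) lam μ f g′)
        ≈⟨ ih (flagged-g (suc k) h end)
             (ℕₚ.<-≤-trans (measure-g (suc r) (suc k) lam μ f g k<r (g≤f-end h chain g≤f)) bound) ⟩
      tableauSum (suc r) lam μ f g′ (λ _ → 0)
        ≈⟨ tableauSum-raise (suc r) k lam μ f g (λ _ → 0) k<r
             (ℕₚ.<-≤-trans (linked k ℕₚ.≤-refl) (lam-dec k)) μ≡
             (≡.trans (level (suc k) ℕₚ.≤-refl) (≡.sym (level k (ℕₚ.n≤1+n k)))) ⟨
      tableauSum (suc r) lam μ f g (λ _ → 0) ∎
      where
      open ChainEnd chain
      g′ = update g (suc k) (suc (g (suc k)))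
      k<r = nonEmpty⇒<r (nonEmpty-end h chain g≤f μ<lam)

  det≈tableauSum : ∀ r N {lam μ f g} → Flagged r lam μ f g → measure r lam μ f g < N → Formula r lam μ f g
  det≈tableauSum zero    N       h _           = refl
  det≈tableauSum (suc r) (suc N) h (s≤s bound) = formula-step
    (λ h′ → det≈tableauSum r _ h′ ℕₚ.≤-refl) (det≈tableauSum (suc r) N) h bound

-- Fillings

extend : ∀ {r} → (Fin r → ℕ) → ℕ → ℕ
extend {zero}  h _       = 0
extend {suc r} h zero    = h fzero
extend {suc r} h (suc i) = extend (h ∘ fsuc) i

Row : ℕ → Set
Row n = Fin n → List⁺ ℕ

-- The successor stores a strict bound as a weak one, so that columns without a box can carry the
-- vacuous bound 0.
nextBound : ∀ {n} → ℕ → Row n → ℕ → ℕ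
nextBound {zero}  m R = λ _ → 0
nextBound {suc n} m R = update (nextBound (suc m) (R ∘ fsuc)) m (suc (maximum (R fzero)))

nextBound-≤⇒ : ∀ {n} m (R : Row n) c v → nextBound m R c ≤ v → ∀ j → m ℕ.+ toℕ j ≡ c → maximum (R j) < v
nextBound-≤⇒ {suc n} m R c v l fzero ≡.refl = ≡.subst (_≤ v)
  (≡.trans (≡.cong (update (nextBound (suc m) (R ∘ fsuc)) m _) (ℕₚ.+-identityʳ m)) (update-same _ m _)) l
nextBound-≤⇒ {suc n} m R c v l (fsuc j) e = nextBound-≤⇒ (suc m) (R ∘ fsuc) c v
  (≡.subst (_≤ v) (update-other _ m _ c c≢m) l) j e′
  where
  e′ : suc m ℕ.+ toℕ j ≡ c
  e′ = ≡.trans (≡.sym (ℕₚ.+-suc m (toℕ j))) e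
  c≢m : c ≢ m
  c≢m ≡.refl = ℕₚ.m+1+n≢m m e

nextBound-≤⇐ : ∀ {n} m (R : Row n) c v → (∀ j → m ℕ.+ toℕ j ≡ c → maximum (R j) < v) → nextBound m R c ≤ v
nextBound-≤⇐ {zero}  m R c v h = z≤n
nextBound-≤⇐ {suc n} m R c v h with c ℕₚ.≟ m
... | yes ≡.refl = ≡.subst (_≤ v) (≡.sym (update-same _ m _)) (h fzero (ℕₚ.+-identityʳ m))
... | no  c≢m    = ≡.subst (_≤ v) (≡.sym (update-other _ m _ c c≢m))
  (nextBound-≤⇐ (suc m) (R ∘ fsuc) c v λ j e → h (fsuc j) (≡.trans (ℕₚ.+-suc m (toℕ j)) e))

concatMap-allFin : ∀ {A : Set} {n} (h : Fin n → List A) → List.concatMap h (allFin n) ≡ concat (tabulate h)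
concatMap-allFin h = ≡.cong concat (Listₚ.map-tabulate id h)

rowEntries : ∀ {n} → Row n → List ℕ
rowEntries R = concat (tabulate (toList ∘ R))

excess : ∀ {n} → Row n → ℕ
excess {zero}  R = 0
excess {suc n} R = length (List⁺.tail (R fzero)) ℕ.+ excess (R ∘ fsuc)

length-rowEntries : ∀ {n} (R : Row n) → length (rowEntries R) ≡ n ℕ.+ excess R
length-rowEntries {zero}  R = ≡.refl
length-rowEntries {suc n} R = ≡.cong suc (≡.trans (Listₚ.length-++ (List⁺.tail (R fzero)))
  (≡.trans (≡.cong (k ℕ.+_) (length-rowEntries (R ∘ fsuc))) (x∙yz≈y∙xz k n (excess (R ∘ fsuc)))))
  where
  open Algebra.Properties.CommutativeSemigroup ℕₚ.+-commutativeSemigroup using (x∙yz≈y∙xz)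
  k = length (List⁺.tail (R fzero))

totalExcess : ∀ {r} {n : Fin r → ℕ} → (∀ i → Row (n i)) → ℕ
totalExcess {zero}  T = 0
totalExcess {suc r} T = excess (T fzero) ℕ.+ totalExcess (T ∘ fsuc)

allEntries : ∀ {r} {n : Fin r → ℕ} → (∀ i → Row (n i)) → List ℕ
allEntries T = concat (tabulate (λ i → rowEntries (T i)))

length-allEntries : ∀ {r} {n : Fin r → ℕ} (T : ∀ i → Row (n i)) →
  length (allEntries T) ≡ List.sum (tabulate n) ℕ.+ totalExcess T
length-allEntries {zero}      T = ≡.refl
length-allEntries {suc r} {n} T = ≡.trans (Listₚ.length-++ (rowEntries (T fzero)))
  (≡.trans (≡.cong₂ ℕ._+_ (length-rowEntries (T fzero)) (length-allEntries (T ∘ fsuc)))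
    (interchange (n fzero) (excess (T fzero)) _ _))
  where open Algebra.Properties.CommutativeSemigroup ℕₚ.+-commutativeSemigroup using (interchange)

entries≡allEntries : ∀ {r} (lam μ : Fin r → ℕ) T → entries lam μ T ≡ allEntries T
entries≡allEntries {r} lam μ T = ≡.trans
  (concatMap-allFin λ i → List.concatMap (λ j → toList (T i j)) (allFin (lam i ∸ μ i)))
  (≡.cong concat (Listₚ.tabulate-cong λ i → concatMap-allFin (toList ∘ T i)))

excess≡ : ∀ {r} (lam μ : Fin r → ℕ) T → length (entries lam μ T) ∸ size lam μ ≡ totalExcess T
excess≡ lam μ T = ≡.trans
  (≡.cong₂ _∸_ (≡.trans (≡.cong length (entries≡allEntries lam μ T)) (length-allEntries T))
    (≡.cong List.sum (Listₚ.map-tabulate id (λ i → lam i ∸ μ i))))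
  (ℕₚ.m+n∸m≡n (List.sum (tabulate λ i → lam i ∸ μ i)) (totalExcess T))

module Fillings (R : CommutativeRing 0ℓ 0ℓ) (β : CommutativeRing.Carrier R) (x : ℕ → CommutativeRing.Carrier R) where
  open CommutativeRing R hiding (zero)
  open Algebra.Properties.Semiring.Exp semiring using (_^_; ^-homo-*)
  open Algebra.Solver.Ring.NaturalCoefficients.Default commutativeSemiring using (solve; _:+_; _:*_; _:=_)
  open Relation.Binary.Reasoning.Setoid setoid
  open Tableaux R β x

  -- The conjunction of the conditions whose indicators `rowSum` multiplies.
  RowAdmissible : ∀ {n} → (m l : ℕ) (b : ℕ → ℕ) → Row n → Set
  RowAdmissible {zero}  m l b S = ⊤
  RowAdmissible {suc n} m l b S = Allowed l (b m) (S fzero) × RowAdmissible (suc m) (maximum (S fzero)) b (S ∘ fsuc)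

  rowAdmissible? : ∀ {n} m l b (S : Row n) → Dec (RowAdmissible m l b S)
  rowAdmissible? {zero}  m l b S = yes tt
  rowAdmissible? {suc n} m l b S =
    allowed? l (b m) (S fzero) ×-dec rowAdmissible? (suc m) (maximum (S fzero)) b (S ∘ fsuc)

  RowWeak : ∀ {n} → Row n → Set
  RowWeak S = ∀ j j′ → toℕ j′ ≡ suc (toℕ j) → maximum (S j) ≤ minimum (S j′)

  rowAdmissible⇒ : ∀ {n} m l b (S : Row n) → RowAdmissible m l b S →
    RowWeak S × (∀ j → b (m ℕ.+ toℕ j) ≤ minimum (S j)) × (∀ j → toℕ j ≡ 0 → l ≤ minimum (S j))
  rowAdmissible⇒ {zero}  m l b S _ = (λ ()) , (λ ()) , λ ()
  rowAdmissible⇒ {suc n} m l b S ((p , q) , rest) with rowAdmissible⇒ (suc m) _ b (S ∘ fsuc) rest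
  ... | weak , bound , lower = weak′ , bound′ , lower′
    where
    weak′ : RowWeak S
    weak′ fzero    (fsuc j′) e = lower j′ (ℕₚ.suc-injective e)
    weak′ (fsuc j) (fsuc j′) e = weak j j′ (ℕₚ.suc-injective e)
    bound′ : ∀ j → b (m ℕ.+ toℕ j) ≤ minimum (S j)
    bound′ fzero    = ≡.subst (λ c → b c ≤ minimum (S fzero)) (≡.sym (ℕₚ.+-identityʳ m)) q
    bound′ (fsuc j) = ≡.subst (λ c → b c ≤ minimum (S (fsuc j))) (≡.sym (ℕₚ.+-suc m (toℕ j))) (bound j)
    lower′ : ∀ j → toℕ j ≡ 0 → l ≤ minimum (S j)
    lower′ fzero _ = p

  rowAdmissible⇐ : ∀ {n} m l b (S : Row n) → RowWeak S → (∀ j → b (m ℕ.+ toℕ j) ≤ minimum (S j)) →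
    (∀ j → toℕ j ≡ 0 → l ≤ minimum (S j)) → RowAdmissible m l b S
  rowAdmissible⇐ {zero}  m l b S weak bound lower = tt
  rowAdmissible⇐ {suc n} m l b S weak bound lower =
    (lower fzero ≡.refl , ≡.subst (λ c → b c ≤ minimum (S fzero)) (ℕₚ.+-identityʳ m) (bound fzero)) ,
    rowAdmissible⇐ (suc m) _ b (S ∘ fsuc)
      (λ j j′ e → weak (fsuc j) (fsuc j′) (≡.cong suc e))
      (λ j → ≡.subst (λ c → b c ≤ minimum (S (fsuc j))) (ℕₚ.+-suc m (toℕ j)) (bound (fsuc j)))
      (λ j e → weak fzero (fsuc j) (≡.cong suc e))

  Admissible : ∀ {r} (lam μ : Fin r → ℕ) (b : ℕ → ℕ) → Filling lam μ → Set
  Admissible {zero}  lam μ b T = ⊤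
  Admissible {suc r} lam μ b T = RowAdmissible (μ fzero) 0 b (T fzero) ×
    Admissible (lam ∘ fsuc) (μ ∘ fsuc) (nextBound (μ fzero) (T fzero)) (T ∘ fsuc)

  admissible? : ∀ {r} (lam μ : Fin r → ℕ) b T → Dec (Admissible lam μ b T)
  admissible? {zero}  lam μ b T = yes tt
  admissible? {suc r} lam μ b T = rowAdmissible? (μ fzero) 0 b (T fzero) ×-dec
    admissible? (lam ∘ fsuc) (μ ∘ fsuc) (nextBound (μ fzero) (T fzero)) (T ∘ fsuc)

  -- The column condition against an imagined row above the first. In the induction over rows it
  -- becomes the column condition between consecutive rows.
  TopBound : ∀ {r} (lam μ : Fin r → ℕ) (b : ℕ → ℕ) → Filling lam μ → Set
  TopBound lam μ b T = ∀ i → toℕ i ≡ 0 → ∀ j → b (μ i ℕ.+ toℕ j) ≤ minimum (T i j)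

  admissible⇒ : ∀ {r} (lam μ : Fin r → ℕ) b T → Admissible lam μ b T →
    RowCondition lam μ T × ColumnCondition lam μ T × TopBound lam μ b T
  admissible⇒ {zero}  lam μ b T _ = (λ ()) , (λ ()) , λ ()
  admissible⇒ {suc r} lam μ b T (row , rest)
    with rowAdmissible⇒ (μ fzero) 0 b (T fzero) row | admissible⇒ (lam ∘ fsuc) (μ ∘ fsuc) _ (T ∘ fsuc) rest
  ... | weak , bound , _ | rows , columns , top = rows′ , columns′ , top′
    where
    rows′ : RowCondition lam μ T
    rows′ fzero    = weak
    rows′ (fsuc i) = rows i
    columns′ : ColumnCondition lam μ T
    columns′ fzero    (fsuc i′) e j j′ e′ =
      nextBound-≤⇒ (μ fzero) (T fzero) _ _ (top i′ (ℕₚ.suc-injective e) j′) j e′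
    columns′ (fsuc i) (fsuc i′) e = columns i i′ (ℕₚ.suc-injective e)
    top′ : TopBound lam μ b T
    top′ fzero _ = bound

  admissible⇐ : ∀ {r} (lam μ : Fin r → ℕ) b T → RowCondition lam μ T → ColumnCondition lam μ T →
    TopBound lam μ b T → Admissible lam μ b T
  admissible⇐ {zero}  lam μ b T rows columns top = tt
  admissible⇐ {suc r} lam μ b T rows columns top =
    rowAdmissible⇐ (μ fzero) 0 b (T fzero) (rows fzero) (top fzero ≡.refl) (λ _ _ → z≤n) ,
    admissible⇐ (lam ∘ fsuc) (μ ∘ fsuc) _ (T ∘ fsuc) (rows ∘ fsuc)
      (λ i i′ e → columns (fsuc i) (fsuc i′) (≡.cong suc e))
      (λ i e j′ → nextBound-≤⇐ (μ fzero) (T fzero) _ _ λ j e′ → columns fzero (fsuc i) (≡.cong suc e) j j′ e′)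

  rowWeight : ∀ {n} → Row n → Carrier
  rowWeight {zero}  S = 1#
  rowWeight {suc n} S = boxWeight (S fzero) * rowWeight (S ∘ fsuc)

  fillingWeight : ∀ {r} {n : Fin r → ℕ} → (∀ i → Row (n i)) → Carrier
  fillingWeight {zero}  T = 1#
  fillingWeight {suc r} T = rowWeight (T fzero) * fillingWeight (T ∘ fsuc)

  monomial-++ : ∀ as bs → monomial (as ++ bs) ≈ monomial as * monomial bs
  monomial-++ []       bs = sym (*-identityˡ _)
  monomial-++ (a ∷ as) bs = trans (*-congˡ (monomial-++ as bs)) (sym (*-assoc _ _ _))

  weight-* : ∀ j k as bs → (β ^ j * monomial as) * (β ^ k * monomial bs) ≈ β ^ (j ℕ.+ k) * monomial (as ++ bs)
  weight-* j k as bs = trans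
    (solve 4 (λ a b c d → (a :* b) :* (c :* d) := (a :* c) :* (b :* d)) refl (β ^ j) (monomial as) (β ^ k) (monomial bs))
    (sym (*-cong (^-homo-* β j k) (monomial-++ as bs)))

  rowWeight≈ : ∀ {n} (S : Row n) → rowWeight S ≈ β ^ excess S * monomial (rowEntries S)
  rowWeight≈ {zero}  S = sym (*-identityˡ 1#)
  rowWeight≈ {suc n} S = trans (*-congˡ (rowWeight≈ (S ∘ fsuc))) (weight-* (length (List⁺.tail (S fzero))) (excess (S ∘ fsuc)) (toList (S fzero)) _)

  fillingWeight≈ : ∀ {r} {n : Fin r → ℕ} (T : ∀ i → Row (n i)) → fillingWeight T ≈ β ^ totalExcess T * monomial (allEntries T)
  fillingWeight≈ {zero}  T = sym (*-identityˡ 1#)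
  fillingWeight≈ {suc r} T = trans (*-cong (rowWeight≈ (T fzero)) (fillingWeight≈ (T ∘ fsuc)))
    (weight-* (excess (T fzero)) (totalExcess (T ∘ fsuc)) (rowEntries (T fzero)) _)

  weight : ∀ {r} (lam μ : Fin r → ℕ) → Filling lam μ → Carrier
  weight lam μ T = β ^ (length (entries lam μ T) ∸ size lam μ) * monomial (entries lam μ T)

  weight≈ : ∀ {r} (lam μ : Fin r → ℕ) T → weight lam μ T ≈ fillingWeight T
  weight≈ lam μ T = trans
    (reflexive (≡.cong₂ (λ k as → β ^ k * monomial as) (excess≡ lam μ T) (entries≡allEntries lam μ T)))
    (sym (fillingWeight≈ T))

  ΣL-cartesianProductWith : ∀ {A B C : Set} (h : A → B → C) as bs φ →
    ΣL (cartesianProductWith h as bs) φ ≈ ΣL as λ a → ΣL bs λ b → φ (h a b)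
  ΣL-cartesianProductWith h []       bs φ = refl
  ΣL-cartesianProductWith h (a ∷ as) bs φ = trans (ΣL-++ (map (h a) bs) _ φ)
    (+-cong (ΣL-map (h a) bs φ) (ΣL-cartesianProductWith h as bs φ))

  ΣL-cong-all : ∀ {A : Set} as {φ ψ : A → Carrier} → (∀ a → φ a ≈ ψ a) → ΣL as φ ≈ ΣL as ψ
  ΣL-cong-all as e = ΣL-cong (All.universal e as)

  -- The nested sums are multiplied out: a product of indicators is the indicator of a conjunction,
  -- and `∀-cons` joins the first box to the rest exactly as in `choices`.
  rowSum≈ : ∀ n m l f g b K → rowSum n m l f g b K ≈
    ΣL (choices {n} λ _ → nonEmptySubsets (interval g f)) λ S →
      𝟙 (rowAdmissible? m l b S) * (rowWeight S * K (nextBound m S))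
  rowSum≈ zero    m l f g b K = sym (trans (+-identityʳ _) (trans (*-identityˡ _) (*-identityˡ _)))
  rowSum≈ (suc n) m l f g b K = begin
    ΣL N (λ s → 𝟙 (A? s) * (boxWeight s * rowSum n (suc m) (maximum s) f g b (K′ s)))
      ≈⟨ ΣL-cong-all N (λ s → *-congˡ {𝟙 (A? s)} (*-congˡ {boxWeight s} (rowSum≈ n (suc m) (maximum s) f g b (K′ s)))) ⟩
    ΣL N (λ s → 𝟙 (A? s) * (boxWeight s * ΣL C (λ S → 𝟙 (B? s S) * (rowWeight S * K′ s (nextBound (suc m) S)))))
      ≈⟨ ΣL-cong-all N (λ s → trans (sym (*-assoc _ _ _)) (ΣL-* (𝟙 (A? s) * boxWeight s) C _)) ⟩
    ΣL N (λ s → ΣL C (λ S → 𝟙 (A? s) * boxWeight s * (𝟙 (B? s S) * (rowWeight S * K′ s (nextBound (suc m) S)))))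
      ≈⟨ ΣL-cong-all N (λ s → ΣL-cong-all C λ S → trans
           (solve 5 (λ i w j v k → i :* w :* (j :* (v :* k)) := (i :* j) :* ((w :* v) :* k)) refl
             (𝟙 (A? s)) (boxWeight s) (𝟙 (B? s S)) (rowWeight S) (K′ s (nextBound (suc m) S)))
           (*-congʳ (sym (𝟙-× (A? s) (B? s S))))) ⟩
    ΣL N (λ s → ΣL C (λ S → φ (∀-cons s S)))
      ≈⟨ ΣL-cartesianProductWith ∀-cons N C φ ⟨
    ΣL (choices {suc n} λ _ → N) φ ∎
    where
    N = nonEmptySubsets (interval g f)
    C = choices {n} λ _ → N
    A? : ∀ s → Dec (Allowed l (b m) s)
    A? s = allowed? l (b m) s
    B? : ∀ s (S : Row n) → Dec (RowAdmissible (suc m) (maximum s) b S)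
    B? s S = rowAdmissible? (suc m) (maximum s) b S
    K′ : List⁺ ℕ → (ℕ → ℕ) → Carrier
    K′ s c = K (update c m (suc (maximum s)))
    φ : Row (suc n) → Carrier
    φ S = 𝟙 (rowAdmissible? m l b S) * (rowWeight S * K (nextBound m S))

  tableauSum≈ : ∀ {r} (lam μ f g : Fin r → ℕ) b →
    tableauSum r (extend lam) (extend μ) (extend f) (extend g) b ≈
    ΣL (choices λ i → choices {lam i ∸ μ i} λ j → nonEmptySubsets (interval (g i) (f i))) λ T →
      𝟙 (admissible? lam μ b T) * fillingWeight T
  tableauSum≈ {zero}  lam μ f g b = sym (trans (+-identityʳ _) (*-identityˡ _))
  tableauSum≈ {suc r} lam μ f g b = begin
    rowSum (lam fzero ∸ μ fzero) (μ fzero) 0 (f fzero) (g fzero) b K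
      ≈⟨ rowSum≈ (lam fzero ∸ μ fzero) (μ fzero) 0 (f fzero) (g fzero) b K ⟩
    ΣL C (λ S → 𝟙 (A? S) * (rowWeight S * K (nextBound (μ fzero) S)))
      ≈⟨ ΣL-cong-all C (λ S → *-congˡ {𝟙 (A? S)} (*-congˡ {rowWeight S}
           (tableauSum≈ (lam ∘ fsuc) (μ ∘ fsuc) (f ∘ fsuc) (g ∘ fsuc) (nextBound (μ fzero) S)))) ⟩
    ΣL C (λ S → 𝟙 (A? S) * (rowWeight S * ΣL D (λ T → 𝟙 (B? S T) * fillingWeight T)))
      ≈⟨ ΣL-cong-all C (λ S → trans (sym (*-assoc _ _ _)) (ΣL-* (𝟙 (A? S) * rowWeight S) D _)) ⟩
    ΣL C (λ S → ΣL D (λ T → 𝟙 (A? S) * rowWeight S * (𝟙 (B? S T) * fillingWeight T)))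
      ≈⟨ ΣL-cong-all C (λ S → ΣL-cong-all D λ T → trans
           (solve 4 (λ i w j v → i :* w :* (j :* v) := (i :* j) :* (w :* v)) refl
             (𝟙 (A? S)) (rowWeight S) (𝟙 (B? S T)) (fillingWeight T))
           (*-congʳ (sym (𝟙-× (A? S) (B? S T))))) ⟩
    ΣL C (λ S → ΣL D (λ T → φ (∀-cons S T)))
      ≈⟨ ΣL-cartesianProductWith ∀-cons C D φ ⟨
    ΣL (choices λ i → choices {lam i ∸ μ i} λ j → nonEmptySubsets (interval (g i) (f i))) φ ∎
    where
    K = tableauSum r (extend (lam ∘ fsuc)) (extend (μ ∘ fsuc)) (extend (f ∘ fsuc)) (extend (g ∘ fsuc))
    C = choices {lam fzero ∸ μ fzero} λ j → nonEmptySubsets (interval (g fzero) (f fzero))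
    D = choices λ i → choices {lam (fsuc i) ∸ μ (fsuc i)} λ j → nonEmptySubsets (interval (g (fsuc i)) (f (fsuc i)))
    A? : ∀ S → Dec (RowAdmissible (μ fzero) 0 b S)
    A? S = rowAdmissible? (μ fzero) 0 b S
    B? : ∀ (S : Row (lam fzero ∸ μ fzero)) T → Dec (Admissible (lam ∘ fsuc) (μ ∘ fsuc) (nextBound (μ fzero) S) T)
    B? S T = admissible? (lam ∘ fsuc) (μ ∘ fsuc) (nextBound (μ fzero) S) T
    φ : Filling lam μ → Carrier
    φ T = 𝟙 (admissible? lam μ b T) * fillingWeight T

  foldr-filter : ∀ {A : Set} {P : A → Set} (P? : ∀ a → Dec (P a)) (w : A → Carrier) as →
    foldr (λ a F → w a + F) 0# (filter P? as) ≈ ΣL as λ a → 𝟙 (P? a) * w a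
  foldr-filter P? w []       = refl
  foldr-filter P? w (a ∷ as) with P? a
  ... | yes _ = +-cong (sym (*-identityˡ _)) (foldr-filter P? w as)
  ... | no  _ = trans (foldr-filter P? w as) (sym (trans (+-congʳ (zeroˡ _)) (+-identityˡ _)))

  tableaux≈tableauSum : ∀ {r} (lam μ f g : Fin r → ℕ) →
    foldr (λ T F → weight lam μ T + F) 0# (filter (tableau? lam μ)
      (choices λ i → choices {lam i ∸ μ i} λ j → nonEmptySubsets (interval (g i) (f i))))
    ≈ tableauSum r (extend lam) (extend μ) (extend f) (extend g) (λ _ → 0)
  tableaux≈tableauSum lam μ f g = trans (foldr-filter (tableau? lam μ) (weight lam μ) Ts) (trans
    (ΣL-cong-all Ts λ T → *-cong
      (𝟙-cong (tableau? lam μ T) (admissible? lam μ (λ _ → 0) T)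
        (λ (rows , columns) → admissible⇐ lam μ (λ _ → 0) T rows columns (λ _ _ _ → z≤n))
        (λ a → let rows , columns , _ = admissible⇒ lam μ (λ _ → 0) T a in rows , columns))
      (weight≈ lam μ T))
    (sym (tableauSum≈ lam μ f g (λ _ → 0))))
    where Ts = choices λ i → choices {lam i ∸ μ i} λ j → nonEmptySubsets (interval (g i) (f i))

open import Defs

-- The ring ℤ[β][[x]]

module ℤ⟦β⟧ = PowerSeries ℤₚ.+-*-commutativeRing

cauchy≡Σ≐ : ∀ f g n → cauchy f g n ≡ ℤ⟦β⟧.Σ≐ n λ i j → f i ℤ.* g j
cauchy≡Σ≐ f g zero    = ≡.refl
cauchy≡Σ≐ f g (suc n) = ≡.cong (λ z → f 0 ℤ.* g (suc n) ℤ.+ z) (cauchy≡Σ≐ (λ k → f (suc k)) g n)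

-- Coefficients embed ℤ[β] in ℤ[[β]], where trailing zeros are invisible.
module ℤ[β]-embedding = JointlyInjective ℤ[β]-rawRing ⊤ (λ _ → ℤ⟦β⟧.commutativeRingₚ) (λ _ → _at_)

ℤ[β]-commutativeRing : CommutativeRing 0ℓ 0ℓ
ℤ[β]-commutativeRing = ℤ[β]-embedding.IsJointlyInjective.commutativeRing record
  { φ-cong  = λ _ → at-≡
  ; φ-+     = λ _ → at-+
  ; φ-*     = λ _ p q n → CommutativeRing.trans ℤₚ.+-*-commutativeRing (at-* p q n) (cauchy≡Σ≐ _ _ n)
  ; φ-neg   = λ _ → at-map ℤ.-_ ≡.refl
  ; φ-0     = λ _ _ → ≡.refl
  ; φ-1     = λ { _ zero → ≡.refl ; _ (suc _) → ≡.refl }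
  ; reflect = λ e → mk≈ᵝ (e tt)
  }

-- ℤ[β][[x₁,…,xₖ]] as an iterated power series ring.
R⟦_⟧ : ℕ → CommutativeRing 0ℓ 0ℓ
R⟦ zero ⟧  = ℤ[β]-commutativeRing
R⟦ suc k ⟧ = PowerSeries.commutativeRingₚ R⟦ k ⟧

module R (k : ℕ) where
  open CommutativeRing R⟦ k ⟧ public
  open Algebra.Properties.Semiring.Sum semiring public using (sum)

-- Only exponent lists of length exactly k are read. No single k sees all lists, but every list has
-- a length, so the maps for all k are jointly injective.
restrict : ∀ k → (Monomial → ℤ[β]) → R.Carrier k
restrict zero    f = f []
restrict (suc k) f = λ n → restrict k λ e → f (n ∷ e)

restrict-cong : ∀ k {f g} → (∀ e → f e ≈ᵝ g e) → R._≈_ k (restrict k f) (restrict k g)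
restrict-cong zero    e = e []
restrict-cong (suc k) e = λ n → restrict-cong k λ d → e (n ∷ d)

restrict-reflect : ∀ {f g} → (∀ k → R._≈_ k (restrict k f) (restrict k g)) → ∀ e → f e ≈ᵝ g e
restrict-reflect h []      = h 0
restrict-reflect h (n ∷ e) = restrict-reflect (λ k → h (suc k) n) e

restrict-+ : ∀ k f g → R._≈_ k (restrict k λ e → f e +ᵝ g e) (R._+_ k (restrict k f) (restrict k g))
restrict-+ zero    f g = ≈ᵝ-refl
restrict-+ (suc k) f g = λ n → restrict-+ k _ _

restrict-neg : ∀ k f → R._≈_ k (restrict k λ e → -ᵝ f e) (R.-_ k (restrict k f))
restrict-neg zero    f = ≈ᵝ-refl
restrict-neg (suc k) f = λ n → restrict-neg k _

restrict-zero : ∀ k → R._≈_ k (restrict k λ _ → []) (R.0# k)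
restrict-zero zero    = ≈ᵝ-refl
restrict-zero (suc k) = λ n → restrict-zero k

restrict-0# : ∀ k → R._≈_ k (restrict k (coeff 0#)) (R.0# k)
restrict-0# zero    = ≈ᵝ-refl
restrict-0# (suc k) = λ { zero → restrict-0# k ; (suc _) → restrict-zero k }

restrict-1# : ∀ k → R._≈_ k (restrict k (coeff 1#)) (R.1# k)
restrict-1# zero    = ≈ᵝ-refl
restrict-1# (suc k) = λ { zero → restrict-1# k ; (suc _) → restrict-zero k }

restrict-Σᵝ : ∀ k {n} (f : Fin n → Monomial → ℤ[β]) →
  R._≈_ k (restrict k λ e → Σᵝ λ i → f i e) (R.sum k λ i → restrict k (f i))
restrict-Σᵝ k {zero}  f = restrict-zero k
restrict-Σᵝ k {suc n} f = R.trans k (restrict-+ k _ _) (R.+-congˡ k (restrict-Σᵝ k λ i → f (fsuc i)))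

sum-cong : ∀ k {n} {f g : Fin n → R.Carrier k} → (∀ i → R._≈_ k (f i) (g i)) → R._≈_ k (R.sum k f) (R.sum k g)
sum-cong k = Algebra.Properties.Semiring.Sum.sum-cong-≋ (R.semiring k)

restrict-convolve : ∀ k f g → R._≈_ k (restrict k (convolve f g)) (R._*_ k (restrict k f) (restrict k g))
restrict-convolve zero    f g = ≈ᵝ-refl
restrict-convolve (suc k) f g n = R.trans k
  (restrict-Σᵝ k {suc n} λ i → convolve (λ d → f (toℕ i ∷ d)) (λ d → g (n ∸ toℕ i ∷ d)))
  (R.trans k
    (sum-cong k {suc n} λ i → restrict-convolve k (λ d → f (toℕ i ∷ d)) (λ d → g (n ∸ toℕ i ∷ d)))
    (PowerSeries.sum≈Σ≐ R⟦ k ⟧ n λ i j →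
      R._*_ k (restrict k λ d → f (i ∷ d)) (restrict k λ d → g (j ∷ d))))

module Series-embedding = JointlyInjective Series-rawRing ℕ R⟦_⟧ (λ k F → restrict k (coeff F))

Series-commutativeRing : CommutativeRing 0ℓ 0ℓ
Series-commutativeRing = Series-embedding.IsJointlyInjective.commutativeRing record
  { φ-cong  = λ k e → restrict-cong k (coeff-≈ e)
  ; φ-+     = λ k F G → restrict-+ k (coeff F) (coeff G)
  ; φ-*     = λ k F G → restrict-convolve k (coeff F) (coeff G)
  ; φ-neg   = λ k F → restrict-neg k (coeff F)
  ; φ-0     = restrict-0#
  ; φ-1     = restrict-1#
  ; reflect = λ e → mk≈ (restrict-reflect e)
  }

-- Binomial coefficients

module Binomials where
  open ≡
  open Data.Integer.Solver.+-*-Solver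
  open ≡-Reasoning

  falling-last : ∀ z s → falling z (suc s) ≡ falling z s ℤ.* (z ℤ.- + s)
  falling-last z zero    =
    solve 1 (λ z → z :* con 1ℤ := con 1ℤ :* (z :- con 0ℤ)) refl z
  falling-last z (suc s) = begin
    z ℤ.* falling (z ℤ.- 1ℤ) (suc s)
      ≡⟨ cong (z ℤ.*_) (falling-last (z ℤ.- 1ℤ) s) ⟩
    z ℤ.* (falling (z ℤ.- 1ℤ) s ℤ.* (z ℤ.- 1ℤ ℤ.- + s))
      ≡⟨ solve 3 (λ z F s → z :* (F :* (z :- con 1ℤ :- s)) := z :* F :* (z :- (con 1ℤ :+ s))) refl z (falling (z ℤ.- 1ℤ) s) (+ s) ⟩
    z ℤ.* falling (z ℤ.- 1ℤ) s ℤ.* (z ℤ.- + suc s) ∎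

  falling-suc : ∀ z s → falling (ℤ.suc z) (suc s) ≡ falling z (suc s) ℤ.+ + suc s ℤ.* falling z s
  falling-suc z s = begin
    ℤ.suc z ℤ.* falling (ℤ.suc z ℤ.- 1ℤ) s
      ≡⟨ cong (λ w → ℤ.suc z ℤ.* falling w s) (solve 1 (λ z → con 1ℤ :+ z :- con 1ℤ := z) refl z) ⟩
    ℤ.suc z ℤ.* falling z s
      ≡⟨ solve 3 (λ z F s → (con 1ℤ :+ z) :* F := F :* (z :- s) :+ (con 1ℤ :+ s) :* F) refl z (falling z s) (+ s) ⟩
    falling z s ℤ.* (z ℤ.- + s) ℤ.+ + suc s ℤ.* falling z s
      ≡⟨ cong (ℤ._+ + suc s ℤ.* falling z s) (falling-last z s) ⟨
    falling z (suc s) ℤ.+ + suc s ℤ.* falling z s ∎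

  +[1+s]!≡ : ∀ s → + (suc s !) ≡ + suc s ℤ.* + (s !)
  +[1+s]!≡ s = ℤₚ.pos-* (suc s) (s !)

  -- By `falling-suc` the values at z and z + 1 differ by s + 1 times a multiple of s!, so
  -- divisibility by (s + 1)! spreads from z = 0 in both directions.
  falling-divisible : ∀ s z → ∃[ c ] falling z s ≡ c ℤ.* + (s !)
  falling-divisible zero    z = 1ℤ , refl
  falling-divisible (suc s) z = go z
    where
    up : ∀ z → (∃[ c ] falling z (suc s) ≡ c ℤ.* + (suc s !)) → ∃[ c ] falling (ℤ.suc z) (suc s) ≡ c ℤ.* + (suc s !)
    up z (c , e) with falling-divisible s z
    ... | c′ , e′ = c ℤ.+ c′ , (begin
      falling (ℤ.suc z) (suc s)                          ≡⟨ falling-suc z s ⟩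
      falling z (suc s) ℤ.+ + suc s ℤ.* falling z s      ≡⟨ cong₂ (λ a b → a ℤ.+ + suc s ℤ.* b) e e′ ⟩
      c ℤ.* + (suc s !) ℤ.+ + suc s ℤ.* (c′ ℤ.* + (s !)) ≡⟨ cong (λ w → c ℤ.* w ℤ.+ + suc s ℤ.* (c′ ℤ.* + (s !))) (+[1+s]!≡ s) ⟩
      c ℤ.* (+ suc s ℤ.* + (s !)) ℤ.+ + suc s ℤ.* (c′ ℤ.* + (s !))
        ≡⟨ solve 4 (λ c c′ a b → c :* (a :* b) :+ a :* (c′ :* b) := (c :+ c′) :* (a :* b)) refl c c′ (+ suc s) (+ (s !)) ⟩
      (c ℤ.+ c′) ℤ.* (+ suc s ℤ.* + (s !))               ≡⟨ cong ((c ℤ.+ c′) ℤ.*_) (+[1+s]!≡ s) ⟨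
      (c ℤ.+ c′) ℤ.* + (suc s !)                         ∎)
    down : ∀ z → (∃[ c ] falling (ℤ.suc z) (suc s) ≡ c ℤ.* + (suc s !)) → ∃[ c ] falling z (suc s) ≡ c ℤ.* + (suc s !)
    down z (c , e) with falling-divisible s z
    ... | c′ , e′ = c ℤ.- c′ , (begin
      falling z (suc s)
        ≡⟨ solve 2 (λ a b → a := a :+ b :- b) refl (falling z (suc s)) (+ suc s ℤ.* falling z s) ⟩
      falling z (suc s) ℤ.+ + suc s ℤ.* falling z s ℤ.- + suc s ℤ.* falling z s
        ≡⟨ cong₂ ℤ._-_ (trans (sym (falling-suc z s)) (trans e (cong (c ℤ.*_) (+[1+s]!≡ s)))) (cong (+ suc s ℤ.*_) e′) ⟩
      c ℤ.* (+ suc s ℤ.* + (s !)) ℤ.- + suc s ℤ.* (c′ ℤ.* + (s !))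
        ≡⟨ solve 4 (λ c c′ a b → c :* (a :* b) :- a :* (c′ :* b) := (c :- c′) :* (a :* b)) refl c c′ (+ suc s) (+ (s !)) ⟩
      (c ℤ.- c′) ℤ.* (+ suc s ℤ.* + (s !))               ≡⟨ cong ((c ℤ.- c′) ℤ.*_) (+[1+s]!≡ s) ⟨
      (c ℤ.- c′) ℤ.* + (suc s !)                         ∎)
    go : ∀ z → ∃[ c ] falling z (suc s) ≡ c ℤ.* + (suc s !)
    go (+ zero)      = 0ℤ , refl
    go (+ suc n)     = up (+ n) (go (+ n))
    go -[1+ zero ]   = down -[1+ 0 ] (go (+ 0))
    go -[1+ suc n ]  = down -[1+ suc n ] (go -[1+ n ])

  -- The remainder equals (c - q) d and is less than d, which forces q = c.
  */ℕ : ∀ c d .{{_ : ℕ.NonZero d}} → (c ℤ.* + d) ℤ./ℕ d ≡ c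
  */ℕ c d = ℤₚ.i-j≡0⇒i≡j q c (ℤₚ.∣i∣≡0⇒i≡0 (ℕₚ.n<1⇒n≡0 (ℕₚ.*-cancelʳ-< d ℤ.∣ q ℤ.- c ∣ 1 small)))
    where
    q = (c ℤ.* + d) ℤ./ℕ d
    r = (c ℤ.* + d) ℤ.%ℕ d
    r≡ : + r ≡ ℤ.- ((q ℤ.- c) ℤ.* + d)
    r≡ = begin
      + r ≡⟨ solve 2 (λ r qd → r := r :+ qd :- qd) refl (+ r) (q ℤ.* + d) ⟩
      + r ℤ.+ q ℤ.* + d ℤ.- q ℤ.* + d ≡⟨ cong (ℤ._- q ℤ.* + d) (ℤ-DivMod.a≡a%ℕn+[a/ℕn]*n (c ℤ.* + d) d) ⟨
      c ℤ.* + d ℤ.- q ℤ.* + d ≡⟨ solve 3 (λ c q d → c :* d :- q :* d := :- ((q :- c) :* d)) refl c q (+ d) ⟩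
      ℤ.- ((q ℤ.- c) ℤ.* + d) ∎
    small : ℤ.∣ q ℤ.- c ∣ ℕ.* d < 1 ℕ.* d
    small = subst₂ _<_
      (trans (cong ℤ.∣_∣ r≡) (trans (ℤₚ.∣-i∣≡∣i∣ ((q ℤ.- c) ℤ.* + d)) (ℤₚ.abs-* (q ℤ.- c) (+ d))))
      (sym (ℕₚ.*-identityˡ d))
      (ℤ-DivMod.n%ℕd<d (c ℤ.* + d) d)

  binomial-*! : ∀ z s → binomial z s ℤ.* + (s !) ≡ falling z s
  binomial-*! z s with falling-divisible s z
  ... | c , e = trans (cong (ℤ._* + (s !))
    (trans (cong (λ w → ℤ._/ℕ_ w (s !) {{s ℕₚ.!≢0}}) e) (*/ℕ c (s !) {{s ℕₚ.!≢0}}))) (sym e)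

  binomial-unique : ∀ z s c → c ℤ.* + (s !) ≡ falling z s → binomial z s ≡ c
  binomial-unique z s c e =
    trans (cong (λ w → ℤ._/ℕ_ w (s !) {{s ℕₚ.!≢0}}) (sym e)) (*/ℕ c (s !) {{s ℕₚ.!≢0}})

  binomial-zeroˡ : ∀ s → binomial 0ℤ (suc s) ≡ 0ℤ
  binomial-zeroˡ s = binomial-unique 0ℤ (suc s) 0ℤ refl

  binomial-pascal : ∀ z s → binomial (ℤ.suc z) (suc s) ≡ binomial z (suc s) ℤ.+ binomial z s
  binomial-pascal z s = binomial-unique (ℤ.suc z) (suc s) _ (begin
    (binomial z (suc s) ℤ.+ binomial z s) ℤ.* + (suc s !)
      ≡⟨ ℤₚ.*-distribʳ-+ (+ (suc s !)) (binomial z (suc s)) (binomial z s) ⟩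
    binomial z (suc s) ℤ.* + (suc s !) ℤ.+ binomial z s ℤ.* + (suc s !)
      ≡⟨ cong₂ ℤ._+_ (binomial-*! z (suc s)) (cong (binomial z s ℤ.*_) (+[1+s]!≡ s)) ⟩
    falling z (suc s) ℤ.+ binomial z s ℤ.* (+ suc s ℤ.* + (s !))
      ≡⟨ cong (λ w → falling z (suc s) ℤ.+ w)
          (solve 3 (λ b a d → b :* (a :* d) := a :* (b :* d)) refl (binomial z s) (+ suc s) (+ (s !))) ⟩
    falling z (suc s) ℤ.+ + suc s ℤ.* (binomial z s ℤ.* + (s !))
      ≡⟨ cong (λ w → falling z (suc s) ℤ.+ + suc s ℤ.* w) (binomial-*! z s) ⟩
    falling z (suc s) ℤ.+ + suc s ℤ.* falling z s ≡⟨ falling-suc z s ⟨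
    falling (ℤ.suc z) (suc s) ∎)

open Binomials using (binomial-zeroˡ; binomial-pascal)

-- Convergence

module 𝕊 = CommutativeRing Series-commutativeRing
module ᵝ = CommutativeRing ℤ[β]-commutativeRing
module 𝕊-Sum = Algebra.Properties.Semiring.Sum 𝕊.semiring

module 𝕊-Id = RingIdentities Series-commutativeRing

infix 4 _≈[_]_
record _≈[_]_ (F : Series) (N : ℕ) (G : Series) : Set where
  constructor mk≈[]
  field below : ∀ e → degree e < N → coeff F e ≈ᵝ coeff G e
open _≈[_]_

≈⇒≈[] : ∀ {F G} N → F ≈ G → F ≈[ N ] G
≈⇒≈[] N e = mk≈[] λ d _ → coeff-≈ e d

≈[]⇒≈ : ∀ {F G} → (∀ N → F ≈[ N ] G) → F ≈ G
≈[]⇒≈ h = mk≈ λ e → below (h (suc (degree e))) e ℕₚ.≤-refl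

≈[]-sym : ∀ {N F G} → F ≈[ N ] G → G ≈[ N ] F
≈[]-sym h = mk≈[] λ e l → ≈ᵝ-sym (below h e l)

≈[]-trans : ∀ {N F G H} → F ≈[ N ] G → G ≈[ N ] H → F ≈[ N ] H
≈[]-trans h h′ = mk≈[] λ e l → ≈ᵝ-trans (below h e l) (below h′ e l)

≈[]-+ : ∀ {N F F′ G G′} → F ≈[ N ] F′ → G ≈[ N ] G′ → F + G ≈[ N ] F′ + G′
≈[]-+ h h′ = mk≈[] λ e l → +ᵝ-cong (below h e l) (below h′ e l)

-- F - G has order at least N, and multiplication by c does not lower the order.
≈[]-*ˡ : ∀ {N F G} c → F ≈[ N ] G → c * F ≈[ N ] c * G
≈[]-*ˡ {N} {F} {G} c h = mk≈[] λ e l → ≈ᵝ-trans (coeff-≈ (𝕊-Id.c*a≈c*b+c*[a-b] c F G) e)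
  (≈ᵝ-trans (+ᵝ-cong ≈ᵝ-refl (*-orderʳ N c (F + - G) difference e l)) (ᵝ.+-identityʳ _))
  where
  difference : Order≥ N (coeff (F + - G))
  difference d l = ≈ᵝ-trans (+ᵝ-cong (below h d l) ≈ᵝ-refl) (ᵝ.-‿inverseʳ (coeff G d))

partialSum : (ℕ → Series) → ℕ → Series
partialSum F k = Σˢ {k} λ i → F (toℕ i)

-- F sums to s in the topology of ℤ[β][[x]] given by the total degree.
infix 4 _⇒_
record _⇒_ (F : ℕ → Series) (s : Series) : Set where
  constructor mk⇒
  field limit : ∀ N → ∃[ K ] (∀ k → K ≤ k → partialSum F k ≈[ N ] s)
open _⇒_

partialSum-cong : ∀ {F G} → (∀ k → F k ≈ G k) → ∀ k → partialSum F k ≈ partialSum G k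
partialSum-cong e k = 𝕊-Sum.sum-cong-≋ {k} λ i → e (toℕ i)

⇒-unique : ∀ {F s t} → F ⇒ s → F ⇒ t → s ≈ t
⇒-unique h h′ = ≈[]⇒≈ λ N → let K , p = limit h N ; K′ , p′ = limit h′ N in
  ≈[]-trans (≈[]-sym (p (K ℕ.+ K′) (ℕₚ.m≤m+n K K′))) (p′ (K ℕ.+ K′) (ℕₚ.m≤n+m K′ K))

⇒-cong : ∀ {F G s} → (∀ k → F k ≈ G k) → F ⇒ s → G ⇒ s
⇒-cong e h = mk⇒ λ N → let K , p = limit h N in
  K , λ k l → ≈[]-trans (≈⇒≈[] N (𝕊.sym (partialSum-cong e k))) (p k l)

⇒-+ : ∀ {F G s t} → F ⇒ s → G ⇒ t → (λ k → F k + G k) ⇒ s + t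
⇒-+ {F} {G} h h′ = mk⇒ λ N → let K , p = limit h N ; K′ , p′ = limit h′ N in
  K ℕ.+ K′ , λ k l → ≈[]-trans
    (≈⇒≈[] N (𝕊-Sum.∑-distrib-+ {k} (λ i → F (toℕ i)) (λ i → G (toℕ i))))
    (≈[]-+ (p k (ℕₚ.≤-trans (ℕₚ.m≤m+n K K′) l)) (p′ k (ℕₚ.≤-trans (ℕₚ.m≤n+m K′ K) l)))

⇒-* : ∀ {F s} c → F ⇒ s → (λ k → c * F k) ⇒ c * s
⇒-* {F} c h = mk⇒ λ N → let K , p = limit h N in
  K , λ k l → ≈[]-trans (≈⇒≈[] N (𝕊.sym (𝕊-Sum.*-distribˡ-sum {k} c (λ i → F (toℕ i))))) (≈[]-*ˡ c (p k l))

⇒-suc : ∀ {F s} → (λ k → F (suc k)) ⇒ s → F ⇒ F 0 + s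
⇒-suc {F} h = mk⇒ λ N → let K , p = limit h N in
  suc K , λ { (suc k) (s≤s l) → ≈[]-+ (≈⇒≈[] {F 0} N 𝕊.refl) (p k l) }

⇒-tail : ∀ {F s} → F ⇒ s → (λ k → F (suc k)) ⇒ s + - F 0
⇒-tail {F} h = mk⇒ λ N → let K , p = limit h N in
  K , λ k l → ≈[]-trans (≈⇒≈[] N (𝕊.sym (𝕊-Id.a+b-a≈b (F 0) (partialSum (λ k → F (suc k)) k))))
    (≈[]-+ (p (suc k) (ℕₚ.m≤n⇒m≤1+n l)) (≈⇒≈[] { - F 0} N 𝕊.refl))

⇒-zero : ∀ {F} → (∀ k → F k ≈ 0#) → F ⇒ 0#
⇒-zero e = ⇒-cong (λ k → 𝕊.sym (e k)) (mk⇒ λ N → 0 , λ k _ → ≈⇒≈[] N (𝕊-Sum.sum-replicate-zero k))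

coeff-Σˢ : ∀ {n} (F : Fin n → Series) e → coeff (Σˢ F) e ≈ᵝ Σᵝ λ i → coeff (F i) e
coeff-Σˢ {zero}  F e = 0#-order (suc (degree e)) e ℕₚ.≤-refl
coeff-Σˢ {suc n} F e = +ᵝ-cong ≈ᵝ-refl (coeff-Σˢ (λ i → F (fsuc i)) e)

-- `Σ∞` truncates at a point depending on the monomial; in degrees below N that point is at most N +
-- |z|, which makes the convergence uniform there.
Σ∞-⇒ : ∀ z F (o : ∀ k → Order≥ℤ (z ℤ.+ + k) (F k)) → F ⇒ Σ∞ F (summable-shift z F o)
Σ∞-⇒ z F o = mk⇒ λ N → N ℕ.+ ℤ.∣ z ∣ , λ k l → mk≈[] λ e d → ≈ᵝ-trans (coeff-Σˢ (λ (i : Fin k) → F (toℕ i)) e)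
  (Σᵝ-truncate k (proj₁ (summable e)) (λ _ → ≈ᵝ-refl)
    (λ i k≤i → proj₂ (summable e) i (ℕₚ.≤-trans (ℕₚ.+-monoˡ-≤ ℤ.∣ z ∣ d) (ℕₚ.≤-trans l k≤i)))
    (proj₂ (summable e)))
  where summable = summable-shift z F o

fromℤ-+ : ∀ a b → fromℤ (a ℤ.+ b) ≈ fromℤ a + fromℤ b
fromℤ-+ a b = mk≈ go
  where
  go : ∀ e → coeff (fromℤ (a ℤ.+ b)) e ≈ᵝ coeff (fromℤ a) e +ᵝ coeff (fromℤ b) e
  go []          = ≈ᵝ-refl
  go (zero  ∷ e) = go e
  go (suc _ ∷ e) = ≈ᵝ-refl

fromℤ-0 : fromℤ 0ℤ ≈ 0#
fromℤ-0 = mk≈ go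
  where
  go : ∀ e → coeff (fromℤ 0ℤ) e ≈ᵝ coeff 0# e
  go []          = mk≈ᵝ λ { zero → ≡.refl ; (suc _) → ≡.refl }
  go (zero  ∷ e) = go e
  go (suc _ ∷ e) = ≈ᵝ-refl

-- The difference d of the two series satisfies d = - β d x_k, so every bound on its order improves
-- by one.
1+βx-cancelˡ : ∀ k {a b} → (1# + β * x k) * a ≈ (1# + β * x k) * b → a ≈ b
1+βx-cancelˡ k {a} {b} h = x∙y⁻¹≈ε⇒x≈y a b (mk≈ λ e → ≈ᵝ-trans (vanish (suc (degree e)) e ℕₚ.≤-refl)
    (≈ᵝ-sym (0#-order (suc (degree e)) e ℕₚ.≤-refl)))
  where
  open Algebra.Properties.Ring 𝕊.ring using (-‿distribˡ-*; -‿distribʳ-*)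
  open Algebra.Properties.Group 𝕊.+-group using (x∙y⁻¹≈ε⇒x≈y) renaming (inverseˡ-unique to +-inverseˡ-unique)
  open import Relation.Binary.Reasoning.Setoid 𝕊.setoid
  d = a + - b
  [1+βx]d≈0 : d + β * x k * d ≈ 0#
  [1+βx]d≈0 = begin
    d + β * x k * d                                      ≈⟨ 𝕊.+-congʳ (𝕊.*-identityˡ d) ⟨
    1# * d + β * x k * d                                 ≈⟨ 𝕊.distribʳ d 1# (β * x k) ⟨
    (1# + β * x k) * (a + - b)                           ≈⟨ 𝕊.distribˡ (1# + β * x k) a (- b) ⟩
    (1# + β * x k) * a + (1# + β * x k) * - b            ≈⟨ 𝕊.+-cong h (𝕊.sym (-‿distribʳ-* (1# + β * x k) b)) ⟩
    (1# + β * x k) * b + - ((1# + β * x k) * b)          ≈⟨ 𝕊.-‿inverseʳ ((1# + β * x k) * b) ⟩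
    0#                                                   ∎
  d≈-βxd : d ≈ - β * d * x k
  d≈-βxd = begin
    d                      ≈⟨ +-inverseˡ-unique d (β * x k * d) [1+βx]d≈0 ⟩
    - (β * x k * d)        ≈⟨ 𝕊.-‿cong (𝕊.trans (𝕊.*-assoc β (x k) d) (𝕊.trans (𝕊.*-congˡ (𝕊.*-comm (x k) d)) (𝕊.sym (𝕊.*-assoc β d (x k))))) ⟩
    - (β * d * x k)        ≈⟨ -‿distribˡ-* (β * d) (x k) ⟩
    - (β * d) * x k        ≈⟨ 𝕊.*-congʳ (-‿distribˡ-* β d) ⟩
    - β * d * x k          ∎
  vanish : ∀ n → Order≥ n (coeff d)
  vanish (suc n) e l = ≈ᵝ-trans (coeff-≈ d≈-βxd e)
    (*-order n 1 (- β * d) (x k) (*-orderʳ n (- β) d (vanish n)) (variableAt-order (ℕ.pred k)) e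
      (≡.subst (degree e <_) (ℕₚ.+-comm 1 n) l))

[1+βx_] : ℕ → Series
[1+βx i ] = 1# + β * x i

A[_/_] : ℕ → ℕ → ℤ → Series
A[ p / q ] m = [u^ m ] productᵘ (interval q p)

factor-peel : ∀ q B m → [u^ m ] (factor q *ᵘ B) ≈ [1+βx q ] * ([u^ m ] B) + x q * ([u^ ℤ.pred m ] (factor q *ᵘ B))
factor-peel q B (+ zero)  = GeometricFactor.times-zero Series-commutativeRing [1+βx q ] (x q) B
factor-peel q B (+ suc n) = GeometricFactor.times-suc Series-commutativeRing [1+βx q ] (x q) B n
factor-peel q B -[1+ n ]  = GeometricFactor.times-neg Series-commutativeRing [1+βx q ] (x q)

A-peel : ∀ {p q} → q ≤ p → ∀ m → A[ p / q ] m ≈ [1+βx q ] * A[ p / suc q ] m + x q * A[ p / q ] (ℤ.pred m)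
A-peel {p} {q} q≤p m = ≡.subst
  (λ is → [u^ m ] productᵘ is ≈ [1+βx q ] * A[ p / suc q ] m + x q * ([u^ ℤ.pred m ] productᵘ is))
  (≡.sym (interval-∷ q≤p)) (factor-peel q (productᵘ (interval (suc q) p)) m)

A-empty : ∀ {p q} → p < q → ∀ n → A[ p / q ] (+ suc n) ≈ 0#
A-empty p<q n = ≡.subst (λ is → productᵘ is (suc n) ≈ 0#) (≡.sym (interval-[] p<q)) 𝕊.refl

A-empty-zero : ∀ {p q} → p < q → A[ p / q ] 0ℤ ≈ 1#
A-empty-zero p<q = ≡.subst (λ is → productᵘ is 0 ≈ 1#) (≡.sym (interval-[] p<q)) 𝕊.refl

E-term : ℕ → ℕ → ℤ → ℤ → ℕ → Series
E-term p q n m s = fromℤ (binomial n s) * β ^ˢ s * G[ p / q ] (m ℤ.+ + s)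

E-term-order : ∀ p q n m s → Order≥ℤ (m ℤ.+ + s) (E-term p q n m s)
E-term-order p q n m s = *-orderℤ (m ℤ.+ + s) (fromℤ (binomial n s) * β ^ˢ s)
  (G[ p / q ] (m ℤ.+ + s)) (G[/]-order p q (m ℤ.+ + s))

E : ℕ → ℕ → ℤ → ℤ → Series
E p q n m = Σ∞ (E-term p q n m) (summable-shift m (E-term p q n m) (E-term-order p q n m))

summation : Summation Series-commutativeRing
summation = record
  { _⇒_ = _⇒_ ; ⇒-unique = ⇒-unique ; ⇒-cong = ⇒-cong ; ⇒-+ = ⇒-+ ; ⇒-* = ⇒-*
  ; ⇒-suc = ⇒-suc ; ⇒-tail = ⇒-tail ; ⇒-zero = ⇒-zero }

E-laws : EntryLaws Series-commutativeRing β x E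
E-laws = GeneratingFunctions.Entries.entryLaws Series-commutativeRing summation β x 1+βx-cancelˡ
  binomial (λ _ → ≡.refl) binomial-zeroˡ binomial-pascal fromℤ fromℤ-0 𝕊.refl fromℤ-+
  A[_/_] A-peel A-empty A-empty-zero (λ _ _ _ → 𝕊.refl) G[_/_] E
  (λ p q m → Σ∞-⇒ m (G-term p q m) (G-term-order p q m))
  (λ p q n m → Σ∞-⇒ m (E-term p q n m) (E-term-order p q n m))

-- The theorem

extend-toℕ : ∀ {r} (h : Fin r → ℕ) i → extend h (toℕ i) ≡ h i
extend-toℕ h fzero    = ≡.refl
extend-toℕ h (fsuc i) = extend-toℕ (λ i → h (fsuc i)) i

extend-fromℕ< : ∀ {r} (h : Fin r → ℕ) {i} (i<r : i < r) → extend h i ≡ h (fromℕ< i<r)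
extend-fromℕ< h i<r = ≡.trans (≡.cong (extend h) (≡.sym (Finₚ.toℕ-fromℕ< i<r))) (extend-toℕ h (fromℕ< i<r))

extend-support : ∀ {r} (h : Fin r → ℕ) i → r ≤ i → extend h i ≡ 0
extend-support {zero}  h i       _       = ≡.refl
extend-support {suc r} h (suc i) (s≤s l) = extend-support (λ i → h (fsuc i)) i l

extend-decreasing : ∀ {r} (h : Fin r → ℕ) → WeaklyDecreasing h → ∀ i → extend h (suc i) ≤ extend h i
extend-decreasing {zero}        h d i       = z≤n
extend-decreasing {suc zero}    h d zero    = z≤n
extend-decreasing {suc (suc r)} h d zero    = d fzero (fsuc fzero) z≤n
extend-decreasing {suc r}       h d (suc i) =
  extend-decreasing (λ i → h (fsuc i)) (λ i j l → d (fsuc i) (fsuc j) (s≤s l)) i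

extend-≤ : ∀ {r} (h k : Fin r → ℕ) → (∀ i → h i ≤ k i) → ∀ i → extend h i ≤ extend k i
extend-≤ {zero}  h k l i       = z≤n
extend-≤ {suc r} h k l zero    = l fzero
extend-≤ {suc r} h k l (suc i) = extend-≤ (λ i → h (fsuc i)) (λ i → k (fsuc i)) (λ i → l (fsuc i)) i

extend-flagging : ∀ {r} (lam μ f g : Fin r → ℕ) → IsFlagging lam μ f g →
  ∀ i → extend μ i < extend lam (suc i) → extend g i ≤ extend g (suc i) × extend f i ≤ extend f (suc i)
extend-flagging {r} lam μ f g flagging i l with suc i ℕₚ.<? r
... | no  i≮r = contradiction (≡.subst (extend μ i <_) (extend-support lam (suc i) (ℕₚ.≮⇒≥ i≮r)) l) λ ()
... | yes p   =
  let q = ℕₚ.<-trans (ℕₚ.n<1+n i) p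
      g≤ , f≤ = flagging (fromℕ< q) (fromℕ< p)
        (≡.trans (Finₚ.toℕ-fromℕ< p) (≡.cong suc (≡.sym (Finₚ.toℕ-fromℕ< q))))
        (≡.subst₂ _<_ (extend-fromℕ< μ q) (extend-fromℕ< lam p) l)
  in ≡.subst₂ _≤_ (≡.sym (extend-fromℕ< g q)) (≡.sym (extend-fromℕ< g p)) g≤ ,
     ≡.subst₂ _≤_ (≡.sym (extend-fromℕ< f q)) (≡.sym (extend-fromℕ< f p)) f≤

module 𝕊-Det = Determinant Series-commutativeRing
module 𝕊-Formula = DeterminantFormula Series-commutativeRing β x E E-laws
module 𝕊-Fillings = Fillings Series-commutativeRing β x

det≈det : ∀ {n} (M N : Fin n → Fin n → Series) → (∀ a b → M a b ≈ N a b) → det M ≈ 𝕊-Det.det N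
det≈det {zero}  M N e = 𝕊.refl
det≈det {suc n} M N e = 𝕊-Sum.sum-cong-≋ λ j →
  𝕊.*-congˡ {(- 1#) ^ˢ toℕ j} (𝕊.*-cong (e fzero j)
    (det≈det (λ a b → M (fsuc a) (punchIn j b)) (λ a b → N (fsuc a) (punchIn j b)) λ a b → e (fsuc a) (punchIn j b)))

-- The truncation points depend only on the degree and the subscript, not on the proofs of the order
-- bounds, so the coefficients agree definitionally.
entry≈E : ∀ {r} (lam μ f g : Fin r → ℕ) i j →
  entry lam μ f g i j ≈ E (f i) (g j) (toℕ i ⊖ toℕ j) (subscript lam μ f g i j)
entry≈E lam μ f g i j = mk≈ λ _ → ≈ᵝ-refl

entry≈entry : ∀ {r} (lam μ f g : Fin r → ℕ) i j →
  entry lam μ f g i j ≈ 𝕊-Formula.entryMatrix r (extend lam) (extend μ) (extend f) (extend g) i j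
entry≈entry lam μ f g i j = 𝕊.trans (entry≈E lam μ f g i j) (𝕊.reflexive
  (≡.trans
    (≡.cong₂ (λ p q → E p q (toℕ i ⊖ toℕ j) ((lam i ⊖ μ j) ℤ.+ (toℕ j ⊖ toℕ i)))
      (≡.sym (extend-toℕ f i)) (≡.sym (extend-toℕ g j)))
    (≡.cong₂ (λ l m → E (extend f (toℕ i)) (extend g (toℕ j)) (toℕ i ⊖ toℕ j) ((l ⊖ m) ℤ.+ (toℕ j ⊖ toℕ i)))
      (≡.sym (extend-toℕ lam i)) (≡.sym (extend-toℕ μ j)))))

theorem4p7 : ∀ {r : ℕ} (lam μ f g : Fin r → ℕ) →
    WeaklyDecreasing lam → Positive lam →
    WeaklyDecreasing μ → (∀ i → μ i ≤ lam i) →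
    Positive f → Positive g → IsFlagging lam μ f g →
    G̃ lam μ f g ≈ G lam μ f g
theorem4p7 {r} lam μ f g lam-dec _ μ-dec μ≤lam _ _ flagging = 𝕊.trans
  (det≈det (entry lam μ f g) (𝕊-Formula.entryMatrix r (extend lam) (extend μ) (extend f) (extend g)) (entry≈entry lam μ f g))
  (𝕊.trans (𝕊-Formula.det≈tableauSum r _ flagged ℕₚ.≤-refl)
    (𝕊.sym (𝕊-Fillings.tableaux≈tableauSum lam μ f g)))
  where
  flagged : Flagged r (extend lam) (extend μ) (extend f) (extend g)
  flagged = record
    { lam-dec = extend-decreasing lam lam-dec
    ; μ-dec   = extend-decreasing μ μ-dec
    ; μ≤lam   = extend-≤ μ lam μ≤lam
    ; flag    = extend-flagging lam μ f g flagging
    ; support = extend-support lam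
    }
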